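{- Let $m\ge2$ and let $\mathcal{H}\in\mathcal{TC}_1$ have $k$ edges. Then: (i) $\lambda_1(\mathcal{H})\le\lambda_1(T_1C(k-5,0,0,0))$, and equality holds only when $\mathcal{H}=T_1C(k-5,0,0,0)$. (ii) $\lambda_1(T_1C(k-5,0,0,0))<\dfrac{m+1+\sqrt{(m+1)^2+4(k-3)(m-1)}}{2m-2}$.
   Context: A hypergraph has a finite vertex set and an edge set of non-empty subsets of the vertex set; it is $m$-uniform if all edges have cardinality $m$, and linear if two distinct edges share at most one vertex. The adjacency matrix of a linear $m$-uniform hypergraph has $(i,j)$ entry $\frac{1}{m-1}$ if $i\ne j$ lie in a common edge, and $0$ otherwise; $\lambda_1$ denotes the spectral radius of this matrix. The $m$-th power hypergraph of a graph $G(V,E)$ is the $m$-uniform hypergraph obtained by adding to each edge $e\in E$ $m-2$ new vertices $v_{e,1},\dots,v_{e,m-2}$ (distinct for distinct edges). $\mathcal{P}(\mathcal{H})$ denotes the set of $m$-th power hypergraphs of graphs. A loose cycle of length $l\ge3$, $v_1e_1v_2e_2\dots v_le_lv_1$, is the $m$-uniform hypergraph with edges $e_1,\dots,e_l$ in which $e_{i-1}\cap e_i=\{v_i\}$ (indices mod $l$, the $v_i$ distinct) and non-consecutive edges are disjoint. A linear hypergraph is $3$-cyclic (tricyclic) if it contains exactly three loose cycles. A connected $m$-uniform $3$-cyclic linear hypergraph with $n$ vertices and $k$ edges is of Type I if $n=k(m-1)-1$. $\mathcal{TC}_1$ is the collection of (connected) $3$-cyclic Type I linear hypergraphs in $\mathcal{P}(\mathcal{H})$.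 Attaching a pendant edge at a vertex $v$ means adding a new edge consisting of $v$ and $m-1$ new vertices. $T_1C(l_1,l_2,l_3,l_4)\in\mathcal{TC}_1$ is the hypergraph consisting of the five edges $e_1,\dots,e_5$ forming the three loose cycles $v_1e_1v_2e_2v_3e_3v_1$, $v_1e_3v_3e_4v_4e_5v_1$ and $v_1e_1v_2e_2v_3e_4v_4e_5v_1$, together with $l_1,l_2,l_3,l_4$ pendant edges attached at $v_1,v_2,v_3,v_4$, respectively. Equality of hypergraphs means isomorphism. -}

module Defs where

open import Level using (_⊔_; suc)
open import Algebra.Bundles using (CommutativeRing)
open import Algebra.Core using (Op₁; Op₂)
open import Algebra.Structures using (IsCommutativeRing)
import Algebra.Properties.Monoid.Mult as Mult
import Algebra.Properties.Monoid.Sum as Sum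
open import Data.Bool.Base using (if_then_else_)
import Data.Bool.Properties as Bool
open import Data.Fin.Base
  using (Fin; zero; inject₁; fromℕ; _↑ˡ_; _↑ʳ_; quotient; combine; splitAt; join)
  renaming (suc to fsuc)
open import Data.Fin.Patterns using (0F; 1F; 2F; 3F; 4F)
open import Data.Fin.Properties
  using (_≟_; any?; all?; join-splitAt; remQuot-combine)
open import Data.Fin.Subset using (Subset; inside; outside; _∈_; _∩_; _∪_; ⁅_⁆; ⊥; ∣_∣; Nonempty; Empty)
open import Data.Fin.Subset.Properties using (_∈?_; ∉⊥; nonempty?)
open import Data.Nat.Base as ℕ using (ℕ; NonTrivial; _∸_)
open import Data.Product.Base using (Σ-syntax; ∃; ∃-syntax; _×_; _,_; proj₁; proj₂)
open import Data.Sum.Base using (inj₁; inj₂; [_,_]′)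
open import Data.Vec.Base using (_++_; lookup; tabulate; replicate)
open import Data.Vec.Properties
  using (++-injectiveˡ; ++-injectiveʳ; lookup-++ˡ; lookup-++ʳ; lookup∘tabulate;
         lookup⇒[]=; []=⇒lookup; ≡-dec)
open import Function.Base using (_∘_)
open import Function.Bundles using (_↔_; _⇔_; Inverse)
open import Function.Definitions using (Injective)
open import Relation.Binary.Core using (Rel)
open import Relation.Binary.Construct.Closure.ReflexiveTransitive using (Star)
import Relation.Binary.Construct.NonStrictToStrict as ToStrict
open import Relation.Binary.PropositionalEquality
  using (_≡_; _≢_; refl; sym; trans; cong; subst)
open import Relation.Binary.Structures using (IsDecTotalOrder)
open import Relation.Nullary using (¬_; Dec; does; yes; no; contradiction)
open import Relation.Nullary.Decidable
  using (¬?; _×-dec_; _→-dec_; from-yes; dec-true)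
open import Relation.Unary using (Pred)

-- The real numbers, axiomatised as usual (classically, up to unique
-- isomorphism) as a Dedekind-complete ordered field.  The inverse is total;
-- its value at 0# is unspecified.

record CompleteOrderedField c ℓ₁ ℓ₂ : Set (suc (c ⊔ ℓ₁ ⊔ ℓ₂)) where
  infix  8 _⁻¹
  infix  8 -_
  infixl 7 _*_
  infixl 6 _+_
  infix  4 _≈_ _≤_
  field
    Carrier           : Set c
    _≈_               : Rel Carrier ℓ₁
    _≤_               : Rel Carrier ℓ₂
    _+_ _*_           : Op₂ Carrier
    -_ _⁻¹            : Op₁ Carrier
    0# 1#             : Carrier
    isCommutativeRing : IsCommutativeRing _≈_ _+_ _*_ -_ 0# 1#
    isDecTotalOrder   : IsDecTotalOrder _≈_ _≤_
    0≉1               : ¬ 0# ≈ 1#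
    ⁻¹-inverse        : ∀ {x} → ¬ x ≈ 0# → x * x ⁻¹ ≈ 1#
    +-monoˡ-≤         : ∀ {x y} z → x ≤ y → x + z ≤ y + z
    *-nonNegative     : ∀ {x y} → 0# ≤ x → 0# ≤ y → 0# ≤ x * y

  UpperBound : Pred Carrier (c ⊔ ℓ₁ ⊔ ℓ₂) → Carrier → Set (c ⊔ ℓ₁ ⊔ ℓ₂)
  UpperBound P b = ∀ x → P x → x ≤ b

  field
    supremum : ∀ (P : Pred Carrier (c ⊔ ℓ₁ ⊔ ℓ₂)) → ∃ P → ∃ (UpperBound P) →
               ∃[ s ] UpperBound P s × (∀ b → UpperBound P b → s ≤ b)

  commutativeRing : CommutativeRing c ℓ₁
  commutativeRing = record { isCommutativeRing = isCommutativeRing }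

  open CommutativeRing commutativeRing public
    using (_-_; +-monoid)
  open ToStrict _≈_ _≤_ public using (_<_)
  open Sum +-monoid public using (sum)

  fromNat : ℕ → Carrier
  fromNat n = Mult._×_ +-monoid n 1#

  IsSqrt : Carrier → Carrier → Set (ℓ₁ ⊔ ℓ₂)
  IsSqrt x s = 0# ≤ s × s * s ≈ x

module SpectralRadius {c ℓ₁ ℓ₂} (ℝ : CompleteOrderedField c ℓ₁ ℓ₂) where
  open CompleteOrderedField ℝ

  infix  4 _≈ᶜ_
  infixl 7 _*ᶜ_

  -- (a , b) stands for a + b i.
  ℂ : Set c
  ℂ = Carrier × Carrier

  _≈ᶜ_ : Rel ℂ ℓ₁
  (a , b) ≈ᶜ (c , d) = a ≈ c × b ≈ d

  0ᶜ : ℂ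
  0ᶜ = 0# , 0#

  _*ᶜ_ : Op₂ ℂ
  (a , b) *ᶜ (c , d) = a * c - b * d , a * d + b * c

  ∣_∣²ᶜ : ℂ → Carrier
  ∣ a , b ∣²ᶜ = a * a + b * b

  Matrix : ℕ → Set c
  Matrix n = Fin n → Fin n → Carrier

  _·_ : ∀ {n} → Matrix n → (Fin n → ℂ) → Fin n → ℂ
  (A · x) i = sum (λ j → A i j * proj₁ (x j)) , sum (λ j → A i j * proj₂ (x j))

  IsEigenvalue : ∀ {n} → Matrix n → ℂ → Set (c ⊔ ℓ₁)
  IsEigenvalue A z =
    ∃[ x ] ¬ (∀ i → x i ≈ᶜ 0ᶜ) × (∀ i → (A · x) i ≈ᶜ z *ᶜ x i)

  -- ρ is the largest modulus of a complex eigenvalue of A.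
  IsSpectralRadius : ∀ {n} → Matrix n → Carrier → Set (c ⊔ ℓ₁ ⊔ ℓ₂)
  IsSpectralRadius A ρ =
    0# ≤ ρ ×
    (∃[ z ] IsEigenvalue A z × ∣ z ∣²ᶜ ≈ ρ * ρ) ×
    (∀ z → IsEigenvalue A z → ∣ z ∣²ᶜ ≤ ρ * ρ)

record Hypergraph : Set where
  field
    order          : ℕ
    size           : ℕ
    edge           : Fin size → Subset order
    edge-nonempty  : ∀ e → Nonempty (edge e)
    edge-injective : Injective _≡_ _≡_ edge

  Vertex Edge : Set
  Vertex = Fin order
  Edge   = Fin size

open Hypergraph public

infix 4 _≅_
_≅_ : Hypergraph → Hypergraph → Set
G ≅ H =
  Σ[ σ ∈ Vertex G ↔ Vertex H ] Σ[ τ ∈ Edge G ↔ Edge H ]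
    (∀ v e → v ∈ edge G e ⇔ Inverse.to σ v ∈ edge H (Inverse.to τ e))

Uniform : ℕ → Hypergraph → Set
Uniform m H = ∀ e → ∣ edge H e ∣ ≡ m

Linear : Hypergraph → Set
Linear H = ∀ e f → e ≢ f → ∣ edge H e ∩ edge H f ∣ ℕ.≤ 1

Joined : (H : Hypergraph) → Rel (Vertex H) _
Joined H u v = ∃[ e ] u ∈ edge H e × v ∈ edge H e

joined? : ∀ H u v → Dec (Joined H u v)
joined? H u v = any? λ e → u ∈? edge H e ×-dec v ∈? edge H e

Connected : Hypergraph → Set
Connected H = ∀ u v → Star (Joined H) u v

-- The adjacency matrix of H regarded as an m-uniform linear hypergraph.
module _ {c ℓ₁ ℓ₂} (ℝ : CompleteOrderedField c ℓ₁ ℓ₂) where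
  open CompleteOrderedField ℝ
  open SpectralRadius ℝ

  adjacency : ℕ → (H : Hypergraph) → Matrix (order H)
  adjacency m H i j =
    if does (¬? (i ≟ j) ×-dec joined? H i j) then fromNat (m ∸ 1) ⁻¹ else 0#

cyclicPred : ∀ {l} → Fin l → Fin l
cyclicPred zero     = fromℕ _
cyclicPred (fsuc i) = inject₁ i

-- S is the edge set of a loose cycle v₁e₁v₂e₂…vₗeₗv₁ of H.  The conditions
-- force the edges eᵢ to be distinct when H is m-uniform with m ≥ 2.
record IsLooseCycle (H : Hypergraph) (S : Subset (size H)) : Set where
  field
    l        : ℕ
    l≥3      : 3 ℕ.≤ l
    v        : Fin l → Vertex H
    e        : Fin l → Edge H
    distinct : Injective _≡_ _≡_ v
    meet     : ∀ i → edge H (e (cyclicPred i)) ∩ edge H (e i) ≡ ⁅ v i ⁆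
    disjoint : ∀ i j → i ≢ j → i ≢ cyclicPred j → j ≢ cyclicPred i →
               Empty (edge H (e i) ∩ edge H (e j))
    edgeSet  : ∀ f → f ∈ S ⇔ (∃[ i ] e i ≡ f)

-- Loose cycles are counted as subhypergraphs, that is, by their edge sets.
ExactlyThreeLooseCycles : Hypergraph → Set
ExactlyThreeLooseCycles H =
  Σ[ C ∈ (Fin 3 → Subset (size H)) ]
    Injective _≡_ _≡_ C × (∀ S → IsLooseCycle H S ⇔ (∃[ i ] C i ≡ S))

∈-++ˡ : ∀ {a b} {p : Subset a} {q : Subset b} {i} → i ∈ p → i ↑ˡ b ∈ p ++ q
∈-++ˡ {p = p} {q} {i} i∈p =
  lookup⇒[]= _ (p ++ q) (trans (lookup-++ˡ p q i) ([]=⇒lookup i∈p))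

-- The vertices of the i-th of l consecutive blocks of r vertices.
block : ∀ {l} r → Fin l → Subset (l ℕ.* r)
block r i = tabulate λ p → does (quotient r p ≟ i)

∈-block : ∀ {l r} (i : Fin l) (q : Fin r) → combine i q ∈ block r i
∈-block {l} {r} i q = lookup⇒[]= _ (block r i)
  (trans (lookup∘tabulate _ (combine i q))
         (dec-true (quotient r (combine i q) ≟ i) (cong proj₁ (remQuot-combine i q))))

∈-block⁻ : ∀ {l r} {i : Fin l} {p} → p ∈ block r i → quotient r p ≡ i
∈-block⁻ {r = r} {i} {p} p∈
  with quotient r p ≟ i | trans (sym (lookup∘tabulate (λ p → does (quotient r p ≟ i)) p)) ([]=⇒lookup p∈)
... | yes eq | _ = eq
... | no _   | ()

block-injective : ∀ {l r} (q : Fin r) {i j : Fin l} → block r i ≡ block r j → i ≡ j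
block-injective q {i} {j} eq =
  trans (sym (cong proj₁ (remQuot-combine i q)))
        (∈-block⁻ (subst (combine i q ∈_) eq (∈-block i q)))

block≢⊥ : ∀ {l r} (q : Fin r) {i : Fin l} → block r i ≢ ⊥
block≢⊥ q {i} eq = ∉⊥ (subst (combine i q ∈_) eq (∈-block i q))

-- The m-th power: block e consists of the vertices v_{e,1}, …, v_{e,m-2}.
power : ℕ → Hypergraph → Hypergraph
power m G = record
  { order          = order G ℕ.+ size G ℕ.* (m ∸ 2)
  ; size           = size G
  ; edge           = λ e → edge G e ++ block (m ∸ 2) e
  ; edge-nonempty  = λ e → let v , v∈e = edge-nonempty G e in _ , ∈-++ˡ v∈e
  ; edge-injective = λ eq → edge-injective G (++-injectiveˡ _ _ eq)
  }

-- A (simple) graph is a 2-uniform hypergraph.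
InPowers : ℕ → Hypergraph → Set
InPowers m H = ∃[ G ] Uniform 2 G × H ≅ power m G

record TC₁ (m : ℕ) (H : Hypergraph) : Set where
  field
    uniform   : Uniform m H
    linear    : Linear H
    connected : Connected H
    tricyclic : ExactlyThreeLooseCycles H
    typeI     : ℕ.suc (order H) ≡ size H ℕ.* (m ∸ 1)
    inPowers  : InPowers m H

private
  newVertex : ∀ m .{{_ : NonTrivial m}} → Fin (m ∸ 1)
  newVertex (ℕ.suc (ℕ.suc m)) = zero

-- Attach l pendant edges to H, the j-th one at the vertex at j; its new
-- vertices are those of block j.
module _ (m : ℕ) .{{_ : NonTrivial m}} (H : Hypergraph) {l} (at : Fin l → Vertex H) where

  oldEdge : Edge H → Subset (order H ℕ.+ l ℕ.* (m ∸ 1))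
  oldEdge e = edge H e ++ ⊥

  newEdge : Fin l → Subset (order H ℕ.+ l ℕ.* (m ∸ 1))
  newEdge j = ⁅ at j ⁆ ++ block (m ∸ 1) j

  extendedEdge : Fin (size H ℕ.+ l) → Subset (order H ℕ.+ l ℕ.* (m ∸ 1))
  extendedEdge f = [ oldEdge , newEdge ]′ (splitAt (size H) f)

  private
    nonempty : ∀ f → Nonempty (extendedEdge f)
    nonempty f with splitAt (size H) f
    ... | inj₁ e = let v , v∈e = edge-nonempty H e in _ , ∈-++ˡ v∈e
    ... | inj₂ j = order H ↑ʳ combine j (newVertex m) ,
      lookup⇒[]= _ (newEdge j)
        (trans (lookup-++ʳ ⁅ at j ⁆ (block (m ∸ 1) j) (combine j (newVertex m)))
               ([]=⇒lookup (∈-block j (newVertex m))))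

    injective′ : ∀ x y → [ oldEdge , newEdge ]′ x ≡ [ oldEdge , newEdge ]′ y → x ≡ y
    injective′ (inj₁ e) (inj₁ f) eq = cong inj₁ (edge-injective H (++-injectiveˡ _ _ eq))
    injective′ (inj₁ e) (inj₂ j) eq =
      contradiction (sym (++-injectiveʳ (edge H e) ⁅ at j ⁆ eq)) (block≢⊥ {l} (newVertex m))
    injective′ (inj₂ i) (inj₁ f) eq =
      contradiction (++-injectiveʳ ⁅ at i ⁆ (edge H f) eq) (block≢⊥ {l} (newVertex m))
    injective′ (inj₂ i) (inj₂ j) eq =
      cong inj₂ (block-injective (newVertex m) (++-injectiveʳ ⁅ at i ⁆ ⁅ at j ⁆ eq))

    injective : Injective _≡_ _≡_ extendedEdge
    injective {f} {g} eq =
      trans (sym (join-splitAt (size H) l f))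
        (trans (cong (join (size H) l) (injective′ (splitAt (size H) f) (splitAt (size H) g) eq))
               (join-splitAt (size H) l g))

  attachPendants : Hypergraph
  attachPendants = record
    { order          = order H ℕ.+ l ℕ.* (m ∸ 1)
    ; size           = size H ℕ.+ l
    ; edge           = extendedEdge
    ; edge-nonempty  = nonempty
    ; edge-injective = injective
    }

-- K₄ minus an edge, on v₁, v₂, v₃, v₄ = 0F, 1F, 2F, 3F, with edges listed as
-- e₁, …, e₅.
diamond : Hypergraph
diamond = record
  { order          = 4
  ; size           = 5
  ; edge           = es
  ; edge-nonempty  = from-yes (all? λ e → nonempty? (es e))
  ; edge-injective = λ {e} {f} →
      from-yes (all? λ e → all? λ f → ≡-dec Bool._≟_ (es e) (es f) →-dec e ≟ f) e f
  }
  where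
  es : Fin 5 → Subset 4
  es 0F = ⁅ 0F ⁆ ∪ ⁅ 1F ⁆
  es 1F = ⁅ 1F ⁆ ∪ ⁅ 2F ⁆
  es 2F = ⁅ 2F ⁆ ∪ ⁅ 0F ⁆
  es 3F = ⁅ 2F ⁆ ∪ ⁅ 3F ⁆
  es 4F = ⁅ 3F ⁆ ∪ ⁅ 0F ⁆

-- Five m-element edges with the three loose cycles v₁e₁v₂e₂v₃e₃v₁,
-- v₁e₃v₃e₄v₄e₅v₁ and v₁e₁v₂e₂v₃e₄v₄e₅v₁ form the m-th power of the diamond.
T₁C : (m : ℕ) .{{_ : NonTrivial m}} → ℕ → ℕ → ℕ → ℕ → Hypergraph
T₁C m l₁ l₂ l₃ l₄ =
  attachPendants m (power m diamond) (lookup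
    (replicate l₁ (v 0F) ++ replicate l₂ (v 1F) ++ replicate l₃ (v 2F) ++ replicate l₄ (v 3F)))
  where
  v : Vertex diamond → Vertex (power m diamond)
  v i = i ↑ˡ (5 ℕ.* (m ∸ 2))

{-# OPTIONS --safe #-}

-- Put r = m - 2 and μ = (m - 1) λ.  Eliminating the new vertices of the power of a graph G from
-- A y = λ y leaves θ y = (r D + s A) y on the vertices of G, where D and A are the degree and
-- adjacency matrices of G, s = μ + 1 and θ = μ (μ - r + 1).  For the Perron vector y of H, take a
-- vertex at which y is largest as root and a spanning tree of G containing every edge at the root.
-- G has one edge more than vertices, so two edges remain, neither of them at the root.  Moving the
-- upper end of every tree edge to the root, and one of the remaining edges onto the largest of
-- their ends, turns G into the graph of T and does not decrease the quadratic form of r D + s A.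
-- At the parameters of T that form is θ |y|² minus a sum of squares weighted by the Perron vector of
-- T, hence λ(H) ≤ λ(T).  In the equality case y is proportional to that vector, and comparing the
-- eigenvalue equations at the root and at the largest end shows that nothing has been moved.
-- The Perron vector of T is polynomial in ν = μ - r, where ν is a root of an explicit F; the bound
-- in (ii) is the positive root of a quadratic N in ν such that N ≥ 0 implies F > 0.

module Submission where

open import Defs
open import Algebra.Bundles using (CommutativeRing)
import Algebra.Properties.AbelianGroup as AbelianGroupProperties
import Algebra.Properties.Monoid.Mult as MonoidMult
import Algebra.Properties.Monoid.Sum as MonoidSum
import Algebra.Properties.Ring as RingProperties
import Algebra.Properties.Semiring.Mult as SemiringMult
import Algebra.Properties.Semiring.Sum as SemiringSum
import Algebra.Solver.Ring as RingSolver
open import Algebra.Solver.Ring.AlmostCommutativeRing using (fromCommutativeRing; _-Raw-AlmostCommutative⟶_)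
open import Data.Bool.Base using (Bool; if_then_else_)
open import Data.Fin.Base as Fin
  using (Fin; zero; suc; _↑ˡ_; _↑ʳ_; combine; splitAt; punchIn; punchOut; toℕ)
open import Data.Fin.Patterns using (0F; 1F; 2F; 3F; 4F)
import Data.Fin.Permutation as Perm
import Data.Fin.Properties as Fin
open import Data.Fin.Subset using (Subset; _∈_; ⊥; ⁅_⁆; ∣_∣; Nonempty)
open import Data.Fin.Subset.Properties
  using (_∈?_; x∈p⇒∣p-x∣<∣p∣; x∈p∧x≢y⇒x∈p-y; x∈⁅x⁆; x∈⁅y⁆⇒x≡y; x∈⁅y⁆⇔x≡y; ∣⁅x⁆∣≡1; p⊆q⇒∣p∣≤∣q∣; x∈p∩q⁺; ∉⊥)
open import Data.Integer.Base as ℤ using (ℤ; -[1+_]; _⊖_; _◃_)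
import Data.Integer.Properties as ℤ
open import Data.Maybe.Base as Maybe using (Maybe; just; nothing; from-just)
open import Data.Nat.Base as ℕ using (ℕ; zero; suc; s≤s; z≤n; NonTrivial; _∸_)
import Data.Nat.Properties as ℕ
open import Data.Product.Base using (Σ-syntax; ∃; ∃-syntax; _×_; _,_; proj₁; proj₂)
open import Data.Product.Function.NonDependent.Propositional using (_×-↔_)
open import Data.Sign.Base as Sign using (Sign)
open import Data.Sum.Base as Sum using (_⊎_; inj₁; inj₂; [_,_]′)
import Data.Sum.Properties as Sum
open import Data.Sum.Function.Propositional using (_⊎-↔_)
open import Data.Unit.Base using (⊤; tt)
open import Data.Vec.Base using (Vec; lookup; replicate; _++_; _∷_; [])
open import Data.Vec.Properties using (lookup-++ˡ; lookup-++ʳ; lookup⇒[]=; []=⇒lookup)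
open import Data.Vec.Relation.Unary.All using (All; []; _∷_)
import Data.Vec.Relation.Unary.All.Properties as All
open import Function.Base using (_∘_; id)
open import Function.Bundles using (_↔_; mk↔ₛ′; Inverse; _⇔_; mk⇔; Equivalence)
open import Function.Definitions using (Injective)
import Function.Properties.Equivalence as ⇔
import Function.Properties.Inverse as ↔
open import Level using (_⊔_; Lift; lift)
open import Relation.Binary.Bundles using (Poset)
open import Relation.Binary.Construct.Closure.ReflexiveTransitive as Star using (Star; ε; _◅_)
open import Relation.Binary.Core using (Rel)
open import Relation.Binary.Definitions using (Total; Transitive)
open import Relation.Binary.PropositionalEquality as ≡ using (_≡_; _≢_)
import Relation.Binary.Reasoning.PartialOrder as PartialOrderReasoning
open import Relation.Binary.Structures using (IsDecTotalOrder)
open import Relation.Nullary using (¬_; Dec; yes; no; does; contradiction)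
open import Relation.Nullary.Decidable
  using (dec-true; dec-false; dec⇒maybe; ¬?; _×-dec_; _⊎-dec_; _→-dec_; from-yes)

-- Rayleigh quotients cannot be compared directly: eliminating the new vertices leaves the operator
-- `r D + s A`, whose coefficient `s` depends on the eigenvalue, so `H` and `T` give forms with
-- different `s`. What rescues the argument is that `θ / s` increases with the eigenvalue; the
-- relations for `H` and `T` can then be combined so that the adjacency form cancels.
--
-- The vector `y` is obtained as the entrywise absolute value of a real eigenvector. The triangle
-- inequality gives `λ y ≤ A y`, which is the direction that the comparison uses, and this passes to
-- the graph when `t = ν + 1 = s - r` is positive. If `t ≤ 0`, then `μ ≤ r - 1` and the bound is
-- immediate.
--
-- Since the tree contains every edge at the root, the two remaining edges avoid the root. By
-- simplicity they have at least three ends between them, and together with the root these provide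
-- the four corners of the diamond. Each edge keeps one end, its `tail`, and only the other end is
-- moved, to a vertex where `y` is at least as large; hence both the degree form and the adjacency
-- form can only grow.

-- Powers of graphs, described by labels of their vertices and edges.

module Presentations where
  open ≡ using (refl; sym; trans; cong; subst; subst₂; module ≡-Reasoning)

  -- Equivalent to Linear, but without cardinalities.
  MeetOnce : Hypergraph → Set
  MeetOnce H = ∀ {u v} → u ≢ v → ∀ {e f} → u ∈ edge H e → v ∈ edge H e → u ∈ edge H f → v ∈ edge H f → e ≡ f

  -- H is the power of the graph with edges A e B e on Fin n, the block of e having r vertices.
  record Presentation (H : Hypergraph) {n k} (r : ℕ) (A B : Fin k → Fin n) : Set where
    field
      vertices  : (Fin n ⊎ (Fin k × Fin r)) ↔ Vertex H
      edges     : Fin k ↔ Edge H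

    old : Fin n → Vertex H
    old u = Inverse.to vertices (inj₁ u)

    new : Fin k → Fin r → Vertex H
    new e i = Inverse.to vertices (inj₂ (e , i))

    at : Fin k → Edge H
    at = Inverse.to edges

    field
      A≢B : ∀ e → A e ≢ B e
      old∈ : ∀ u e → old u ∈ edge H (at e) ⇔ (u ≡ A e ⊎ u ≡ B e)
      new∈ : ∀ f i e → new f i ∈ edge H (at e) ⇔ f ≡ e

  pattern 5+_ j = suc (suc (suc (suc (suc j))))
  pattern 4+_ j = suc (suc (suc (suc j)))

  -- The diamond with l pendant edges at vertex 0; edge e joins tail e and head e.
  tail head : ∀ {l} → Fin (5 ℕ.+ l) → Fin (4 ℕ.+ l)
  tail 0F = 1F
  tail 1F = 2F
  tail 2F = 2F
  tail 3F = 3F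
  tail 4F = 3F
  tail (5+ j) = 4+ j

  head 0F = 0F
  head 1F = 1F
  head 2F = 0F
  head 3F = 2F
  head 4F = 0F
  head (5+ j) = 0F

  infix 4 _∈ends[_,_]
  _∈ends[_,_] : ∀ {n} → Fin n → Fin n → Fin n → Set
  u ∈ends[ a , b ] = u ≡ a ⊎ u ≡ b

  distinct-elements : ∀ {n} {p : Subset n} {u v} → u ≢ v → u ∈ p → v ∈ p → 2 ℕ.≤ ∣ p ∣
  distinct-elements u≢v u∈p v∈p =
    ℕ.≤-trans (s≤s (ℕ.≤-trans (s≤s z≤n) (x∈p⇒∣p-x∣<∣p∣ (x∈p∧x≢y⇒x∈p-y v∈p (u≢v ∘ sym))))) (x∈p⇒∣p-x∣<∣p∣ u∈p)

  Linear⇒MeetOnce : ∀ H → Linear H → MeetOnce H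
  Linear⇒MeetOnce H linear u≢v {e} {f} u∈e v∈e u∈f v∈f with e Fin.≟ f
  ... | yes e≡f = e≡f
  ... | no e≢f = contradiction (linear e f e≢f)
        (ℕ.<⇒≱ (distinct-elements u≢v (x∈p∩q⁺ (u∈e , u∈f)) (x∈p∩q⁺ (v∈e , v∈f))))

  ∣p∣≡2⇒pair : ∀ {n} (p : Subset n) → ∣ p ∣ ≡ 2 → Nonempty p →
         Σ[ a ∈ Fin n ] Σ[ b ∈ Fin n ] a ≢ b × (∀ u → u ∈ p ⇔ u ∈ends[ a , b ])
  ∣p∣≡2⇒pair p ∣p∣≡2 (a , a∈p) with Fin.any? (λ b → (b ∈? p) ×-dec ¬? (b Fin.≟ a))
  ... | no only-a = contradiction (subst (ℕ._≤ 1) ∣p∣≡2 (subst (∣ p ∣ ℕ.≤_) (∣⁅x⁆∣≡1 a) (p⊆q⇒∣p∣≤∣q∣ p⊆⁅a⁆)))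
                                  λ { (s≤s ()) }
    where
    p⊆⁅a⁆ : ∀ {u} → u ∈ p → u ∈ ⁅ a ⁆
    p⊆⁅a⁆ {u} u∈p with u Fin.≟ a
    ... | yes refl = x∈⁅x⁆ a
    ... | no u≢a = contradiction (u , u∈p , u≢a) only-a
  ... | yes (b , b∈p , b≢a) = a , b , b≢a ∘ sym , λ u → mk⇔ (to u) λ { (inj₁ refl) → a∈p ; (inj₂ refl) → b∈p }
    where
    to : ∀ u → u ∈ p → u ∈ends[ a , b ]
    to u u∈p with u Fin.≟ a | u Fin.≟ b
    ... | yes u≡a | _ = inj₁ u≡a
    ... | _ | yes u≡b = inj₂ u≡b
    ... | no u≢a | no u≢b = contradiction
          (subst (3 ℕ.≤_) ∣p∣≡2 (ℕ.≤-trans (s≤s (distinct-elements (u≢b ∘ sym)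
            (x∈p∧x≢y⇒x∈p-y b∈p b≢a) (x∈p∧x≢y⇒x∈p-y u∈p u≢a))) (x∈p⇒∣p-x∣<∣p∣ a∈p)))
          λ { (s≤s (s≤s ())) }

  to-injective : ∀ {X Y : Set} (σ : X ↔ Y) {x y} → Inverse.to σ x ≡ Inverse.to σ y → x ≡ y
  to-injective σ eq = trans (sym (Inverse.inverseʳ σ refl)) (Inverse.inverseʳ σ eq)

  ↑ˡ≢↑ʳ : ∀ m {n} {i : Fin m} {j : Fin n} → i ↑ˡ n ≢ m ↑ʳ j
  ↑ˡ≢↑ʳ m {n} {i} {j} eq
    with () ← trans (sym (Fin.splitAt-↑ˡ m i n)) (trans (cong (splitAt m) eq) (Fin.splitAt-↑ʳ m n j))

  ↑ˡ∈++ : ∀ {a b} (p : Subset a) (q : Subset b) i → i ↑ˡ b ∈ p ++ q ⇔ i ∈ p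
  ↑ˡ∈++ p q i = mk⇔
    (λ i∈ → lookup⇒[]= i p (trans (sym (lookup-++ˡ p q i)) ([]=⇒lookup i∈)))
    (λ i∈ → lookup⇒[]= _ (p ++ q) (trans (lookup-++ˡ p q i) ([]=⇒lookup i∈)))

  ↑ʳ∈++ : ∀ {a b} (p : Subset a) (q : Subset b) i → a ↑ʳ i ∈ p ++ q ⇔ i ∈ q
  ↑ʳ∈++ p q i = mk⇔
    (λ i∈ → lookup⇒[]= i q (trans (sym (lookup-++ʳ p q i)) ([]=⇒lookup i∈)))
    (λ i∈ → lookup⇒[]= _ (p ++ q) (trans (lookup-++ʳ p q i) ([]=⇒lookup i∈)))

  combine∈block : ∀ {l r} (i j : Fin l) (q : Fin r) → combine i q ∈ block r j ⇔ i ≡ j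
  combine∈block {r = r} i j q = mk⇔
    (λ i∈ → trans (sym (cong proj₁ (Fin.remQuot-combine i q))) (∈-block⁻ i∈))
    (λ { refl → ∈-block i q })

  ≡⇒⇔ : ∀ {a} {P Q : Set a} → P ≡ Q → P ⇔ Q
  ≡⇒⇔ P≡Q = mk⇔ (subst id P≡Q) (subst id (sym P≡Q))

  both-false : ∀ {a b} {P : Set a} {Q : Set b} → ¬ P → ¬ Q → P ⇔ Q
  both-false ¬p ¬q = mk⇔ (λ p → contradiction p ¬p) (λ q → contradiction q ¬q)

  power-presentation : ∀ r G (A B : Edge G → Vertex G) → (∀ e → A e ≢ B e) →
    (∀ e u → u ∈ edge G e ⇔ u ∈ends[ A e , B e ]) → Presentation (power (2 ℕ.+ r) G) r A B
  power-presentation r G A B A≢B ends = record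
    { vertices = ↔.↔-sym (↔.↔-trans Fin.+↔⊎ (↔.↔-refl ⊎-↔ Fin.*↔×))
    ; edges = ↔.↔-refl
    ; A≢B = A≢B
    ; old∈ = λ u e → ⇔.trans (↑ˡ∈++ (edge G e) (block r e) u) (ends e u)
    ; new∈ = λ f i e → ⇔.trans (↑ʳ∈++ (edge G e) (block r e) (combine f i)) (combine∈block f e i)
    }

  presentation-≅ : ∀ {H H′ n k r} {A B : Fin k → Fin n} → H ≅ H′ → Presentation H′ r A B → Presentation H r A B
  presentation-≅ {H} {H′} (σ , τ , σ∈τ) P = record
    { vertices = ↔.↔-trans vertices (↔.↔-sym σ)
    ; edges = ↔.↔-trans edges (↔.↔-sym τ)
    ; A≢B = A≢B
    ; old∈ = λ u e → ⇔.trans (pull (old u) (at e)) (old∈ u e)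
    ; new∈ = λ f i e → ⇔.trans (pull (new f i) (at e)) (new∈ f i e)
    }
    where
    open Presentation P
    pull : ∀ v e → Inverse.from σ v ∈ edge H (Inverse.from τ e) ⇔ v ∈ edge H′ e
    pull v e = ⇔.trans (σ∈τ _ _) (≡⇒⇔ (trans
      (cong (_∈ edge H′ (Inverse.to τ (Inverse.from τ e))) (Inverse.inverseˡ σ refl))
      (cong (λ e → v ∈ edge H′ e) (Inverse.inverseˡ τ refl))))

  -- Ends are compared as unordered pairs, so a relabelling may reverse an edge. This allows every
  -- edge to be written with the end that stays fixed in first place and the end to be moved in
  -- second place.
  relabel : ∀ {H n k n′ k′ r} {A B : Fin k → Fin n} (P : Presentation H r A B)
    (ψ : Fin n′ ↔ Fin n) (φ : Fin k′ ↔ Fin k) {A′ B′ : Fin k′ → Fin n′} → (∀ e → A′ e ≢ B′ e) →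
    (∀ e u → Inverse.to ψ u ∈ends[ A (Inverse.to φ e) , B (Inverse.to φ e) ] ⇔ u ∈ends[ A′ e , B′ e ]) →
    Presentation H r A′ B′
  relabel P ψ φ A′≢B′ ends = record
    { vertices = ↔.↔-trans (ψ ⊎-↔ (φ ×-↔ ↔.↔-refl)) vertices
    ; edges = ↔.↔-trans φ edges
    ; A≢B = A′≢B′
    ; old∈ = λ u e → ⇔.trans (old∈ _ _) (ends e u)
    ; new∈ = λ f i e → ⇔.trans (new∈ _ _ _) (mk⇔ (to-injective φ) (cong (Inverse.to φ)))
    }
    where open Presentation P

  -- The isomorphism matches equal labels. It concludes the equality case, where both presentations
  -- have `tail` as first ends and the second ends are known to agree only pointwise.
  presentations⇒≅ : ∀ {H H′ n k r} {A B B′ : Fin k → Fin n} → Presentation H r A B → Presentation H′ r A B′ →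
                    (∀ e → B e ≡ B′ e) → H ≅ H′
  presentations⇒≅ {H} {H′} {A = A} {B} {B′} P P′ B≗B′ =
    ↔.↔-trans (↔.↔-sym P.vertices) P′.vertices , ↔.↔-trans (↔.↔-sym P.edges) P′.edges , same
    where
    module P = Presentation P
    module P′ = Presentation P′

    same-at : ∀ x e → Inverse.to P.vertices x ∈ edge H (P.at e) ⇔ Inverse.to P′.vertices x ∈ edge H′ (P′.at e)
    same-at (inj₁ u) e = ⇔.trans (P.old∈ u e) (⇔.trans
      (≡⇒⇔ (cong (λ b → u ∈ends[ A e , b ]) (B≗B′ e))) (⇔.sym (P′.old∈ u e)))
    same-at (inj₂ (f , i)) e = ⇔.trans (P.new∈ f i e) (⇔.sym (P′.new∈ f i e))

    same : ∀ v e → v ∈ edge H e ⇔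
      Inverse.to P′.vertices (Inverse.from P.vertices v) ∈ edge H′ (P′.at (Inverse.from P.edges e))
    same v e = ⇔.trans
      (≡⇒⇔ (sym (trans
        (cong (λ v → v ∈ edge H (P.at (Inverse.from P.edges e))) (Inverse.inverseˡ P.vertices refl))
        (cong (λ e → v ∈ edge H e) (Inverse.inverseˡ P.edges refl)))))
      (same-at (Inverse.from P.vertices v) (Inverse.from P.edges e))

  -- A new vertex lies in a single edge, so only a pair of old vertices could lie in two edges, and
  -- for old vertices the condition is simplicity of the graph.
  presentation-MeetOnce : ∀ {H n k r} {A B : Fin k → Fin n} → Presentation H r A B →
    (∀ {u v} → u ≢ v → ∀ {e f} → u ∈ends[ A e , B e ] → v ∈ends[ A e , B e ] →
      u ∈ends[ A f , B f ] → v ∈ends[ A f , B f ] → e ≡ f) →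
    MeetOnce H
  presentation-MeetOnce {H} P simple {u} {v} u≢v {e} {f} u∈e v∈e u∈f v∈f =
    trans (sym (Inverse.inverseˡ edges refl)) (trans
      (cong at (by-labels _ _ (label u) (label v) (back u∈e) (back v∈e) (back u∈f) (back v∈f)))
      (Inverse.inverseˡ edges refl))
    where
    open Presentation P

    label : ∀ v → ∃[ x ] Inverse.to vertices x ≡ v
    label v = Inverse.from vertices v , Inverse.inverseˡ vertices refl

    back : ∀ {v e} → v ∈ edge H e → v ∈ edge H (at (Inverse.from edges e))
    back {v} = subst (λ e → v ∈ edge H e) (sym (Inverse.inverseˡ edges refl))

    by-labels : ∀ e f → (∃[ x ] Inverse.to vertices x ≡ u) → (∃[ x ] Inverse.to vertices x ≡ v) →
      u ∈ edge H (at e) → v ∈ edge H (at e) → u ∈ edge H (at f) → v ∈ edge H (at f) → e ≡ f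
    by-labels e f (inj₂ (g , i) , refl) _ u∈e v∈e u∈f v∈f =
      trans (sym (Equivalence.to (new∈ g i e) u∈e)) (Equivalence.to (new∈ g i f) u∈f)
    by-labels e f (inj₁ _ , refl) (inj₂ (g , i) , refl) u∈e v∈e u∈f v∈f =
      trans (sym (Equivalence.to (new∈ g i e) v∈e)) (Equivalence.to (new∈ g i f) v∈f)
    by-labels e f (inj₁ x , refl) (inj₁ y , refl) u∈e v∈e u∈f v∈f =
      simple (λ x≡y → u≢v (cong old x≡y))
        (Equivalence.to (old∈ x e) u∈e) (Equivalence.to (old∈ y e) v∈e)
        (Equivalence.to (old∈ x f) u∈f) (Equivalence.to (old∈ y f) v∈f)

  head<tail : ∀ {l} (e : Fin (5 ℕ.+ l)) → head e Fin.< tail e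
  head<tail 0F = s≤s z≤n
  head<tail 1F = s≤s (s≤s z≤n)
  head<tail 2F = s≤s z≤n
  head<tail 3F = s≤s (s≤s (s≤s z≤n))
  head<tail 4F = s≤s z≤n
  head<tail (5+ j) = s≤s z≤n

  tail≢head : ∀ {l} (e : Fin (5 ℕ.+ l)) → tail e ≢ head e
  tail≢head e t≡h = ℕ.<-irrefl (cong toℕ (sym t≡h)) (head<tail e)

  -- A left inverse of `e ↦ (tail e , head e)`, from which simplicity follows. Its values at pairs
  -- that are not of this form are arbitrary.
  edge-between : ∀ {l} → Fin (4 ℕ.+ l) → Fin (4 ℕ.+ l) → Fin (5 ℕ.+ l)
  edge-between 2F 1F = 1F
  edge-between 2F _ = 2F
  edge-between 3F 2F = 3F
  edge-between 3F _ = 4F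
  edge-between (4+ j) _ = 5+ j
  edge-between _ _ = 0F

  edge-between-ends : ∀ {l} (e : Fin (5 ℕ.+ l)) → edge-between (tail e) (head e) ≡ e
  edge-between-ends 0F = refl
  edge-between-ends 1F = refl
  edge-between-ends 2F = refl
  edge-between-ends 3F = refl
  edge-between-ends 4F = refl
  edge-between-ends (5+ j) = refl

  extremal-simple : ∀ {l} {u v : Fin (4 ℕ.+ l)} → u ≢ v → ∀ {e f : Fin (5 ℕ.+ l)} →
    u ∈ends[ tail e , head e ] → v ∈ends[ tail e , head e ] →
    u ∈ends[ tail f , head f ] → v ∈ends[ tail f , head f ] → e ≡ f
  extremal-simple u≢v {e} {f} = λ where
      (inj₁ refl) (inj₁ refl) _ _ → contradiction refl u≢v
      (inj₂ refl) (inj₂ refl) _ _ → contradiction refl u≢v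
      (inj₁ u≡te) (inj₂ v≡he) (inj₁ u≡tf) (inj₂ v≡hf) → same (trans (sym u≡te) u≡tf) (trans (sym v≡he) v≡hf)
      (inj₂ u≡he) (inj₁ v≡te) (inj₂ u≡hf) (inj₁ v≡tf) → same (trans (sym v≡te) v≡tf) (trans (sym u≡he) u≡hf)
      (inj₁ u≡te) (inj₂ v≡he) (inj₂ u≡hf) (inj₁ v≡tf) → swapped (trans (sym u≡te) u≡hf) (trans (sym v≡he) v≡tf)
      (inj₂ u≡he) (inj₁ v≡te) (inj₁ u≡tf) (inj₂ v≡hf) → swapped (trans (sym v≡te) v≡hf) (trans (sym u≡he) u≡tf)
      _ _ (inj₁ u≡tf) (inj₁ v≡tf) → contradiction (trans u≡tf (sym v≡tf)) u≢v
      _ _ (inj₂ u≡hf) (inj₂ v≡hf) → contradiction (trans u≡hf (sym v≡hf)) u≢v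
    where
    same : tail e ≡ tail f → head e ≡ head f → e ≡ f
    same t h = trans (sym (edge-between-ends e)) (trans (cong (λ x → edge-between x (head e)) t)
      (trans (cong (edge-between (tail f)) h) (edge-between-ends f)))

    swapped : tail e ≡ head f → head e ≡ tail f → e ≡ f
    swapped te≡hf he≡tf = contradiction (head<tail e)
      (ℕ.<⇒≯ (subst (Fin._< head e) (sym te≡hf) (subst (head f Fin.<_) (sym he≡tf) (head<tail f))))

  lookup-replicate-++[] : ∀ {a} {X : Set a} l (x : X) (j : Fin (l ℕ.+ 0)) → lookup (replicate l x ++ []) j ≡ x
  lookup-replicate-++[] (suc l) x zero = refl
  lookup-replicate-++[] (suc l) x (suc j) = lookup-replicate-++[] l x j

  -- The diamond power with pendant edges at one vertex, as the power of a graph.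

  module _ (r : ℕ) {l} (at : Fin l → Vertex (power (2 ℕ.+ r) diamond))
    (at≡ : ∀ j → at j ≡ _↑ˡ_ {4} 0F (5 ℕ.* r)) where
    private
      T : Hypergraph
      T = attachPendants (2 ℕ.+ r) (power (2 ℕ.+ r) diamond) at

      -- A pendant edge brings `suc r` new vertices. The first is reinterpreted as a leaf of the
      -- graph, the other `r` as the new vertices of the edge at that leaf.
      regroup : ∀ {X Y L : Set} → ((X ⊎ L) ⊎ ((Y ⊎ L) × Fin r)) ↔ ((X ⊎ (Y × Fin r)) ⊎ (L × Fin (suc r)))
      regroup = mk↔ₛ′
        (λ { (inj₁ (inj₁ x)) → inj₁ (inj₁ x) ; (inj₁ (inj₂ j)) → inj₂ (j , zero)
           ; (inj₂ (inj₁ y , i)) → inj₁ (inj₂ (y , i)) ; (inj₂ (inj₂ j , i)) → inj₂ (j , suc i) })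
        (λ { (inj₁ (inj₁ x)) → inj₁ (inj₁ x) ; (inj₂ (j , zero)) → inj₁ (inj₂ j)
           ; (inj₁ (inj₂ (y , i))) → inj₂ (inj₁ y , i) ; (inj₂ (j , suc i)) → inj₂ (inj₂ j , i) })
        (λ { (inj₁ (inj₁ x)) → refl ; (inj₂ (j , zero)) → refl
           ; (inj₁ (inj₂ (y , i))) → refl ; (inj₂ (j , suc i)) → refl })
        (λ { (inj₁ (inj₁ x)) → refl ; (inj₁ (inj₂ j)) → refl
           ; (inj₂ (inj₁ y , i)) → refl ; (inj₂ (inj₂ j , i)) → refl })

      vertices : (Fin (4 ℕ.+ l) ⊎ (Fin (5 ℕ.+ l) × Fin r)) ↔ Vertex T
      vertices = ↔.↔-trans (Fin.+↔⊎ {4} ⊎-↔ (Fin.+↔⊎ {5} ×-↔ ↔.↔-refl)) (↔.↔-trans regroup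
        (↔.↔-sym (↔.↔-trans Fin.+↔⊎ (↔.↔-trans Fin.+↔⊎ (↔.↔-refl ⊎-↔ Fin.*↔×) ⊎-↔ Fin.*↔×))))

      diamond∈ : ∀ (u : Fin 4) (e : Fin 5) → u ∈ edge diamond e ⇔ u ∈ends[ tail {0} e , head {0} e ]
      diamond∈ u e = mk⇔
        (from-yes (Fin.all? λ u → Fin.all? λ e →
          (u ∈? edge diamond e) →-dec ((u Fin.≟ tail {0} e) ⊎-dec (u Fin.≟ head {0} e))) u e)
        (from-yes (Fin.all? λ u → Fin.all? λ e →
          ((u Fin.≟ tail {0} e) ⊎-dec (u Fin.≟ head {0} e)) →-dec (u ∈? edge diamond e)) u e)

      tail-↑ˡ : ∀ (e : Fin 5) → tail (e ↑ˡ l) ≡ tail {0} e ↑ˡ l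
      tail-↑ˡ 0F = refl
      tail-↑ˡ 1F = refl
      tail-↑ˡ 2F = refl
      tail-↑ˡ 3F = refl
      tail-↑ˡ 4F = refl

      head-↑ˡ : ∀ (e : Fin 5) → head (e ↑ˡ l) ≡ head {0} e ↑ˡ l
      head-↑ˡ 0F = refl
      head-↑ˡ 1F = refl
      head-↑ˡ 2F = refl
      head-↑ˡ 3F = refl
      head-↑ˡ 4F = refl

      old : Fin (4 ℕ.+ l) → Vertex T
      old u = Inverse.to vertices (inj₁ u)

      new : Fin (5 ℕ.+ l) → Fin r → Vertex T
      new f i = Inverse.to vertices (inj₂ (f , i))

      old-↑ˡ : ∀ (u : Fin 4) → old (u ↑ˡ l) ≡ (u ↑ˡ 5 ℕ.* r) ↑ˡ (l ℕ.* suc r)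
      old-↑ˡ u rewrite Fin.splitAt-↑ˡ 4 u l = refl

      new-↑ˡ : ∀ (f : Fin 5) i → new (f ↑ˡ l) i ≡ (4 ↑ʳ combine f i) ↑ˡ (l ℕ.* suc r)
      new-↑ˡ f i rewrite Fin.splitAt-↑ˡ 5 f l = refl

      edge-↑ˡ : ∀ (e : Fin 5) → edge T (e ↑ˡ l) ≡ (edge diamond e ++ block r e) ++ ⊥
      edge-↑ˡ e rewrite Fin.splitAt-↑ˡ 5 e l = refl

      data View (n : ℕ) : Fin (n ℕ.+ l) → Set where
        core : ∀ u → View n (u ↑ˡ l)
        pendant : ∀ j → View n (n ↑ʳ j)

      view : ∀ n u → View n u
      view n u with splitAt n u in eq
      ... | inj₁ x = subst (View n) (Fin.splitAt⁻¹-↑ˡ eq) (core x)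
      ... | inj₂ j = subst (View n) (Fin.splitAt⁻¹-↑ʳ eq) (pendant j)

      old∈ : ∀ u e → old u ∈ edge T e ⇔ u ∈ends[ tail e , head e ]
      old∈ u e with view 4 u | view 5 e
      ... | core u | core e rewrite old-↑ˡ u | edge-↑ˡ e | tail-↑ˡ e | head-↑ˡ e =
            ⇔.trans (↑ˡ∈++ (edge diamond e ++ block r e) ⊥ _) (⇔.trans (↑ˡ∈++ (edge diamond e) (block r e) u)
              (⇔.trans (diamond∈ u e) (mk⇔ (Sum.map (cong (_↑ˡ l)) (cong (_↑ˡ l)))
                (Sum.map (Fin.↑ˡ-injective l _ _) (Fin.↑ˡ-injective l _ _)))))
      ... | core u | pendant j rewrite old-↑ˡ u | at≡ j =
            ⇔.trans (↑ˡ∈++ ⁅ _↑ˡ_ {4} 0F (5 ℕ.* r) ⁆ (block (suc r) j) (u ↑ˡ 5 ℕ.* r))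
              (⇔.trans x∈⁅y⁆⇔x≡y (mk⇔
                (λ u≡0 → inj₂ (cong (_↑ˡ l) (Fin.↑ˡ-injective (5 ℕ.* r) u 0F u≡0)))
                λ { (inj₁ u≡4+j) → contradiction u≡4+j (↑ˡ≢↑ʳ 4)
                  ; (inj₂ u≡0) → cong (_↑ˡ 5 ℕ.* r) (Fin.↑ˡ-injective l u 0F u≡0) }))
      ... | pendant i | core e rewrite edge-↑ˡ e | tail-↑ˡ e | head-↑ˡ e = both-false
            (λ i∈ → ∉⊥ (Equivalence.to (↑ʳ∈++ (edge diamond e ++ block r e) ⊥ (combine i zero)) i∈))
            λ { (inj₁ eq) → ↑ˡ≢↑ʳ 4 (sym eq) ; (inj₂ eq) → ↑ˡ≢↑ʳ 4 (sym eq) }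
      ... | pendant i | pendant j = ⇔.trans (↑ʳ∈++ ⁅ at j ⁆ (block (suc r) j) (combine i zero))
            (⇔.trans (combine∈block i j zero) (mk⇔ (inj₁ ∘ cong (4 ↑ʳ_))
              λ { (inj₁ eq) → Fin.↑ʳ-injective 4 i j eq ; (inj₂ ()) }))

      new∈ : ∀ f i e → new f i ∈ edge T e ⇔ f ≡ e
      new∈ f i e with view 5 f | view 5 e
      ... | core f | core e rewrite new-↑ˡ f i | edge-↑ˡ e =
            ⇔.trans (↑ˡ∈++ (edge diamond e ++ block r e) ⊥ _) (⇔.trans
              (↑ʳ∈++ (edge diamond e) (block r e) (combine f i))
              (⇔.trans (combine∈block f e i) (mk⇔ (cong (_↑ˡ l)) (Fin.↑ˡ-injective l _ _))))
      ... | core f | pendant j rewrite new-↑ˡ f i | at≡ j = both-false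
            (λ f∈ → ↑ˡ≢↑ʳ 4 (sym (x∈⁅y⁆⇒x≡y (_↑ˡ_ {4} 0F (5 ℕ.* r)) (Equivalence.to
              (↑ˡ∈++ ⁅ _↑ˡ_ {4} 0F (5 ℕ.* r) ⁆ (block (suc r) j) (4 ↑ʳ combine f i)) f∈))))
            (↑ˡ≢↑ʳ 5)
      ... | pendant f | core e rewrite edge-↑ˡ e = both-false
            (λ f∈ → ∉⊥ (Equivalence.to (↑ʳ∈++ (edge diamond e ++ block r e) ⊥ (combine f (suc i))) f∈))
            (↑ˡ≢↑ʳ 5 ∘ sym)
      ... | pendant f | pendant j = ⇔.trans (↑ʳ∈++ ⁅ at j ⁆ (block (suc r) j) (combine f (suc i)))
            (⇔.trans (combine∈block f j (suc i)) (mk⇔ (cong (5 ↑ʳ_)) (Fin.↑ʳ-injective 5 f j)))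

    attachPendants-presentation : Presentation T r (tail {l}) head
    attachPendants-presentation = record
      { vertices = vertices ; edges = ↔.↔-refl ; A≢B = tail≢head ; old∈ = old∈ ; new∈ = new∈ }

  -- A spanning tree around a maximal root, and the labelling by the extremal graph.

  least : {P : ℕ → Set} → (∀ i → Dec (P i)) → ∀ {i} → P i → ∃[ j ] P j × (∀ {k} → P k → j ℕ.≤ k)
  least P? {i} Pi with P? 0
  ... | yes P0 = 0 , P0 , λ _ → z≤n
  least P? {zero} P0 | no ¬P0 = contradiction P0 ¬P0
  least P? {suc i} Pi | no ¬P0 with least (P? ∘ suc) Pi
  ...   | j , Pj , j≤ = suc j , Pj , λ { {zero} P0 → contradiction P0 ¬P0 ; {suc k} Pk → s≤s (j≤ Pk) }

  maximum : ∀ {a ℓ} {X : Set a} {_≼_ : Rel X ℓ} → Total _≼_ → Transitive _≼_ →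
            ∀ {n} (f : Fin (suc n) → X) → ∃[ i ] ∀ j → f j ≼ f i
  maximum total trans′ {zero} f = 0F , λ { 0F → [ id , id ]′ (total _ _) }
  maximum total trans′ {suc n} f with maximum total trans′ (f ∘ suc)
  ... | i , ≼fi with total (f 0F) (f (suc i))
  ...   | inj₁ f0≼fi = suc i , λ { 0F → f0≼fi ; (suc j) → ≼fi j }
  ...   | inj₂ fi≼f0 = 0F , λ { 0F → [ id , id ]′ (total _ _) ; (suc j) → trans′ (≼fi j) fi≼f0 }

  -- The value `f 0F` is punched out, the rest is extended by induction, and `f 0F` is inserted
  -- again. This serves both to complete a partial labelling and to find `b` elements outside the
  -- image of `f`, namely the images of the added indices.
  extend : ∀ {a n} b (f : Fin a → Fin n) → Injective _≡_ _≡_ f → a ℕ.+ b ≡ n →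
           Σ[ π ∈ Fin (a ℕ.+ b) ↔ Fin n ] (∀ i → Inverse.to π (i ↑ˡ b) ≡ f i)
  extend {zero} b f f-inj refl = Perm.id , λ ()
  extend {suc a} b f f-inj refl = Perm.insert 0F (f 0F) π , λ where
      0F → refl
      (suc i) → trans (Perm.insert-punchIn 0F (f 0F) π (i ↑ˡ b))
        (trans (cong (punchIn (f 0F)) (π≡ i)) (Fin.punchIn-punchOut (f0≢ i)))
    where
    f0≢ : ∀ i → f 0F ≢ f (suc i)
    f0≢ i f0≡ with () ← f-inj f0≡

    rest : Fin a → Fin (a ℕ.+ b)
    rest i = punchOut (f0≢ i)

    extended = extend b rest (λ eq → Fin.suc-injective (f-inj (Fin.punchOut-injective (f0≢ _) (f0≢ _) eq))) refl
    π = proj₁ extended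
    π≡ = proj₂ extended

  injective⇒permutation : ∀ {a n} (f : Fin a → Fin n) → Injective _≡_ _≡_ f → a ≡ n →
                          Σ[ π ∈ Fin a ↔ Fin n ] (∀ i → Inverse.to π i ≡ f i)
  injective⇒permutation {a} f f-inj a≡n with extend 0 f f-inj (trans (ℕ.+-identityʳ a) a≡n)
  ... | π , π≡ = ↔.↔-trans (Perm.cast-id (sym (ℕ.+-identityʳ a))) π , λ i →
    trans (cong (Inverse.to π) (Fin.toℕ-injective
            (trans (Fin.toℕ-cast (sym (ℕ.+-identityʳ a)) i) (sym (Fin.toℕ-↑ˡ i 0)))))
          (π≡ i)

  other-end-unique : ∀ {n} {a b u v w : Fin n} → u ≢ v → u ≢ w →
                     u ∈ends[ a , b ] → v ∈ends[ a , b ] → w ∈ends[ a , b ] → v ≡ w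
  other-end-unique u≢v u≢w (inj₁ u≡a) (inj₁ v≡a) _ = contradiction (trans u≡a (sym v≡a)) u≢v
  other-end-unique u≢v u≢w (inj₂ u≡b) (inj₂ v≡b) _ = contradiction (trans u≡b (sym v≡b)) u≢v
  other-end-unique u≢v u≢w (inj₁ u≡a) _ (inj₁ w≡a) = contradiction (trans u≡a (sym w≡a)) u≢w
  other-end-unique u≢v u≢w (inj₂ u≡b) _ (inj₂ w≡b) = contradiction (trans u≡b (sym w≡b)) u≢w
  other-end-unique u≢v u≢w (inj₁ _) (inj₂ v≡b) (inj₂ w≡b) = trans v≡b (sym w≡b)
  other-end-unique u≢v u≢w (inj₂ _) (inj₁ v≡a) (inj₁ w≡a) = trans v≡a (sym w≡a)

  -- A labelling of a graph with edges A e B e by the vertices and edges of the diamond with pendant edges,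
  -- such that the head of each edge is dominated by the head of the corresponding edge there.
  record Labelling {ℓ n k} (A B : Fin k → Fin n) (_≼_ : Rel (Fin n) ℓ) : Set ℓ where
    field
      {l}       : ℕ
      ψ         : Fin (4 ℕ.+ l) ↔ Fin n
      φ         : Fin (5 ℕ.+ l) ↔ Fin k
      B′        : Fin (5 ℕ.+ l) → Fin (4 ℕ.+ l)
      tail≢B′   : ∀ e → tail e ≢ B′ e
      ends      : ∀ e u → Inverse.to ψ u ∈ends[ A (Inverse.to φ e) , B (Inverse.to φ e) ] ⇔ u ∈ends[ tail e , B′ e ]
      B′1≡1     : B′ 1F ≡ 1F
      B′3≢0     : B′ 3F ≢ 0F
      dominated : ∀ e → Inverse.to ψ (B′ e) ≼ Inverse.to ψ (head e)

  module _ {ℓ N k} {A B : Fin k → Fin (suc N)} {_≼_ : Rel (Fin (suc N)) ℓ}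
    (total : Total _≼_) (≼-trans : Transitive _≼_)
    (A≢B : ∀ e → A e ≢ B e)
    (simple : ∀ {u v} → u ≢ v → ∀ {e f} → u ∈ends[ A e , B e ] → v ∈ends[ A e , B e ] →
              u ∈ends[ A f , B f ] → v ∈ends[ A f , B f ] → e ≡ f)
    (connected : ∀ u v → Star (λ u v → ∃[ e ] u ∈ends[ A e , B e ] × v ∈ends[ A e , B e ]) u v)
    (size≡ : suc (suc N) ≡ k) where

    private
      V E : Set
      V = Fin (suc N)
      E = Fin k

      infix 4 _∈ᵉ_
      _∈ᵉ_ : V → E → Set
      u ∈ᵉ e = u ∈ends[ A e , B e ]

      _∈ᵉ?_ : ∀ u e → Dec (u ∈ᵉ e)
      u ∈ᵉ? e = (u Fin.≟ A e) ⊎-dec (u Fin.≟ B e)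

      ≼-refl : ∀ {u} → u ≼ u
      ≼-refl = [ id , id ]′ (total _ _)

      root : V
      root = proj₁ (maximum total ≼-trans id)

      ≼root : ∀ u → u ≼ root
      ≼root = proj₂ (maximum total ≼-trans id)

      Within : ℕ → V → Set
      Within zero u = u ≡ root
      Within (suc i) u = Within i u ⊎ ∃[ e ] u ∈ᵉ e × ∃[ v ] v ∈ᵉ e × Within i v

      within? : ∀ u i → Dec (Within i u)
      within? u zero = u Fin.≟ root
      within? u (suc i) = within? u i ⊎-dec
        Fin.any? λ e → (u ∈ᵉ? e) ×-dec Fin.any? λ v → (v ∈ᵉ? e) ×-dec within? v i

      reach : ∀ {u} → Star (λ u v → ∃[ e ] u ∈ᵉ e × v ∈ᵉ e) u root → ∃[ i ] Within i u
      reach ε = 0 , refl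
      reach ((e , u∈e , v∈e) ◅ path) = let i , v-within = reach path in
        suc i , inj₂ (e , u∈e , _ , v∈e , v-within)

      distance : ∀ u → ∃[ i ] Within i u × (∀ {j} → Within j u → i ℕ.≤ j)
      distance u = least (within? u) (proj₂ (reach (connected u root)))

      depth : V → ℕ
      depth u = proj₁ (distance u)

      -- If `u` were within the smaller radius already, its distance would not be minimal; so the
      -- last step of the recursion crosses an edge to a vertex that is closer to the root.
      descend : ∀ u → u ≢ root → ∃[ e ] u ∈ᵉ e × ∃[ v ] v ∈ᵉ e × depth v ℕ.< depth u
      descend u u≢root with distance u
      ... | zero , u≡root , _ = contradiction u≡root u≢root
      ... | suc i , inj₁ u-within , least-u = contradiction (least-u u-within) ℕ.1+n≰n
      ... | suc i , inj₂ (e , u∈e , v , v∈e , v-within) , _ =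
            e , u∈e , v , v∈e , s≤s (proj₂ (proj₂ (distance v)) v-within)

      -- A spanning tree that contains every edge at the root.
      record Parent (u : V) : Set where
        field
          via    : E
          to     : V
          u∈via  : u ∈ᵉ via
          to∈via : to ∈ᵉ via
          u≢to   : u ≢ to
          toward : to ≡ root ⊎ (¬ (∃[ e ] u ∈ᵉ e × root ∈ᵉ e) × depth to ℕ.< depth u)

      parentOf : ∀ u → u ≢ root → Parent u
      parentOf u u≢root with Fin.any? (λ e → (u ∈ᵉ? e) ×-dec (root ∈ᵉ? e))
      ... | yes (e , u∈e , root∈e) = record
            { via = e ; to = root ; u∈via = u∈e ; to∈via = root∈e ; u≢to = u≢root ; toward = inj₁ refl }
      ... | no not-adjacent with descend u u≢root
      ...   | e , u∈e , v , v∈e , v<u = record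
            { via = e ; to = v ; u∈via = u∈e ; to∈via = v∈e
            ; u≢to = λ u≡v → ℕ.<-irrefl (cong depth (sym u≡v)) v<u ; toward = inj₂ (not-adjacent , v<u) }

      open Parent

      -- The decision is made from `u` alone, so that the parent selected by `parent` does not vary
      -- with the proof of `u ≢ root`; `via-cong` rests on this.
      root-or-parent : ∀ u → u ≡ root ⊎ Parent u
      root-or-parent u with u Fin.≟ root
      ... | yes u≡root = inj₁ u≡root
      ... | no u≢root = inj₂ (parentOf u u≢root)

      parent : ∀ u → u ≢ root → Parent u
      parent u u≢root = [ (λ u≡root → contradiction u≡root u≢root) , id ]′ (root-or-parent u)

      via-cong : ∀ {u v} (u≢root : u ≢ root) (v≢root : v ≢ root) → u ≡ v →
                 via (parent u u≢root) ≡ via (parent v v≢root)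
      via-cong {u} u≢root v≢root refl with root-or-parent u
      ... | inj₁ u≡root = contradiction u≡root u≢root
      ... | inj₂ _ = refl

      -- Two distinct vertices with the same parent edge would be each other's parent. Neither is
      -- the root, so each would have to be strictly closer to the root than the other.
      via-injective : ∀ {u v} (u≢root : u ≢ root) (v≢root : v ≢ root) →
                      via (parent u u≢root) ≡ via (parent v v≢root) → u ≡ v
      via-injective {u} {v} u≢root v≢root same with u Fin.≟ v
      ... | yes u≡v = u≡v
      ... | no u≢v = contradiction (toward pu) (up (toward pv))
        where
        pu = parent u u≢root
        pv = parent v v≢root

        v≡to-u : v ≡ to pu
        v≡to-u = other-end-unique u≢v (u≢to pu) (u∈via pu) (subst (v ∈ᵉ_) (sym same) (u∈via pv)) (to∈via pu)

        u≡to-v : u ≡ to pv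
        u≡to-v = other-end-unique (u≢v ∘ sym) (u≢to pv) (u∈via pv) (subst (u ∈ᵉ_) same (u∈via pu)) (to∈via pv)

        up : to pv ≡ root ⊎ (_ × depth (to pv) ℕ.< depth v) → ¬ (to pu ≡ root ⊎ (_ × depth (to pu) ℕ.< depth u))
        up (inj₁ to-v≡root) _ = u≢root (trans u≡to-v to-v≡root)
        up _ (inj₁ to-u≡root) = v≢root (trans v≡to-u to-u≡root)
        up (inj₂ (_ , v↓)) (inj₂ (_ , u↓)) = ℕ.<-asym
          (subst (λ x → depth x ℕ.< depth v) (sym u≡to-v) v↓) (subst (λ x → depth x ℕ.< depth u) (sym v≡to-u) u↓)

      to≡root : ∀ {u} u≢root → (∃[ e ] u ∈ᵉ e × root ∈ᵉ e) → to (parent u u≢root) ≡ root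
      to≡root {u} u≢root adjacent with toward (parent u u≢root)
      ... | inj₁ to≡ = to≡
      ... | inj₂ (not-adjacent , _) = contradiction adjacent not-adjacent

      Extra : E → Set
      Extra e = ∀ u u≢root → via (parent u u≢root) ≢ e

      other-end : ∀ {v} e → v ∈ᵉ e → ∃[ u ] u ≢ v × u ∈ᵉ e
      other-end e (inj₁ refl) = B e , A≢B e ∘ sym , inj₂ refl
      other-end e (inj₂ refl) = A e , A≢B e , inj₁ refl

      -- The other end `u` of an edge at the root has the root as parent. By simplicity that edge is
      -- the parent edge of `u`, hence not extra.
      root∉extra : ∀ {e} → Extra e → ¬ root ∈ᵉ e
      root∉extra {e} extra root∈e with other-end e root∈e
      ... | u , u≢root , u∈e = extra u u≢root (simple u≢root
            (u∈via p) (subst (_∈ᵉ via p) (to≡root u≢root (e , u∈e , root∈e)) (to∈via p)) u∈e root∈e)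
        where p = parent u u≢root

      -- The `N` vertices other than the root have distinct parent edges, while there are `N + 2`
      -- edges. The two extra edges are the images of the two indices added by `extend`.
      extras : ∃[ e ] ∃[ f ] e ≢ f × Extra e × Extra f
      extras = Inverse.to π (N ↑ʳ 0F) , Inverse.to π (N ↑ʳ 1F)
        , (λ eq → 0≢1 (Fin.↑ʳ-injective N 0F 1F (to-injective π eq))) , extra 0F , extra 1F
        where
        nonroot : ∀ i → punchIn root i ≢ root
        nonroot = Fin.punchInᵢ≢i root

        tree : Fin N → E
        tree i = via (parent (punchIn root i) (nonroot i))

        extended = extend 2 tree (λ eq → Fin.punchIn-injective root _ _ (via-injective (nonroot _) (nonroot _) eq))
          (trans (ℕ.+-comm N 2) size≡)
        π = proj₁ extended

        0≢1 : _≢_ {A = Fin 2} 0F 1F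
        0≢1 ()

        extra : ∀ j → Extra (Inverse.to π (N ↑ʳ j))
        extra j u u≢root eq = ↑ˡ≢↑ʳ N (to-injective π (trans (proj₂ extended i) (trans same eq)))
          where
          i = punchOut (u≢root ∘ sym)
          same = via-cong (nonroot i) u≢root (Fin.punchIn-punchOut (u≢root ∘ sym))

      record Ordered (e : E) : Set ℓ where
        field
          {big small} : V
          big∈     : big ∈ᵉ e
          small∈   : small ∈ᵉ e
          big≢     : big ≢ small
          small≼   : small ≼ big

      order-ends : ∀ e → Ordered e
      order-ends e with total (A e) (B e)
      ... | inj₁ A≼B = record { big∈ = inj₂ refl ; small∈ = inj₁ refl ; big≢ = A≢B e ∘ sym ; small≼ = A≼B }
      ... | inj₂ B≼A = record { big∈ = inj₁ refl ; small∈ = inj₂ refl ; big≢ = A≢B e ; small≼ = B≼A }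

      -- The two extra edges are e = {a, b} and f = {c, d}, where a is maximal among their ends.
      record ExtraPair : Set ℓ where
        field
          {e f}     : E
          {a b c d} : V
          e≢f       : e ≢ f
          extra-e   : Extra e
          extra-f   : Extra f
          a∈e       : a ∈ᵉ e
          b∈e       : b ∈ᵉ e
          c∈f       : c ∈ᵉ f
          d∈f       : d ∈ᵉ f
          a≢b       : a ≢ b
          c≢d       : c ≢ d
          c≢a       : c ≢ a
          c≢b       : c ≢ b
          d≼a       : d ≼ a

      -- The end `c` of `f` that is kept must lie off `e` to be a fourth corner, and the other end
      -- `d` will be moved onto `a`. The larger end of `f` is taken for `c` if it lies off `e`.
      -- Otherwise the smaller end is taken: it lies off `e`, since two edges do not share both
      -- ends.
      extra-pair′ : ∀ {e f} → e ≢ f → Extra e → Extra f → (oe : Ordered e) (of : Ordered f) →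
                    Ordered.big of ≼ Ordered.big oe → ExtraPair
      extra-pair′ {e} {f} e≢f extra-e extra-f oe of big≼big = choose (big of ∈ᵉ? e)
        where
        open Ordered
        choose : Dec (big of ∈ᵉ e) → ExtraPair
        choose (no big∉e) = record
          { e≢f = e≢f ; extra-e = extra-e ; extra-f = extra-f
          ; a∈e = big∈ oe ; b∈e = small∈ oe ; c∈f = big∈ of ; d∈f = small∈ of
          ; a≢b = big≢ oe ; c≢d = big≢ of
          ; c≢a = λ { refl → big∉e (big∈ oe) } ; c≢b = λ { refl → big∉e (small∈ oe) }
          ; d≼a = ≼-trans (small≼ of) big≼big }
        choose (yes big∈e) = record
          { e≢f = e≢f ; extra-e = extra-e ; extra-f = extra-f
          ; a∈e = big∈ oe ; b∈e = small∈ oe ; c∈f = small∈ of ; d∈f = big∈ of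
          ; a≢b = big≢ oe ; c≢d = big≢ of ∘ sym
          ; c≢a = λ { refl → small∉e (big∈ oe) } ; c≢b = λ { refl → small∉e (small∈ oe) }
          ; d≼a = big≼big }
          where
          small∉e : ¬ small of ∈ᵉ e
          small∉e small∈e = e≢f (simple (big≢ of) big∈e small∈e (big∈ of) (small∈ of))

      extra-pair : ExtraPair
      extra-pair with extras
      ... | e , f , e≢f , extra-e , extra-f with total (Ordered.big (order-ends e)) (Ordered.big (order-ends f))
      ...   | inj₂ f≼e = extra-pair′ e≢f extra-e extra-f (order-ends e) (order-ends f) f≼e
      ...   | inj₁ e≼f = extra-pair′ (e≢f ∘ sym) extra-f extra-e (order-ends f) (order-ends e) e≼f

      open ExtraPair extra-pair

      a≢root : a ≢ root
      a≢root a≡root = root∉extra extra-e (subst (_∈ᵉ e) a≡root a∈e)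

      b≢root : b ≢ root
      b≢root b≡root = root∉extra extra-e (subst (_∈ᵉ e) b≡root b∈e)

      c≢root : c ≢ root
      c≢root c≡root = root∉extra extra-f (subst (_∈ᵉ f) c≡root c∈f)

      d≢root : d ≢ root
      d≢root d≡root = root∉extra extra-f (subst (_∈ᵉ f) d≡root d∈f)

      -- The root and `a` take the two places of degree three in the diamond. Then `e` is already
      -- the edge `1F`, and `f` becomes the edge `3F` once `d` is moved onto `a`; the edges `0F`,
      -- `2F` and `4F` come from the parent edges of `b`, `a` and `c`.
      corners : Fin 4 → V
      corners 0F = root
      corners 1F = b
      corners 2F = a
      corners 3F = c

      corners-injective : Injective _≡_ _≡_ corners
      corners-injective {0F} {0F} _ = refl
      corners-injective {0F} {1F} eq = contradiction (sym eq) b≢root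
      corners-injective {0F} {2F} eq = contradiction (sym eq) a≢root
      corners-injective {0F} {3F} eq = contradiction (sym eq) c≢root
      corners-injective {1F} {0F} eq = contradiction eq b≢root
      corners-injective {1F} {1F} _ = refl
      corners-injective {1F} {2F} eq = contradiction (sym eq) a≢b
      corners-injective {1F} {3F} eq = contradiction (sym eq) c≢b
      corners-injective {2F} {0F} eq = contradiction eq a≢root
      corners-injective {2F} {1F} eq = contradiction eq a≢b
      corners-injective {2F} {2F} _ = refl
      corners-injective {2F} {3F} eq = contradiction (sym eq) c≢a
      corners-injective {3F} {0F} eq = contradiction eq c≢root
      corners-injective {3F} {1F} eq = contradiction eq c≢b
      corners-injective {3F} {2F} eq = contradiction eq c≢a
      corners-injective {3F} {3F} _ = refl

      remaining : ∃[ l ] 4 ℕ.+ l ≡ suc N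
      remaining = ℕ.m≤n⇒∃[o]m+o≡n (Fin.injective⇒≤ corners-injective)

      l : ℕ
      l = proj₁ remaining

      extended-corners = extend l corners corners-injective (proj₂ remaining)

      ψ : Fin (4 ℕ.+ l) ↔ V
      ψ = proj₁ extended-corners

      label : V → Fin (4 ℕ.+ l)
      label = Inverse.from ψ

      ψ-label : ∀ u → Inverse.to ψ (label u) ≡ u
      ψ-label u = Inverse.inverseˡ ψ refl

      ψ-injective : ∀ {i j} → Inverse.to ψ i ≡ Inverse.to ψ j → i ≡ j
      ψ-injective = to-injective ψ

      ψ-corner : ∀ i → Inverse.to ψ (i ↑ˡ l) ≡ corners i
      ψ-corner = proj₂ extended-corners

      ψ-nonroot : ∀ i → Inverse.to ψ (suc i) ≢ root
      ψ-nonroot i eq with () ← ψ-injective (trans eq (sym (ψ-corner 0F)))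

      parent-of : ∀ i → Parent (Inverse.to ψ (suc i))
      parent-of i = parent (Inverse.to ψ (suc i)) (ψ-nonroot i)

      -- The places `1F` and `3F` are reserved for the two extra edges. Every other edge is to be
      -- the parent edge of its tail, and `inj₂ i` stands for the one whose tail is `suc i`.
      kind : Fin (5 ℕ.+ l) ↔ (Fin 2 ⊎ Fin (3 ℕ.+ l))
      kind = mk↔ₛ′
        (λ { 0F → inj₂ 0F ; 1F → inj₁ 0F ; 2F → inj₂ 1F ; 3F → inj₁ 1F ; 4F → inj₂ 2F
           ; (5+ j) → inj₂ (suc (suc (suc j))) })
        (λ { (inj₂ 0F) → 0F ; (inj₁ 0F) → 1F ; (inj₂ 1F) → 2F ; (inj₁ 1F) → 3F ; (inj₂ 2F) → 4F
           ; (inj₂ (suc (suc (suc j)))) → 5+ j })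
        (λ { (inj₂ 0F) → refl ; (inj₁ 0F) → refl ; (inj₂ 1F) → refl ; (inj₁ 1F) → refl ; (inj₂ 2F) → refl
           ; (inj₂ (suc (suc (suc j)))) → refl })
        (λ { 0F → refl ; 1F → refl ; 2F → refl ; 3F → refl ; 4F → refl ; (5+ j) → refl })

      edge-of : Fin 2 ⊎ Fin (3 ℕ.+ l) → E
      edge-of (inj₁ 0F) = e
      edge-of (inj₁ 1F) = f
      edge-of (inj₂ i) = via (parent-of i)

      edge-of-injective : ∀ {x y} → edge-of x ≡ edge-of y → x ≡ y
      edge-of-injective {inj₁ 0F} {inj₁ 0F} _ = refl
      edge-of-injective {inj₁ 1F} {inj₁ 1F} _ = refl
      edge-of-injective {inj₁ 0F} {inj₁ 1F} eq = contradiction eq e≢f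
      edge-of-injective {inj₁ 1F} {inj₁ 0F} eq = contradiction (sym eq) e≢f
      edge-of-injective {inj₁ 0F} {inj₂ i} eq = contradiction (sym eq) (extra-e _ (ψ-nonroot i))
      edge-of-injective {inj₁ 1F} {inj₂ i} eq = contradiction (sym eq) (extra-f _ (ψ-nonroot i))
      edge-of-injective {inj₂ i} {inj₁ 0F} eq = contradiction eq (extra-e _ (ψ-nonroot i))
      edge-of-injective {inj₂ i} {inj₁ 1F} eq = contradiction eq (extra-f _ (ψ-nonroot i))
      edge-of-injective {inj₂ i} {inj₂ j} eq =
        cong inj₂ (Fin.suc-injective (ψ-injective (via-injective (ψ-nonroot i) (ψ-nonroot j) eq)))

      edges = injective⇒permutation (edge-of ∘ Inverse.to kind) (to-injective kind ∘ edge-of-injective)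
        (trans (cong suc (proj₂ remaining)) size≡)

      B′ : Fin (5 ℕ.+ l) → Fin (4 ℕ.+ l)
      B′ 0F = label (to (parent-of 0F))
      B′ 1F = 1F
      B′ 2F = label (to (parent-of 1F))
      B′ 3F = label d
      B′ 4F = label (to (parent-of 2F))
      B′ (5+ j) = label (to (parent-of (suc (suc (suc j)))))

      both-ends : ∀ {g u v w} → u ≢ v → u ∈ᵉ g → v ∈ᵉ g → w ∈ᵉ g ⇔ w ∈ends[ u , v ]
      both-ends {g} {u} {v} {w} u≢v u∈g v∈g = mk⇔ to-ends λ { (inj₁ refl) → u∈g ; (inj₂ refl) → v∈g }
        where
        to-ends : w ∈ᵉ g → w ∈ends[ u , v ]
        to-ends w∈g with u Fin.≟ w
        ... | yes u≡w = inj₁ (sym u≡w)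
        ... | no u≢w = inj₂ (sym (other-end-unique u≢v u≢w u∈g v∈g w∈g))

      ψ-ends : ∀ {i j u v} w → Inverse.to ψ i ≡ u → Inverse.to ψ j ≡ v →
               Inverse.to ψ w ∈ends[ u , v ] ⇔ w ∈ends[ i , j ]
      ψ-ends w refl refl = mk⇔ (Sum.map ψ-injective ψ-injective) (Sum.map (cong (Inverse.to ψ)) (cong (Inverse.to ψ)))

      ends-at : ∀ g w {i j u v} → u ≢ v → u ∈ᵉ g → v ∈ᵉ g → Inverse.to ψ i ≡ u → Inverse.to ψ j ≡ v →
                Inverse.to ψ w ∈ᵉ g ⇔ w ∈ends[ i , j ]
      ends-at g w u≢v u∈g v∈g ψi ψj = ⇔.trans (both-ends u≢v u∈g v∈g) (ψ-ends w ψi ψj)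

      ends-tree : ∀ w i → Inverse.to ψ w ∈ᵉ via (parent-of i) ⇔ w ∈ends[ suc i , label (to (parent-of i)) ]
      ends-tree w i = ends-at _ w (u≢to p) (u∈via p) (to∈via p) refl (ψ-label (to p))
        where p = parent-of i

      ends-of : ∀ g w → Inverse.to ψ w ∈ᵉ edge-of (Inverse.to kind g) ⇔ w ∈ends[ tail g , B′ g ]
      ends-of 0F w = ends-tree w 0F
      ends-of 1F w = ends-at e w a≢b a∈e b∈e (ψ-corner 2F) (ψ-corner 1F)
      ends-of 2F w = ends-tree w 1F
      ends-of 3F w = ends-at f w c≢d c∈f d∈f (ψ-corner 3F) (ψ-label d)
      ends-of 4F w = ends-tree w 2F
      ends-of (5+ j) w = ends-tree w (suc (suc (suc j)))

      label-≢ : ∀ {i u} → Inverse.to ψ i ≢ u → i ≢ label u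
      label-≢ {i} {u} ψi≢u i≡ = ψi≢u (trans (cong (Inverse.to ψ) i≡) (ψ-label u))

      tail≢B′ : ∀ g → tail g ≢ B′ g
      tail≢B′ 0F = label-≢ (u≢to (parent-of 0F))
      tail≢B′ 1F ()
      tail≢B′ 2F = label-≢ (u≢to (parent-of 1F))
      tail≢B′ 3F = label-≢ (λ ψ3≡d → c≢d (trans (sym (ψ-corner 3F)) ψ3≡d))
      tail≢B′ 4F = label-≢ (u≢to (parent-of 2F))
      tail≢B′ (5+ j) = label-≢ (u≢to (parent-of (suc (suc (suc j)))))

      ≼ψ0 : ∀ u → u ≼ Inverse.to ψ 0F
      ≼ψ0 u = subst (u ≼_) (sym (ψ-corner 0F)) (≼root u)

      dominated : ∀ g → Inverse.to ψ (B′ g) ≼ Inverse.to ψ (head g)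
      dominated 0F = ≼ψ0 _
      dominated 1F = ≼-refl
      dominated 2F = ≼ψ0 _
      dominated 3F = subst (_≼ Inverse.to ψ 2F) (sym (ψ-label d)) (subst (d ≼_) (sym (ψ-corner 2F)) d≼a)
      dominated 4F = ≼ψ0 _
      dominated (5+ j) = ≼ψ0 _

    labelling : Labelling A B _≼_
    labelling = record
      { ψ = ψ
      ; φ = proj₁ edges
      ; B′ = B′
      ; tail≢B′ = tail≢B′
      ; ends = λ g w → subst (λ h → Inverse.to ψ w ∈ᵉ h ⇔ w ∈ends[ tail g , B′ g ])
          (sym (proj₂ edges g)) (ends-of g w)
      ; B′1≡1 = refl
      ; B′3≢0 = λ label-d≡0 → label-≢ (λ ψ0≡d → d≢root (trans (sym ψ0≡d) (ψ-corner 0F))) (sym label-d≡0)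
      ; dominated = dominated
      }

  -- From properties of the hypergraph to properties of its underlying graph.

  module _ {H r n k} {A B : Fin k → Fin n} (P : Presentation H r A B) where
    open Presentation P

    presentation-simple : MeetOnce H → ∀ {u v} → u ≢ v → ∀ {e f} → u ∈ends[ A e , B e ] → v ∈ends[ A e , B e ] →
      u ∈ends[ A f , B f ] → v ∈ends[ A f , B f ] → e ≡ f
    presentation-simple once {u} {v} u≢v {e} {f} u∈e v∈e u∈f v∈f =
      to-injective edges (once (u≢v ∘ Sum.inj₁-injective ∘ to-injective vertices)
        (Equivalence.from (old∈ u e) u∈e) (Equivalence.from (old∈ v e) v∈e)
        (Equivalence.from (old∈ u f) u∈f) (Equivalence.from (old∈ v f) v∈f))

    -- A path of H is followed in the graph by moving from a new vertex to an end of its edge.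
    presentation-connected : Connected H → ∀ u v →
      Star (λ u v → ∃[ e ] u ∈ends[ A e , B e ] × v ∈ends[ A e , B e ]) u v
    presentation-connected connected u v = subst₂ (Star _) (owner-old u) (owner-old v)
      (Star.gmap owner adjacent (connected (old u) (old v)))
      where
      owner′ : Fin n ⊎ (Fin k × Fin r) → Fin n
      owner′ (inj₁ u) = u
      owner′ (inj₂ (e , _)) = A e

      owner : Vertex H → Fin n
      owner v = owner′ (Inverse.from vertices v)

      owner-old : ∀ u → owner (old u) ≡ u
      owner-old u = cong owner′ (Inverse.inverseʳ vertices refl)

      owner′∈ : ∀ x e → Inverse.to vertices x ∈ edge H (at e) → owner′ x ∈ends[ A e , B e ]
      owner′∈ (inj₁ u) e u∈e = Equivalence.to (old∈ u e) u∈e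
      owner′∈ (inj₂ (f , i)) e v∈e = inj₁ (cong A (Equivalence.to (new∈ f i e) v∈e))

      owner∈ : ∀ v e → v ∈ edge H e → owner v ∈ends[ A (Inverse.from edges e) , B (Inverse.from edges e) ]
      owner∈ v e v∈e = owner′∈ (Inverse.from vertices v) (Inverse.from edges e)
        (subst₂ (λ v e → v ∈ edge H e) (sym (Inverse.inverseˡ vertices refl))
          (sym (Inverse.inverseˡ edges refl)) v∈e)

      adjacent : ∀ {v w} → Joined H v w → ∃[ e ] owner v ∈ends[ A e , B e ] × owner w ∈ends[ A e , B e ]
      adjacent (e , v∈e , w∈e) = Inverse.from edges e , owner∈ _ e v∈e , owner∈ _ e w∈e

    presentation-size : k ≡ size H
    presentation-size = Perm.↔⇒≡ edges

    presentation-order : n ℕ.+ k ℕ.* r ≡ order H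
    presentation-order = Perm.↔⇒≡ (↔.↔-trans (↔.↔-trans Fin.+↔⊎ (↔.↔-refl ⊎-↔ Fin.*↔×)) vertices)

    -- The power has `n + k r` vertices, so the term `k r` cancels from both sides of the Type I
    -- equation `n + k r + 1 = k (r + 1)`.
    presentation-typeI : suc (order H) ≡ size H ℕ.* suc r → suc n ≡ k
    presentation-typeI typeI = ℕ.+-cancelʳ-≡ (k ℕ.* r) (suc n) k (begin
      suc n ℕ.+ k ℕ.* r  ≡⟨ cong suc presentation-order ⟩
      suc (order H)      ≡⟨ typeI ⟩
      size H ℕ.* suc r   ≡⟨ cong (ℕ._* suc r) presentation-size ⟨
      k ℕ.* suc r        ≡⟨ ℕ.*-suc k r ⟩
      k ℕ.+ k ℕ.* r      ∎)
      where open ≡-Reasoning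

  presentation-labelling : ∀ {ℓ H r n k} {A B : Fin k → Fin n} {_≼_ : Rel (Fin n) ℓ} →
    Total _≼_ → Transitive _≼_ → Presentation H r A B → MeetOnce H → Connected H →
    suc (order H) ≡ size H ℕ.* suc r → Labelling A B _≼_
  -- Without vertices the count would leave exactly one edge, which could have no ends.
  presentation-labelling {n = zero} {A = A} total transitive P once connected typeI
    with refl ← presentation-typeI P typeI with () ← A 0F
  presentation-labelling {n = suc N} total transitive P once connected typeI =
    labelling total transitive (Presentation.A≢B P) (presentation-simple P once)
      (presentation-connected P connected) (presentation-typeI P typeI)

  T₁C-presentation : ∀ r l → Presentation (T₁C (2 ℕ.+ r) l 0 0 0) r (tail {l ℕ.+ 0}) head
  T₁C-presentation r l = attachPendants-presentation r _ (lookup-replicate-++[] l (_↑ˡ_ {4} 0F (5 ℕ.* r)))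

open Presentations

-- Ordered field arithmetic and the ring solver.

module OrderedField {c ℓ₁ ℓ₂} (ℝ : CompleteOrderedField c ℓ₁ ℓ₂) where
  open CompleteOrderedField ℝ public
  open CommutativeRing commutativeRing public
    using (refl; sym; trans; reflexive; semiring; ring; +-abelianGroup;
           +-cong; +-congˡ; +-congʳ; +-identityˡ; +-identityʳ; +-comm; +-assoc; -‿inverseʳ; -‿cong;
           *-cong; *-congˡ; *-congʳ; *-identityˡ; *-identityʳ; *-comm; *-assoc; distribʳ; zeroˡ; zeroʳ)
  open IsDecTotalOrder isDecTotalOrder public
    using (_≟_; _≤?_; total; antisym)
    renaming (refl to ≤-refl; reflexive to ≤-reflexive; trans to ≤-trans)
  open RingProperties ring public using (-‿distribˡ-*; -‿distribʳ-*)
  open AbelianGroupProperties +-abelianGroup public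
    using (⁻¹-∙-comm) renaming (⁻¹-involutive to -‿involutive; ε⁻¹≈ε to -0≈0)

  poset : Poset c ℓ₁ ℓ₂
  poset = record { isPartialOrder = IsDecTotalOrder.isPartialOrder isDecTotalOrder }

  module ≤-Reasoning = PartialOrderReasoning poset

  infix 4 _≉_
  _≉_ : Carrier → Carrier → Set ℓ₁
  x ≉ y = ¬ x ≈ y

  -- The ring homomorphism from the integers. It supplies the solver with integer coefficients,
  -- whose equality is decided by computation.
  ⟦_⟧ℤ : ℤ → Carrier
  ⟦ ℤ.+ n ⟧ℤ = fromNat n
  ⟦ -[1+ n ] ⟧ℤ = - fromNat (suc n)

  fromNat-+ : ∀ m n → fromNat (m ℕ.+ n) ≈ fromNat m + fromNat n
  fromNat-+ = MonoidMult.×-homo-+ +-monoid 1#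

  fromNat-* : ∀ m n → fromNat (m ℕ.* n) ≈ fromNat m * fromNat n
  fromNat-* = SemiringMult.×1-homo-* semiring

  private
    cancel-1+ : ∀ x y → x - y ≈ (1# + x) - (1# + y)
    cancel-1+ x y = sym (begin-equality
      (1# + x) + - (1# + y)      ≈⟨ +-cong (+-comm x 1#) (⁻¹-∙-comm 1# y) ⟨
      (x + 1#) + (- 1# + - y)    ≈⟨ +-assoc x 1# _ ⟩
      x + (1# + (- 1# + - y))    ≈⟨ +-congˡ (+-assoc 1# (- 1#) (- y)) ⟨
      x + ((1# + - 1#) + - y)    ≈⟨ +-congˡ (trans (+-congʳ (-‿inverseʳ 1#)) (+-identityˡ (- y))) ⟩
      x + - y                    ∎)
      where open ≤-Reasoning

    ⊖-homo : ∀ m n → ⟦ m ⊖ n ⟧ℤ ≈ fromNat m - fromNat n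
    ⊖-homo m zero = sym (trans (+-congˡ -0≈0) (+-identityʳ _))
    ⊖-homo zero (suc n) = sym (+-identityˡ _)
    ⊖-homo (suc m) (suc n) = begin-equality
      ⟦ suc m ⊖ suc n ⟧ℤ             ≡⟨ ≡.cong ⟦_⟧ℤ (ℤ.[1+m]⊖[1+n]≡m⊖n m n) ⟩
      ⟦ m ⊖ n ⟧ℤ                     ≈⟨ ⊖-homo m n ⟩
      fromNat m - fromNat n          ≈⟨ cancel-1+ _ _ ⟩
      fromNat (suc m) - fromNat (suc n) ∎
      where open ≤-Reasoning

    +-homo : ∀ i j → ⟦ i ℤ.+ j ⟧ℤ ≈ ⟦ i ⟧ℤ + ⟦ j ⟧ℤ
    +-homo (ℤ.+ m) (ℤ.+ n) = fromNat-+ m n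
    +-homo (ℤ.+ m) -[1+ n ] = ⊖-homo m (suc n)
    +-homo -[1+ m ] (ℤ.+ n) = trans (⊖-homo n (suc m)) (+-comm _ _)
    +-homo -[1+ m ] -[1+ n ] = begin-equality
      - fromNat (suc (suc (m ℕ.+ n)))             ≡⟨ ≡.cong (λ x → - fromNat (suc x)) (ℕ.+-suc m n) ⟨
      - fromNat (suc m ℕ.+ suc n)                 ≈⟨ -‿cong (fromNat-+ (suc m) (suc n)) ⟩
      - (fromNat (suc m) + fromNat (suc n))       ≈⟨ ⁻¹-∙-comm _ _ ⟨
      - fromNat (suc m) + - fromNat (suc n)       ∎
      where open ≤-Reasoning

    -◃-homo : ∀ n → ⟦ Sign.- ◃ n ⟧ℤ ≈ - fromNat n
    -◃-homo zero = sym -0≈0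
    -◃-homo (suc n) = refl

    +◃-homo : ∀ n → ⟦ Sign.+ ◃ n ⟧ℤ ≈ fromNat n
    +◃-homo zero = refl
    +◃-homo (suc n) = refl

    *-homo : ∀ i j → ⟦ i ℤ.* j ⟧ℤ ≈ ⟦ i ⟧ℤ * ⟦ j ⟧ℤ
    *-homo (ℤ.+ m) (ℤ.+ n) = trans (+◃-homo (m ℕ.* n)) (fromNat-* m n)
    *-homo (ℤ.+ m) -[1+ n ] =
      trans (-◃-homo (m ℕ.* suc n)) (trans (-‿cong (fromNat-* m (suc n))) (-‿distribʳ-* _ _))
    *-homo -[1+ m ] (ℤ.+ n) =
      trans (-◃-homo (suc m ℕ.* n)) (trans (-‿cong (fromNat-* (suc m) n)) (-‿distribˡ-* _ _))
    *-homo -[1+ m ] -[1+ n ] = begin-equality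
      fromNat (suc m ℕ.* suc n)                ≈⟨ fromNat-* (suc m) (suc n) ⟩
      fromNat (suc m) * fromNat (suc n)        ≈⟨ -‿involutive _ ⟨
      - - (fromNat (suc m) * fromNat (suc n))  ≈⟨ -‿cong (-‿distribʳ-* _ _) ⟩
      - (fromNat (suc m) * - fromNat (suc n))  ≈⟨ -‿distribˡ-* _ _ ⟩
      - fromNat (suc m) * - fromNat (suc n)    ∎
      where open ≤-Reasoning

    -‿homo : ∀ i → ⟦ ℤ.- i ⟧ℤ ≈ - ⟦ i ⟧ℤ
    -‿homo (ℤ.+ zero) = sym -0≈0
    -‿homo (ℤ.+ suc n) = refl
    -‿homo -[1+ n ] = sym (-‿involutive _)

    morphism : ℤ.+-*-rawRing -Raw-AlmostCommutative⟶ fromCommutativeRing commutativeRing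
    morphism = record
      { ⟦_⟧ = ⟦_⟧ℤ ; +-homo = +-homo ; *-homo = *-homo ; -‿homo = -‿homo
      ; 0-homo = refl ; 1-homo = +-identityʳ 1# }

  module Solver = RingSolver ℤ.+-*-rawRing (fromCommutativeRing commutativeRing) morphism
    (λ i j → Maybe.map (λ eq → reflexive (≡.cong ⟦_⟧ℤ eq)) (dec⇒maybe (i ℤ.≟ j)))
  open Solver public using (solve; con; var; op; _:=_; _:+_; _:*_; _:-_; :-_; _:^_; Polynomial; ⟦_⟧)

  infix 9 ♯_
  ♯_ : ∀ {n} → ℕ → Polynomial n
  ♯ k = con (ℤ.+ k)

  +-mono-≤ : ∀ {a b x y} → a ≤ b → x ≤ y → a + x ≤ b + y
  +-mono-≤ {a} {b} {x} {y} a≤b x≤y = begin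
    a + x  ≤⟨ +-monoˡ-≤ x a≤b ⟩
    b + x  ≈⟨ +-comm b x ⟩
    x + b  ≤⟨ +-monoˡ-≤ b x≤y ⟩
    y + b  ≈⟨ +-comm y b ⟩
    b + y  ∎
    where open ≤-Reasoning

  x≤y⇒0≤y-x : ∀ {x y} → x ≤ y → 0# ≤ y - x
  x≤y⇒0≤y-x {x} {y} x≤y = begin
    0#     ≈⟨ -‿inverseʳ x ⟨
    x - x  ≤⟨ +-monoˡ-≤ (- x) x≤y ⟩
    y - x  ∎
    where open ≤-Reasoning

  x<y⇒0<y-x : ∀ {x y} → x < y → 0# < y - x
  x<y⇒0<y-x {x} {y} (x≤y , x≉y) = x≤y⇒0≤y-x x≤y , λ 0≈y-x → x≉y (begin-equality
    x            ≈⟨ +-identityʳ x ⟨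
    x + 0#       ≈⟨ +-congˡ 0≈y-x ⟩
    x + (y - x)  ≈⟨ solve 2 (λ x y → x :+ (y :- x) := y) refl x y ⟩
    y            ∎)
    where open ≤-Reasoning

  0≤d⇒x≤y : ∀ {x y d} → 0# ≤ d → y ≈ x + d → x ≤ y
  0≤d⇒x≤y {x} {y} {d} 0≤d y≈ = begin
    x       ≈⟨ +-identityʳ x ⟨
    x + 0#  ≤⟨ +-mono-≤ ≤-refl 0≤d ⟩
    x + d   ≈⟨ y≈ ⟨
    y       ∎
    where open ≤-Reasoning

  0<d⇒x<y : ∀ {x y d} → 0# < d → y ≈ x + d → x < y
  0<d⇒x<y {x} {y} {d} (0≤d , 0≉d) y≈ = 0≤d⇒x≤y 0≤d y≈ , λ x≈y → 0≉d (begin-equality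
    0#           ≈⟨ -‿inverseʳ x ⟨
    x - x        ≈⟨ +-congʳ (trans x≈y y≈) ⟩
    (x + d) - x  ≈⟨ solve 2 (λ x d → (x :+ d) :- x := d) refl x d ⟩
    d            ∎)
    where open ≤-Reasoning

  ≰⇒> : ∀ {x y} → ¬ x ≤ y → y < x
  ≰⇒> {x} {y} x≰y with total x y
  ... | inj₁ x≤y = contradiction x≤y x≰y
  ... | inj₂ y≤x = y≤x , λ y≈x → x≰y (≤-reflexive (sym y≈x))

  <⇒≱ : ∀ {x y} → x < y → ¬ y ≤ x
  <⇒≱ (x≤y , x≉y) y≤x = x≉y (antisym x≤y y≤x)

  ≤-or-> : ∀ x y → x ≤ y ⊎ y < x
  ≤-or-> x y with x ≤? y
  ... | yes x≤y = inj₁ x≤y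
  ... | no x≰y = inj₂ (≰⇒> x≰y)

  <⇒≉ : ∀ {x y} → x < y → x ≉ y
  <⇒≉ = proj₂

  <-≤-trans : ∀ {x y z} → x < y → y ≤ z → x < z
  <-≤-trans x<y y≤z = begin-strict _ <⟨ x<y ⟩ _ ≤⟨ y≤z ⟩ _ ∎
    where open ≤-Reasoning

  ≤-<-trans : ∀ {x y z} → x ≤ y → y < z → x < z
  ≤-<-trans x≤y y<z = begin-strict _ ≤⟨ x≤y ⟩ _ <⟨ y<z ⟩ _ ∎
    where open ≤-Reasoning

  <-respʳ-≈ : ∀ {x y z} → y ≈ z → x < y → x < z
  <-respʳ-≈ y≈z x<y = <-≤-trans x<y (≤-reflexive y≈z)

  ≤-respʳ-≈ : ∀ {x y z} → y ≈ z → x ≤ y → x ≤ z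
  ≤-respʳ-≈ y≈z x≤y = ≤-trans x≤y (≤-reflexive y≈z)

  0≤x+y : ∀ {x y} → 0# ≤ x → 0# ≤ y → 0# ≤ x + y
  0≤x+y 0≤x 0≤y = ≤-trans (≤-reflexive (sym (+-identityˡ 0#))) (+-mono-≤ 0≤x 0≤y)

  0<x+y : ∀ {x y} → 0# < x → 0# ≤ y → 0# < x + y
  0<x+y {x} {y} 0<x 0≤y = <-≤-trans 0<x (0≤d⇒x≤y 0≤y refl)

  0≤x⇒0<y⇒0<x+y : ∀ {x y} → 0# ≤ x → 0# < y → 0# < x + y
  0≤x⇒0<y⇒0<x+y 0≤x 0<y = <-respʳ-≈ (+-comm _ _) (0<x+y 0<y 0≤x)

  *≈0 : ∀ {x y} → x * y ≈ 0# → x ≉ 0# → y ≈ 0#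
  *≈0 {x} {y} xy≈0 x≉0 = begin-equality
    y               ≈⟨ *-identityˡ y ⟨
    1# * y          ≈⟨ *-congʳ (⁻¹-inverse x≉0) ⟨
    x * x ⁻¹ * y    ≈⟨ solve 3 (λ x i y → x :* i :* y := i :* (x :* y)) refl x (x ⁻¹) y ⟩
    x ⁻¹ * (x * y)  ≈⟨ *-congˡ xy≈0 ⟩
    x ⁻¹ * 0#       ≈⟨ zeroʳ _ ⟩
    0#              ∎
    where open ≤-Reasoning

  0<x*y : ∀ {x y} → 0# < x → 0# < y → 0# < x * y
  0<x*y (0≤x , 0≉x) (0≤y , 0≉y) =
    *-nonNegative 0≤x 0≤y , λ 0≈xy → 0≉y (sym (*≈0 (sym 0≈xy) (λ x≈0 → 0≉x (sym x≈0))))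

  -x≥0 : ∀ {x} → x ≤ 0# → 0# ≤ - x
  -x≥0 x≤0 = ≤-respʳ-≈ (+-identityˡ _) (x≤y⇒0≤y-x x≤0)

  0≤x² : ∀ x → 0# ≤ x * x
  0≤x² x with total 0# x
  ... | inj₁ 0≤x = *-nonNegative 0≤x 0≤x
  ... | inj₂ x≤0 = ≤-respʳ-≈ (solve 1 (λ x → :- x :* :- x := x :* x) refl x)
                             (*-nonNegative (-x≥0 x≤0) (-x≥0 x≤0))

  x²≈0⇒x≈0 : ∀ {x} → x * x ≈ 0# → x ≈ 0#
  x²≈0⇒x≈0 {x} x²≈0 with x ≟ 0#
  ... | yes x≈0 = x≈0
  ... | no x≉0 = *≈0 x²≈0 x≉0

  0<1 : 0# < 1#
  0<1 = ≤-respʳ-≈ (*-identityˡ 1#) (0≤x² 1#) , 0≉1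

  0≤fromNat : ∀ n → 0# ≤ fromNat n
  0≤fromNat zero = ≤-refl
  0≤fromNat (suc n) = 0≤x+y (proj₁ 0<1) (0≤fromNat n)

  0<fromNat : ∀ n → 0# < fromNat (suc n)
  0<fromNat n = 0<x+y 0<1 (0≤fromNat n)

  >⇒≉0 : ∀ {x} → 0# < x → x ≉ 0#
  >⇒≉0 (_ , 0≉x) x≈0 = 0≉x (sym x≈0)

  *-monoˡ-≤ : ∀ {z x y} → 0# ≤ z → x ≤ y → z * x ≤ z * y
  *-monoˡ-≤ {z} {x} {y} 0≤z x≤y = 0≤d⇒x≤y (*-nonNegative 0≤z (x≤y⇒0≤y-x x≤y))
    (solve 3 (λ x y z → z :* y := z :* x :+ z :* (y :- x)) refl x y z)

  *-monoˡ-< : ∀ {z x y} → 0# < z → x < y → z * x < z * y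
  *-monoˡ-< {z} {x} {y} 0<z x<y = 0<d⇒x<y (0<x*y 0<z (x<y⇒0<y-x x<y))
    (solve 3 (λ x y z → z :* y := z :* x :+ z :* (y :- x)) refl x y z)

  *-cancelˡ-≤ : ∀ {z x y} → 0# < z → z * x ≤ z * y → x ≤ y
  *-cancelˡ-≤ {z} {x} {y} 0<z zx≤zy with ≤-or-> x y
  ... | inj₁ x≤y = x≤y
  ... | inj₂ y<x = contradiction zx≤zy (<⇒≱ (*-monoˡ-< 0<z y<x))

  *-cancelˡ-< : ∀ {z x y} → 0# ≤ z → z * x < z * y → x < y
  *-cancelˡ-< {z} {x} {y} 0≤z zx<zy with ≤-or-> y x
  ... | inj₁ y≤x = contradiction (*-monoˡ-≤ 0≤z y≤x) (<⇒≱ zx<zy)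
  ... | inj₂ x<y = x<y

  0<x⁻¹ : ∀ {x} → 0# < x → 0# < x ⁻¹
  0<x⁻¹ {x} 0<x = *-cancelˡ-< (proj₁ 0<x) (begin-strict
    x * 0#    ≈⟨ zeroʳ x ⟩
    0#        <⟨ 0<1 ⟩
    1#        ≈⟨ ⁻¹-inverse (>⇒≉0 0<x) ⟨
    x * x ⁻¹  ∎)
    where open ≤-Reasoning

  -- A syntactic test: it succeeds on expressions built from variables and natural constants by sums
  -- and products. A polynomial inequality is thus reduced to a solver identity that shifts the
  -- variables until no negative coefficient is left; `from-just` runs the test during type
  -- checking.
  nonNegative? : ∀ {n} (p : Polynomial n) → Maybe (∀ ρ → All (0# ≤_) ρ → 0# ≤ ⟦ p ⟧ ρ)
  nonNegative? (op o p q) with nonNegative? p | nonNegative? q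
  nonNegative? (op Solver.[+] p q) | just 0≤p | just 0≤q = just λ ρ 0≤ρ → 0≤x+y (0≤p ρ 0≤ρ) (0≤q ρ 0≤ρ)
  nonNegative? (op Solver.[*] p q) | just 0≤p | just 0≤q = just λ ρ 0≤ρ → *-nonNegative (0≤p ρ 0≤ρ) (0≤q ρ 0≤ρ)
  nonNegative? (op o p q) | _ | _ = nothing
  nonNegative? (con (ℤ.+ n)) = just λ _ _ → 0≤fromNat n
  nonNegative? (con -[1+ n ]) = nothing
  nonNegative? (var x) = just λ _ 0≤ρ → All.lookup⁺ 0≤ρ x
  nonNegative? (p :^ n) = nothing
  nonNegative? (:- p) = nothing

-- The intermediate value theorem for polynomials.

module IntermediateValue {c ℓ₁ ℓ₂} (ℝ : CompleteOrderedField c ℓ₁ ℓ₂) where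
  open OrderedField ℝ

  infix 4 _≤±_
  _≤±_ : Carrier → Carrier → Set ℓ₂
  u ≤± v = - v ≤ u × u ≤ v

  ≤±-resp-≈ : ∀ {u u′ v v′} → u ≈ u′ → v ≈ v′ → u ≤± v → u′ ≤± v′
  ≤±-resp-≈ u≈ v≈ (-v≤u , u≤v) =
    ≤-trans (≤-reflexive (-‿cong (sym v≈))) (≤-respʳ-≈ u≈ -v≤u) ,
    ≤-trans (≤-reflexive (sym u≈)) (≤-respʳ-≈ v≈ u≤v)

  ≤±-weaken : ∀ {u v w} → u ≤± v → v ≤ w → u ≤± w
  ≤±-weaken {u} {v} {w} (-v≤u , u≤v) v≤w =
    ≤-trans (0≤d⇒x≤y (x≤y⇒0≤y-x v≤w) (solve 2 (λ v w → :- v := :- w :+ (w :- v)) refl v w)) -v≤u ,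
    ≤-trans u≤v v≤w

  ≤±-neg : ∀ {u v} → u ≤± v → - u ≤± v
  ≤±-neg {u} {v} (-v≤u , u≤v) =
    0≤d⇒x≤y (x≤y⇒0≤y-x u≤v) (solve 2 (λ u v → :- u := :- v :+ (v :- u)) refl u v) ,
    0≤d⇒x≤y (x≤y⇒0≤y-x -v≤u) (solve 2 (λ u v → v := :- u :+ (u :- :- v)) refl u v)

  ≤±-+ : ∀ {u v u′ v′} → u ≤± v → u′ ≤± v′ → u + u′ ≤± v + v′
  ≤±-+ {v = v} {v′ = v′} (-v≤u , u≤v) (-v′≤u′ , u′≤v′) =
    ≤-trans (≤-reflexive (sym (⁻¹-∙-comm v v′))) (+-mono-≤ -v≤u -v′≤u′) , +-mono-≤ u≤v u′≤v′

  -- Twice `v v′ + u u′` is `(v - u)(v′ - u′) + (v + u)(v′ + u′)`, and twice `v v′ - u u′` has a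
  -- similar form; all factors are non-negative.
  ≤±-* : ∀ {u v u′ v′} → u ≤± v → u′ ≤± v′ → u * u′ ≤± v * v′
  ≤±-* {u} {v} {u′} {v′} (-v≤u , u≤v) (-v′≤u′ , u′≤v′) =
    *-cancelˡ-≤ (0<fromNat 1) (0≤d⇒x≤y
      (0≤x+y (*-nonNegative 0≤v-u 0≤v′-u′) (*-nonNegative 0≤v+u 0≤v′+u′))
      (solve 4 (λ u v u′ v′ → ♯ 2 :* (u :* u′) := ♯ 2 :* :- (v :* v′)
         :+ ((v :- u) :* (v′ :- u′) :+ (u :- :- v) :* (u′ :- :- v′))) refl u v u′ v′)) ,
    *-cancelˡ-≤ (0<fromNat 1) (0≤d⇒x≤y
      (0≤x+y (*-nonNegative 0≤v-u 0≤v′+u′) (*-nonNegative 0≤v+u 0≤v′-u′))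
      (solve 4 (λ u v u′ v′ → ♯ 2 :* (v :* v′) := ♯ 2 :* (u :* u′)
         :+ ((v :- u) :* (u′ :- :- v′) :+ (u :- :- v) :* (v′ :- u′))) refl u v u′ v′))
    where
    0≤v-u = x≤y⇒0≤y-x u≤v
    0≤v+u = x≤y⇒0≤y-x -v≤u
    0≤v′-u′ = x≤y⇒0≤y-x u′≤v′
    0≤v′+u′ = x≤y⇒0≤y-x -v′≤u′

  abs : ∀ x → ∃[ y ] 0# ≤ y × x ≤± y × (y ≈ x ⊎ y ≈ - x)
  abs x with total 0# x
  ... | inj₁ 0≤x = x , 0≤x , (≤-trans -x≤0 0≤x , ≤-refl) , inj₁ refl
    where
    -x≤0 : - x ≤ 0#
    -x≤0 = 0≤d⇒x≤y 0≤x (solve 1 (λ x → ♯ 0 := :- x :+ x) refl x)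
  ... | inj₂ x≤0 = - x , -x≥0 x≤0 , (≤-reflexive (-‿involutive x) , ≤-trans x≤0 (-x≥0 x≤0)) , inj₂ refl

  -- A Lipschitz constant takes the place of continuity, because it yields an explicit step away
  -- from a supremum at which the value is not zero. The bound `K` is carried along for the product
  -- rule.
  record Lipschitz (B : Carrier) (f : Carrier → Carrier) : Set (c ⊔ ℓ₂) where
    field
      {L K}     : Carrier
      lipschitz : ∀ {x y} → 0# ≤ x → x ≤ y → y ≤ B → f y - f x ≤± L * (y - x)
      bounded   : ∀ {x} → 0# ≤ x → x ≤ B → f x ≤± K

  open Lipschitz

  Lipschitz-const : ∀ {B} a → Lipschitz B (λ _ → a)
  Lipschitz-const a with abs a
  ... | K , _ , a≤±K , _ = record
    { L = 0#
    ; K = K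
    ; lipschitz = λ {x} {y} _ _ _ → ≤±-resp-≈ (sym (-‿inverseʳ a)) (sym (zeroˡ (y - x)))
        (≤-reflexive -0≈0 , ≤-refl)
    ; bounded = λ _ _ → a≤±K }

  Lipschitz-id : ∀ {B} → Lipschitz B (λ x → x)
  Lipschitz-id {B} = record
    { L = 1#
    ; K = B
    ; lipschitz = λ {x} {y} _ x≤y _ → ≤±-resp-≈ refl (sym (*-identityˡ (y - x))) (0≤⇒≤± (x≤y⇒0≤y-x x≤y))
    ; bounded = λ 0≤x x≤B → ≤±-weaken (0≤⇒≤± 0≤x) x≤B }
    where
    0≤⇒≤± : ∀ {x} → 0# ≤ x → x ≤± x
    0≤⇒≤± {x} 0≤x =
      0≤d⇒x≤y (0≤x+y 0≤x 0≤x) (solve 1 (λ x → x := :- x :+ (x :+ x)) refl x) , ≤-refl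

  Lipschitz-+ : ∀ {B f g} → Lipschitz B f → Lipschitz B g → Lipschitz B (λ x → f x + g x)
  Lipschitz-+ {B} {f} {g} F G = record
    { L = L F + L G
    ; K = K F + K G
    ; lipschitz = λ {x} {y} 0≤x x≤y y≤B → ≤±-resp-≈
        (solve 4 (λ a b c d → (a :- b) :+ (c :- d) := (a :+ c) :- (b :+ d)) refl (f y) (f x) (g y) (g x))
        (sym (distribʳ (y - x) (L F) (L G)))
        (≤±-+ (lipschitz F 0≤x x≤y y≤B) (lipschitz G 0≤x x≤y y≤B))
    ; bounded = λ 0≤x x≤B → ≤±-+ (bounded F 0≤x x≤B) (bounded G 0≤x x≤B) }

  Lipschitz-* : ∀ {B f g} → Lipschitz B f → Lipschitz B g → Lipschitz B (λ x → f x * g x)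
  Lipschitz-* {B} {f} {g} F G = record
    { L = K F * L G + L F * K G
    ; K = K F * K G
    ; lipschitz = λ {x} {y} 0≤x x≤y y≤B → ≤±-resp-≈
        (solve 4 (λ a b c d → a :* (c :- d) :+ (a :- b) :* d := a :* c :- b :* d) refl (f y) (f x) (g y) (g x))
        (solve 5 (λ k l k′ l′ d → k :* (l′ :* d) :+ (l :* d) :* k′ := (k :* l′ :+ l :* k′) :* d)
          refl (K F) (L F) (K G) (L G) (y - x))
        (≤±-+ (≤±-* (bounded F (≤-trans 0≤x x≤y) y≤B) (lipschitz G 0≤x x≤y y≤B))
              (≤±-* (lipschitz F 0≤x x≤y y≤B) (bounded G 0≤x (≤-trans x≤y y≤B))))
    ; bounded = λ 0≤x x≤B → ≤±-* (bounded F 0≤x x≤B) (bounded G 0≤x x≤B) }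

  Lipschitz-neg : ∀ {B f} → Lipschitz B f → Lipschitz B (λ x → - f x)
  Lipschitz-neg {B} {f} F = record
    { L = L F
    ; K = K F
    ; lipschitz = λ {x} {y} 0≤x x≤y y≤B → ≤±-resp-≈
        (solve 2 (λ a b → :- (a :- b) := :- a :- :- b) refl (f y) (f x)) refl
        (≤±-neg (lipschitz F 0≤x x≤y y≤B))
    ; bounded = λ 0≤x x≤B → ≤±-neg (bounded F 0≤x x≤B) }

  Lipschitz-polynomial : ∀ {n B} (p : Polynomial (suc n)) (ρ : Vec Carrier n) →
                         Lipschitz B (λ x → ⟦ p ⟧ (x ∷ ρ))
  Lipschitz-polynomial (op Solver.[+] p q) ρ = Lipschitz-+ (Lipschitz-polynomial p ρ) (Lipschitz-polynomial q ρ)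
  Lipschitz-polynomial (op Solver.[*] p q) ρ = Lipschitz-* (Lipschitz-polynomial p ρ) (Lipschitz-polynomial q ρ)
  Lipschitz-polynomial (con a) ρ = Lipschitz-const ⟦ a ⟧ℤ
  Lipschitz-polynomial (var 0F) ρ = Lipschitz-id
  Lipschitz-polynomial (var (suc i)) ρ = Lipschitz-const (lookup ρ i)
  Lipschitz-polynomial (p :^ zero) ρ = Lipschitz-const 1#
  Lipschitz-polynomial (p :^ suc n) ρ = Lipschitz-* (Lipschitz-polynomial p ρ) (Lipschitz-polynomial (p :^ n) ρ)
  Lipschitz-polynomial (:- p) ρ = Lipschitz-neg (Lipschitz-polynomial p ρ)

  -- The root is the supremum `s` of the points where `f ≤ 0`. A positive `f s` makes `s - f s / M`
  -- a smaller upper bound. A negative `f s` keeps `f ≤ 0` up to `s - f s / M`, which exceeds `s`: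
  -- either this point belongs to the set, or it lies beyond `b` and then `f b` would be negative.
  intermediateValue : ∀ {f a b} → Lipschitz b f → 0# ≤ a → a ≤ b → f a ≤ 0# → 0# ≤ f b →
                      ∃[ x ] a ≤ x × x ≤ b × f x ≈ 0#
  intermediateValue {f} {a} {b} F 0≤a a≤b fa≤0 0≤fb = s , a≤s , s≤b , antisym fs≤0 0≤fs
    where
    Sublevel : Carrier → Set (c ⊔ ℓ₁ ⊔ ℓ₂)
    Sublevel x = Lift (c ⊔ ℓ₁ ⊔ ℓ₂) (a ≤ x × x ≤ b × f x ≤ 0#)

    sup = supremum Sublevel (a , lift (≤-refl , a≤b , fa≤0)) (b , λ { x (lift (_ , x≤b , _)) → x≤b })
    s = proj₁ sup

    a≤s : a ≤ s
    a≤s = proj₁ (proj₂ sup) a (lift (≤-refl , a≤b , fa≤0))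

    s≤b : s ≤ b
    s≤b = proj₂ (proj₂ sup) b λ { x (lift (_ , x≤b , _)) → x≤b }

    -- The constant `L F` may be zero or negative; `M` dominates it and is positive, hence
    -- invertible.
    M = proj₁ (abs (L F)) + 1#

    0<M : 0# < M
    0<M = 0≤x⇒0<y⇒0<x+y (proj₁ (proj₂ (abs (L F)))) 0<1

    L≤M : L F ≤ M
    L≤M = ≤-trans (proj₂ (proj₁ (proj₂ (proj₂ (abs (L F)))))) (0≤d⇒x≤y (proj₁ 0<1) refl)

    slope : ∀ {x y} → 0# ≤ x → x ≤ y → y ≤ b → f y - f x ≤± M * (y - x)
    slope {x} {y} 0≤x x≤y y≤b = ≤±-weaken (lipschitz F 0≤x x≤y y≤b)
      (≤-trans (≤-reflexive (*-comm (L F) _))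
        (≤-trans (*-monoˡ-≤ (x≤y⇒0≤y-x x≤y) L≤M) (≤-reflexive (*-comm _ M))))

    δ = f s * M ⁻¹

    Mδ : M * δ ≈ f s
    Mδ = begin-equality
      M * (f s * M ⁻¹)  ≈⟨ solve 3 (λ m x i → m :* (x :* i) := x :* (m :* i)) refl M (f s) (M ⁻¹) ⟩
      f s * (M * M ⁻¹)  ≈⟨ *-congˡ (⁻¹-inverse (>⇒≉0 0<M)) ⟩
      f s * 1#          ≈⟨ *-identityʳ _ ⟩
      f s               ∎
      where open ≤-Reasoning

    fs≤0 : f s ≤ 0#
    fs≤0 with ≤-or-> (f s) 0#
    ... | inj₁ fs≤0 = fs≤0
    ... | inj₂ 0<fs = contradiction (proj₂ (proj₂ sup) (s - δ) bound) (<⇒≱ (0<d⇒x<y 0<δ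
            (solve 2 (λ s δ → s := s :- δ :+ δ) refl s δ)))
      where
      0<δ : 0# < δ
      0<δ = 0<x*y 0<fs (0<x⁻¹ 0<M)

      bound : UpperBound Sublevel (s - δ)
      -- From `f s - f x ≤ M (s - x)` and `f x ≤ 0` it follows that `M δ = f s ≤ M (s - x)`.
      bound x (lift (a≤x , x≤b , fx≤0)) = *-cancelˡ-≤ 0<M (0≤d⇒x≤y
        (0≤x+y (-x≥0 fx≤0)
               (x≤y⇒0≤y-x (proj₂ (slope (≤-trans 0≤a a≤x) (proj₁ (proj₂ sup) x (lift (a≤x , x≤b , fx≤0))) s≤b))))
        (begin-equality
          M * (s - δ)
            ≈⟨ solve 3 (λ m s δ → m :* (s :- δ) := m :* s :- m :* δ) refl M s δ ⟩
          M * s - M * δ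
            ≈⟨ +-congˡ (-‿cong Mδ) ⟩
          M * s - f s
            ≈⟨ solve 5 (λ m s x fs fx → m :* s :- fs := m :* x :+ (:- fx :+ (m :* (s :- x) :- (fs :- fx))))
                 refl M s x (f s) (f x) ⟩
          M * x + (- f x + (M * (s - x) - (f s - f x))) ∎))
        where open ≤-Reasoning

    0≤fs : 0# ≤ f s
    0≤fs with ≤-or-> 0# (f s)
    ... | inj₁ 0≤fs = 0≤fs
    ... | inj₂ fs<0 with ≤-or-> (s - δ) b
    -- Here `δ` is negative, so `s - δ` lies to the right of `s`.
    ...   | inj₁ s-δ≤b = contradiction
            (proj₁ (proj₂ sup) (s - δ) (lift (≤-trans a≤s s≤s-δ , s-δ≤b , f[s-δ]≤0)))
            (<⇒≱ s<s-δ)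
      where
      s<s-δ : s < s - δ
      s<s-δ = 0<d⇒x<y (0<x*y (x<y⇒0<y-x fs<0) (0<x⁻¹ 0<M))
        (solve 3 (λ s x i → s :- x :* i := s :+ (♯ 0 :- x) :* i) refl s (f s) (M ⁻¹))

      s≤s-δ : s ≤ s - δ
      s≤s-δ = proj₁ s<s-δ

      f[s-δ]≤0 : f (s - δ) ≤ 0#
      f[s-δ]≤0 = 0≤d⇒x≤y (x≤y⇒0≤y-x (proj₂ (slope (≤-trans 0≤a a≤s) s≤s-δ s-δ≤b))) (begin-equality
        0#
          ≈⟨ solve 2 (λ fs x → ♯ 0 := x :+ (:- fs :- (x :- fs))) refl (f s) (f (s - δ)) ⟩
        f (s - δ) + (- f s - (f (s - δ) - f s))
          ≈⟨ +-congˡ (+-congʳ (-‿cong Mδ)) ⟨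
        f (s - δ) + (- (M * δ) - (f (s - δ) - f s))
          ≈⟨ solve 5 (λ m s δ x fs → x :+ (:- (m :* δ) :- (x :- fs))
                        := x :+ (m :* (s :- δ :- s) :- (x :- fs))) refl M s δ (f (s - δ)) (f s) ⟩
        f (s - δ) + (M * (s - δ - s) - (f (s - δ) - f s)) ∎)
        where open ≤-Reasoning
    ...   | inj₂ b<s-δ = contradiction 0≤fb (<⇒≱ fb<0)
      where
      fb<0 : f b < 0#
      fb<0 = 0<d⇒x<y
        (0≤x⇒0<y⇒0<x+y (x≤y⇒0≤y-x (proj₂ (slope (≤-trans 0≤a a≤s) s≤b ≤-refl)))
                       (0<x*y 0<M (x<y⇒0<y-x b<s-δ)))
        (begin-equality
          0#
            ≈⟨ solve 1 (λ fs → ♯ 0 := fs :- fs) refl (f s) ⟩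
          f s - f s
            ≈⟨ +-congˡ (-‿cong Mδ) ⟨
          f s - M * δ
            ≈⟨ solve 6 (λ m s δ b fs fb → fs :- m :* δ
                 := fb :+ ((m :* (b :- s) :- (fb :- fs)) :+ m :* (s :- δ :- b))) refl M s δ b (f s) (f b) ⟩
          f b + ((M * (b - s) - (f b - f s)) + M * (s - δ - b)) ∎)
        where open ≤-Reasoning

-- The positive eigenvector of the extremal graph as a polynomial in `ν`.

module PerronRoot {c ℓ₁ ℓ₂} (ℝ : CompleteOrderedField c ℓ₁ ℓ₂) where
  open OrderedField ℝ
  open IntermediateValue ℝ

  private
    variable
      n : ℕ

    at₂ : Polynomial 2 → Carrier → Carrier → Carrier
    at₂ p x y = ⟦ p ⟧ (x ∷ y ∷ [])

    at₃ : Polynomial 3 → Carrier → Carrier → Carrier → Carrier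
    at₃ p x y z = ⟦ p ⟧ (x ∷ y ∷ z ∷ [])

  -- With c = ν Δ at the centre, the eigenvalue equations of the diamond with k pendant edges at its
  -- vertex 0 give α x₂ = s (c + 2 x₁) and β x₁ = s (c + x₂), a linear system of determinant Δ = α β - 2 s².
  -- Substituting its solution in the equation at the centre gives F = 0.
  -- In terms of μ = ν + r, N = μ² - (m + 1) μ - (k + 2) (m - 1).
  sᴾ : (ν r : Polynomial n) → Polynomial n
  sᴾ ν r = ν :+ r :+ ♯ 1

  αᴾ βᴾ Δᴾ excessᴾ : (ν r : Polynomial n) → Polynomial n
  αᴾ ν r = sᴾ ν r :* ν :- ♯ 2 :* r
  βᴾ ν r = sᴾ ν r :* ν :- r
  Δᴾ ν r = αᴾ ν r :* βᴾ ν r :- ♯ 2 :* (sᴾ ν r :* sᴾ ν r)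
  excessᴾ ν r = Δᴾ ν r :* (♯ 3 :* (ν :* ν) :+ (♯ 2 :* r :+ ♯ 5) :* ν :+ ♯ 5 :* r :+ ♯ 2)
    :- sᴾ ν r :* sᴾ ν r :* ν :* (βᴾ ν r :+ ♯ 2 :* αᴾ ν r :+ ♯ 4 :* sᴾ ν r)

  Fᴾ Nᴾ : (ν r k : Polynomial n) → Polynomial n
  Fᴾ ν r k = ν :* Δᴾ ν r :* (sᴾ ν r :* ν :- (k :+ ♯ 2) :* r) :- sᴾ ν r :* k :* Δᴾ ν r
    :- sᴾ ν r :* sᴾ ν r :* ν :* (βᴾ ν r :+ ♯ 2 :* αᴾ ν r :+ ♯ 4 :* sᴾ ν r)
  Nᴾ ν r k = ν :* ν :+ (r :- ♯ 3) :* ν :- ♯ 3 :* r :- (k :+ ♯ 2) :* (r :+ ♯ 1)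

  s α β Δ excess : (ν r : Carrier) → Carrier
  s = at₂ (sᴾ (var 0F) (var 1F))
  α = at₂ (αᴾ (var 0F) (var 1F))
  β = at₂ (βᴾ (var 0F) (var 1F))
  Δ = at₂ (Δᴾ (var 0F) (var 1F))
  excess = at₂ (excessᴾ (var 0F) (var 1F))

  F N : (ν r k : Carrier) → Carrier
  F = at₃ (Fᴾ (var 0F) (var 1F) (var 2F))
  N = at₃ (Nᴾ (var 0F) (var 1F) (var 2F))

  private
    positive : ∀ n {x y} → 0# ≤ x → y ≈ fromNat (suc n) + x → 0# < y
    positive n 0≤x y≈ = <-respʳ-≈ (sym y≈) (0<x+y (0<fromNat n) 0≤x)

    nonPositive : ∀ {x y} → 0# ≤ y → - x ≈ y → x ≤ 0#
    nonPositive {x} {y} 0≤y -x≈y = 0≤d⇒x≤y 0≤y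
      (trans (sym (-‿inverseʳ x)) (+-congˡ -x≈y))

  private
    -- Cramer's rule for the system above; the factor `Δ` in `w₀ᴾ` clears the denominators. Since
    -- `θ - r = s ν`, the equation at a leaf says that `ν` times its value is the value at the
    -- centre, so the leaf value is `Δ`.
    θᴾ w₀ᴾ w₁ᴾ w₂ᴾ : (ν r : Polynomial n) → Polynomial n
    θᴾ ν r = (ν :+ ♯ 1) :* (ν :+ r)
    w₀ᴾ ν r = ν :* Δᴾ ν r
    w₁ᴾ ν r = ν :* sᴾ ν r :* (αᴾ ν r :+ sᴾ ν r)
    w₂ᴾ ν r = ν :* sᴾ ν r :* (βᴾ ν r :+ ♯ 2 :* sᴾ ν r)

    edge₀ᴾ : (ν r k : Polynomial n) → Polynomial n
    edge₀ᴾ ν r k = (r :* w₀ᴾ ν r :+ sᴾ ν r :* w₁ᴾ ν r) :+ (r :* w₀ᴾ ν r :+ sᴾ ν r :* w₂ᴾ ν r)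
      :+ (r :* w₀ᴾ ν r :+ sᴾ ν r :* w₁ᴾ ν r) :+ k :* (r :* w₀ᴾ ν r :+ sᴾ ν r :* Δᴾ ν r)

  θ : (ν r : Carrier) → Carrier
  θ = at₂ (θᴾ (var 0F) (var 1F))

  private
    w₀ w₁ w₂ : (ν r : Carrier) → Carrier
    w₀ = at₂ (w₀ᴾ (var 0F) (var 1F))
    w₁ = at₂ (w₁ᴾ (var 0F) (var 1F))
    w₂ = at₂ (w₂ᴾ (var 0F) (var 1F))

    -- The defect of the equation at the centre is exactly `F`; the three equations that follow are
    -- identities in `ν` and `r`.
    equation₀ : ∀ ν r k → θ ν r * w₀ ν r ≈ at₃ (edge₀ᴾ (var 0F) (var 1F) (var 2F)) ν r k + F ν r k
    equation₀ = solve 3 (λ ν r k → θᴾ ν r :* w₀ᴾ ν r := edge₀ᴾ ν r k :+ Fᴾ ν r k) refl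

    equation₁ : ∀ ν r → θ ν r * w₁ ν r ≈ (r * w₁ ν r + s ν r * w₀ ν r) + (r * w₁ ν r + s ν r * w₂ ν r)
    equation₁ = solve 2 (λ ν r → θᴾ ν r :* w₁ᴾ ν r
      := (r :* w₁ᴾ ν r :+ sᴾ ν r :* w₀ᴾ ν r) :+ (r :* w₁ᴾ ν r :+ sᴾ ν r :* w₂ᴾ ν r)) refl

    equation₂ : ∀ ν r → θ ν r * w₂ ν r
                ≈ (r * w₂ ν r + s ν r * w₁ ν r) + (r * w₂ ν r + s ν r * w₁ ν r) + (r * w₂ ν r + s ν r * w₀ ν r)
    equation₂ = solve 2 (λ ν r → θᴾ ν r :* w₂ᴾ ν r
      := (r :* w₂ᴾ ν r :+ sᴾ ν r :* w₁ᴾ ν r) :+ (r :* w₂ᴾ ν r :+ sᴾ ν r :* w₁ᴾ ν r)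
         :+ (r :* w₂ᴾ ν r :+ sᴾ ν r :* w₀ᴾ ν r)) refl

    equation₄ : ∀ ν r → θ ν r * Δ ν r ≈ r * Δ ν r + s ν r * w₀ ν r
    equation₄ = solve 2 (λ ν r → θᴾ ν r :* Δᴾ ν r := r :* Δᴾ ν r :+ sᴾ ν r :* w₀ᴾ ν r) refl

  -- No single left end brackets the root of `F` for all `r`. At `ν = 2` the determinant `Δ` is
  -- `18 - 6 r - 2 r²`, which is positive only for `r ≤ 1`; at `ν = 3` the value of `F` is positive
  -- for `r ≤ 1` and `k = 0`. Hence the bracket starts at 2 for `r ≤ 1` and at 3 for larger `r`.
  data Small : ℕ → Set where
    zero : Small 0
    one  : Small 1

  small? : ∀ r → Small r ⊎ fromNat 2 ≤ fromNat r
  small? 0 = inj₁ zero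
  small? 1 = inj₁ one
  small? (suc (suc r)) = inj₂ (0≤d⇒x≤y (0≤fromNat r) (fromNat-+ 2 r))

  module _ (r k : ℕ) where
    private
      R = fromNat r
      K = fromNat k
      0≤R = 0≤fromNat r
      0≤K = 0≤fromNat k

    private
      2≤3 : fromNat 2 ≤ fromNat 3
      2≤3 = 0≤d⇒x≤y (0≤fromNat 1) (fromNat-+ 2 1)

    -- Each cert below is an expansion in powers of ν - ν₀ whose coefficients happen to be natural numbers.
    lowerBracket : ∃[ ν₀ ] fromNat 2 ≤ ν₀ × ν₀ ≤ fromNat 3 × (∀ ν → ν₀ ≤ ν → 0# < Δ ν R) × F ν₀ R K ≤ 0#
    lowerBracket with small? r
    ... | inj₁ zero = fromNat 2 , ≤-refl , 2≤3
      , (λ ν 2≤ν → positive 17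
          (from-just (nonNegative? (cert (var 0F))) _ ((x≤y⇒0≤y-x 2≤ν) ∷ []))
          (solve 1 (λ ν → Δᴾ ν (♯ 0) := ♯ 18 :+ cert (ν :- ♯ 2)) refl ν))
      , nonPositive (from-just (nonNegative? (cert′ (var 0F))) _ (0≤K ∷ []))
          (solve 1 (λ k → :- Fᴾ (♯ 2) (♯ 0) k := cert′ k) refl K)
      where
      cert cert′ : Polynomial n → Polynomial n
      cert h = h :* (♯ 48 :+ h :* (♯ 35 :+ h :* (♯ 10 :+ h)))
      cert′ k = ♯ 324 :+ ♯ 54 :* k
    ... | inj₁ one = fromNat 2 , ≤-refl , 2≤3
      , (λ ν 2≤ν → positive 9
          (from-just (nonNegative? (cert (var 0F))) _ ((x≤y⇒0≤y-x 2≤ν) ∷ []))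
          (solve 1 (λ ν → Δᴾ ν (♯ 1) := ♯ 10 :+ cert (ν :- ♯ 2)) refl ν))
      , nonPositive (from-just (nonNegative? (cert′ (var 0F))) _ (0≤K ∷ []))
          (solve 1 (λ k → :- Fᴾ (♯ 2) (♯ 1) k := cert′ k) refl K)
      where
      cert cert′ : Polynomial n → Polynomial n
      cert h = h :* (♯ 62 :+ h :* (♯ 47 :+ h :* (♯ 12 :+ h)))
      cert′ k = ♯ 1000 :+ ♯ 60 :* k
    ... | inj₂ 2≤R = fromNat 3 , 2≤3 , ≤-refl
      , (λ ν 3≤ν → positive 111
          (from-just (nonNegative? (cert (var 0F) (var 1F))) _ (x≤y⇒0≤y-x 3≤ν ∷ 0≤R ∷ []))
          (solve 2 (λ ν r → Δᴾ ν r := ♯ 112 :+ cert (ν :- ♯ 3) r) refl ν R))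
      , nonPositive (from-just (nonNegative? (cert′ (var 0F) (var 1F))) _ (x≤y⇒0≤y-x 2≤R ∷ 0≤K ∷ []))
          (solve 2 (λ r k → :- Fᴾ (♯ 3) r k := cert′ (r :- ♯ 2) k) refl R K)
      where
      cert cert′ : (h r : Polynomial n) → Polynomial n
      cert h r = ♯ 20 :* r :+ h :* (♯ 152 :+ r :* (♯ 41 :+ ♯ 3 :* r)
        :+ h :* (♯ 71 :+ r :* (♯ 17 :+ r) :+ h :* (♯ 14 :+ ♯ 2 :* r :+ h)))
      cert′ d k = ♯ 960 :+ ♯ 1824 :* k
        :+ d :* (♯ 2016 :+ ♯ 848 :* k :+ d :* (♯ 432 :+ ♯ 80 :* k :+ ♯ 24 :* d))

    N<0⁻ : ∀ {ν d} → 0# < d → - N ν R K ≈ d → N ν R K < 0#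
    N<0⁻ 0<d -N≈d = 0<d⇒x<y 0<d (trans (sym (-‿inverseʳ _)) (+-congˡ -N≈d))

    -- At `ν = 3` the value of `N` is `-(k + 2)(r + 1)`, and the certificate keeps `N ≤ -2` on the
    -- whole of `0 ≤ ν ≤ 3`.
    0≤N⇒3≤ν : ∀ {ν} → 0# ≤ ν → 0# ≤ N ν R K → fromNat 3 ≤ ν
    0≤N⇒3≤ν {ν} 0≤ν 0≤N with ≤-or-> (fromNat 3) ν
    ... | inj₁ 3≤ν = 3≤ν
    ... | inj₂ ν<3 = contradiction 0≤N (<⇒≱ (N<0⁻
          (positive 1 (from-just (nonNegative? (cert (var 0F) (var 1F) (var 2F) (var 3F))) _
            (x≤y⇒0≤y-x (proj₁ ν<3) ∷ 0≤ν ∷ 0≤R ∷ 0≤K ∷ [])) refl)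
          (solve 3 (λ ν r k → :- Nᴾ ν r k := ♯ 2 :+ cert (♯ 3 :- ν) ν r k) refl ν R K)))
      where
      cert : (h ν r k : Polynomial n) → Polynomial n
      cert h ν r k = h :* ν :+ h :* r :+ ♯ 2 :* r :+ k :+ k :* r

    -- The bound 3 would be too weak here: at `ν = 3` the coefficient of `r³` in `excess` is `-24`,
    -- while at `ν = 4` it is `8`. The value of `N` at 4 is `2 - r - k (r + 1)`, which is why
    -- `2 ≤ r` is assumed.
    0≤N⇒4≤ν : ∀ {ν} → fromNat 2 ≤ R → 0# ≤ ν → 0# ≤ N ν R K → fromNat 4 ≤ ν
    0≤N⇒4≤ν {ν} 2≤R 0≤ν 0≤N with ≤-or-> (fromNat 4) ν
    ... | inj₁ 4≤ν = 4≤ν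
    ... | inj₂ ν<4 = contradiction 0≤N (<⇒≱ (N<0⁻
          (0<x+y (0<x*y (x<y⇒0<y-x ν<4) (0<fromNat 2))
            (from-just (nonNegative? (cert (var 0F) (var 1F) (var 2F) (var 3F))) _
              (x≤y⇒0≤y-x (proj₁ ν<4) ∷ 0≤ν ∷ x≤y⇒0≤y-x 2≤R ∷ 0≤K ∷ [])))
          (solve 3 (λ ν r k → :- Nᴾ ν r k := (♯ 4 :- ν) :* ♯ 3 :+ cert (♯ 4 :- ν) ν (r :- ♯ 2) k) refl ν R K)))
      where
      cert : (h ν d k : Polynomial n) → Polynomial n
      cert h ν d k = h :* ν :+ d :* h :+ d :+ k :* (♯ 3 :+ d)

    0≤N⇒0<excess : ∀ {ν} → 0# ≤ ν → 0# ≤ N ν R K → 0# < excess ν R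
    0≤N⇒0<excess {ν} 0≤ν 0≤N with small? r
    ... | inj₁ zero = positive 2431
          (from-just (nonNegative? (cert (var 0F))) _ ((x≤y⇒0≤y-x (0≤N⇒3≤ν 0≤ν 0≤N)) ∷ []))
          (solve 1 (λ ν → excessᴾ ν (♯ 0) := ♯ 2432 :+ cert (ν :- ♯ 3)) refl ν)
      where
      cert : Polynomial n → Polynomial n
      cert h = h :* (♯ 5984 :+ h :* (♯ 5240 :+ h :* (♯ 2258 :+ h :* (♯ 521 :+ h :* (♯ 62 :+ ♯ 3 :* h)))))
    ... | inj₁ one = positive 2759
          (from-just (nonNegative? (cert (var 0F))) _ ((x≤y⇒0≤y-x (0≤N⇒3≤ν 0≤ν 0≤N)) ∷ []))
          (solve 1 (λ ν → excessᴾ ν (♯ 1) := ♯ 2760 :+ cert (ν :- ♯ 3)) refl ν)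
      where
      cert : Polynomial n → Polynomial n
      cert h = h :* (♯ 8680 :+ h :* (♯ 7646 :+ h :* (♯ 3104 :+ h :* (♯ 655 :+ h :* (♯ 70 :+ ♯ 3 :* h)))))
    ... | inj₂ 2≤R = positive 16499
          (from-just (nonNegative? (cert (var 0F) (var 1F))) _ (x≤y⇒0≤y-x (0≤N⇒4≤ν 2≤R 0≤ν 0≤N) ∷ 0≤R ∷ []))
          (solve 2 (λ ν r → excessᴾ ν r := ♯ 16500 :+ cert (ν :- ♯ 4) r) refl ν R)
      where
      cert : (h r : Polynomial n) → Polynomial n
      cert h r = r :* (♯ 5850 :+ r :* (♯ 560 :+ ♯ 8 :* r))
        :+ h :* (♯ 25650 :+ r :* (♯ 9415 :+ r :* (♯ 1157 :+ ♯ 50 :* r))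
        :+ h :* (♯ 15805 :+ r :* (♯ 5239 :+ r :* (♯ 569 :+ ♯ 20 :* r))
        :+ h :* (♯ 5022 :+ r :* (♯ 1353 :+ r :* (♯ 107 :+ ♯ 2 :* r))
        :+ h :* (♯ 876 :+ r :* (♯ 167 :+ ♯ 7 :* r)
        :+ h :* (♯ 80 :+ ♯ 8 :* r
        :+ ♯ 3 :* h)))))

    -- F = Δ (ν + 1) N + excess eliminates k.
    0≤N⇒0<F : ∀ {ν} → 0# ≤ ν → 0# < Δ ν R → 0# ≤ N ν R K → 0# < F ν R K
    0≤N⇒0<F {ν} 0≤ν 0<Δ 0≤N = <-respʳ-≈
      (solve 3 (λ ν r k → Δᴾ ν r :* (ν :+ ♯ 1) :* Nᴾ ν r k :+ excessᴾ ν r := Fᴾ ν r k) refl ν R K)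
      (0≤x⇒0<y⇒0<x+y (*-nonNegative (*-nonNegative (proj₁ 0<Δ) (0≤x+y 0≤ν (0≤fromNat 1))) 0≤N)
                     (0≤N⇒0<excess 0≤ν 0≤N))

    record Perron : Set (c ⊔ ℓ₁ ⊔ ℓ₂) where
      field
        ν x₀ x₁ x₂ x₄ : Carrier
        0<ν  : 0# < ν
        N<0  : N ν R K < 0#
        0<x₀ : 0# < x₀
        0<x₁ : 0# < x₁
        0<x₂ : 0# < x₂
        0<x₄ : 0# < x₄
        eigen₀ : θ ν R * x₀ ≈ (R * x₀ + s ν R * x₁) + (R * x₀ + s ν R * x₂) + (R * x₀ + s ν R * x₁)
                               + K * (R * x₀ + s ν R * x₄)
        eigen₁ : θ ν R * x₁ ≈ (R * x₁ + s ν R * x₀) + (R * x₁ + s ν R * x₂)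
        eigen₂ : θ ν R * x₂ ≈ (R * x₂ + s ν R * x₁) + (R * x₂ + s ν R * x₁) + (R * x₂ + s ν R * x₀)
        eigen₄ : θ ν R * x₄ ≈ R * x₄ + s ν R * x₀

    private
      -- A point chosen so that `N` is visibly non-negative there; then `0≤N⇒0<F` gives the sign of
      -- `F` at the right end.
      upperBracket : Carrier
      upperBracket = K + R + fromNat 6

      0≤upperBracket : 0# ≤ upperBracket
      0≤upperBracket = 0≤x+y (0≤x+y 0≤K 0≤R) (0≤fromNat 6)

      0≤N[upperBracket] : 0# ≤ N upperBracket R K
      0≤N[upperBracket] = ≤-respʳ-≈
        (solve 2 (λ r k → cert r k := Nᴾ (k :+ r :+ ♯ 6) r k) refl R K)
        (from-just (nonNegative? (cert (var 0F) (var 1F))) _ (0≤R ∷ 0≤K ∷ []))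
        where
        cert : (r k : Polynomial n) → Polynomial n
        cert r k = ♯ 16 :+ r :* (♯ 10 :+ ♯ 2 :* r) :+ k :* (♯ 8 :+ ♯ 2 :* r :+ k)

    perronRoot : ∃[ ν ] fromNat 2 ≤ ν × 0# < Δ ν R × F ν R K ≈ 0#
    perronRoot with lowerBracket
    ... | ν₀ , 2≤ν₀ , ν₀≤3 , 0<Δ , Fν₀≤0 = ν , ≤-trans 2≤ν₀ ν₀≤ν , 0<Δ ν ν₀≤ν , Fν≈0
      where
      ν₀≤b : ν₀ ≤ upperBracket
      ν₀≤b = ≤-trans ν₀≤3 (0≤d⇒x≤y (0≤x+y (0≤x+y 0≤K 0≤R) (0≤fromNat 3))
        (solve 2 (λ k r → k :+ r :+ ♯ 6 := ♯ 3 :+ (k :+ r :+ ♯ 3)) refl K R))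

      root = intermediateValue (Lipschitz-polynomial (Fᴾ (var 0F) (var 1F) (var 2F)) (R ∷ K ∷ []))
               (≤-trans (0≤fromNat 2) 2≤ν₀) ν₀≤b Fν₀≤0
               (proj₁ (0≤N⇒0<F 0≤upperBracket (0<Δ _ ν₀≤b) 0≤N[upperBracket]))
      ν = proj₁ root
      ν₀≤ν = proj₁ (proj₂ root)
      Fν≈0 = proj₂ (proj₂ (proj₂ root))

    perronVector : ∀ {ν} → fromNat 2 ≤ ν → 0# < Δ ν R → F ν R K ≈ 0# → Perron
    perronVector {ν} 2≤ν 0<Δ Fν≈0 = record
      { ν = ν
      ; x₀ = w₀ ν R
      ; x₁ = w₁ ν R
      ; x₂ = w₂ ν R
      ; x₄ = Δ ν R
      ; 0<ν = 0<ν
      -- A non-negative `N` would make `F` positive, but `F` vanishes at `ν`.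
      ; N<0 = ≰⇒> λ 0≤N → <⇒≉ (0≤N⇒0<F (proj₁ 0<ν) 0<Δ 0≤N) (sym Fν≈0)
      ; 0<x₀ = 0<x*y 0<ν 0<Δ
      ; 0<x₁ = 0<x*y (0<x*y 0<ν 0<s) (0<x+y 0<α (proj₁ 0<s))
      ; 0<x₂ = 0<x*y (0<x*y 0<ν 0<s) (0<x+y 0<β (*-nonNegative (0≤fromNat 2) (proj₁ 0<s)))
      ; 0<x₄ = 0<Δ
      ; eigen₀ = trans (equation₀ ν R K) (trans (+-congˡ Fν≈0) (+-identityʳ _))
      ; eigen₁ = equation₁ ν R
      ; eigen₂ = equation₂ ν R
      ; eigen₄ = equation₄ ν R
      }
      where
      0<ν : 0# < ν
      0<ν = <-≤-trans (0<fromNat 1) 2≤ν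

      0<s : 0# < s ν R
      0<s = 0<x+y (0<x+y 0<ν 0≤R) (0≤fromNat 1)

      0<β : 0# < β ν R
      0<β = positive 5
        (from-just (nonNegative? (cert (var 0F) (var 1F))) _ (x≤y⇒0≤y-x 2≤ν ∷ 0≤R ∷ []))
        (solve 2 (λ ν r → βᴾ ν r := ♯ 6 :+ cert (ν :- ♯ 2) r) refl ν R)
        where
        cert : (h r : Polynomial n) → Polynomial n
        cert h r = r :+ h :* (♯ 5 :+ r :+ h)

      0<α : 0# < α ν R
      0<α = positive 5
        (from-just (nonNegative? (cert (var 0F) (var 1F))) _ (x≤y⇒0≤y-x 2≤ν ∷ 0≤R ∷ []))
        (solve 2 (λ ν r → αᴾ ν r := ♯ 6 :+ cert (ν :- ♯ 2) r) refl ν R)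
        where
        cert : (h r : Polynomial n) → Polynomial n
        cert h r = h :* (♯ 5 :+ r :+ h)

    -- Unfolding the supremum behind the root would make conversion checking infeasible.
    abstract
      perron : Perron
      perron = let ν , 2≤ν , 0<Δ , Fν≈0 = perronRoot in perronVector 2≤ν 0<Δ Fν≈0

-- Finite sums and Kronecker deltas.

module FiniteSums {c ℓ₁ ℓ₂} (ℝ : CompleteOrderedField c ℓ₁ ℓ₂) where
  open OrderedField ℝ
  open SemiringSum semiring public
    using (*-distribˡ-sum; *-distribʳ-sum; ∑-distrib-+; ∑-comm; sum-permute)

  sum-cong : ∀ {n} {f g : Fin n → Carrier} → (∀ i → f i ≈ g i) → sum f ≈ sum g
  sum-cong = MonoidSum.sum-cong-≋ +-monoid

  sum-mono-≤ : ∀ {n} {f g : Fin n → Carrier} → (∀ i → f i ≤ g i) → sum f ≤ sum g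
  sum-mono-≤ {zero} f≤g = ≤-refl
  sum-mono-≤ {suc n} f≤g = +-mono-≤ (f≤g zero) (sum-mono-≤ (f≤g ∘ suc))

  sum-zero : ∀ {n} {f : Fin n → Carrier} → (∀ i → f i ≈ 0#) → sum f ≈ 0#
  sum-zero {n} f≈0 = trans (sum-cong f≈0) (MonoidSum.sum-replicate-zero +-monoid n)

  0≤sum : ∀ {n} {f : Fin n → Carrier} → (∀ i → 0# ≤ f i) → 0# ≤ sum f
  0≤sum {n} 0≤f = ≤-trans (≤-reflexive (sym (sum-zero {n} λ _ → refl))) (sum-mono-≤ 0≤f)

  term≤sum : ∀ {n} {f : Fin n → Carrier} → (∀ i → 0# ≤ f i) → ∀ i → f i ≤ sum f
  term≤sum {suc n} {f} 0≤f zero = 0≤d⇒x≤y (0≤sum (0≤f ∘ suc)) refl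
  term≤sum {suc n} {f} 0≤f (suc i) =
    ≤-trans (term≤sum (0≤f ∘ suc) i) (0≤d⇒x≤y (0≤f zero) (+-comm _ _))

  sum-const : ∀ n x → sum {n} (λ _ → x) ≈ fromNat n * x
  sum-const zero x = sym (zeroˡ x)
  sum-const (suc n) x = begin-equality
    x + sum {n} (λ _ → x)  ≈⟨ +-cong (sym (*-identityˡ x)) (sum-const n x) ⟩
    1# * x + fromNat n * x ≈⟨ distribʳ x 1# (fromNat n) ⟨
    fromNat (suc n) * x    ∎
    where open ≤-Reasoning

  sum-distrib-sub : ∀ {n} (f g : Fin n → Carrier) → sum (λ i → f i - g i) ≈ sum f - sum g
  sum-distrib-sub {zero} f g = sym (-‿inverseʳ 0#)
  sum-distrib-sub {suc n} f g = trans (+-congˡ (sum-distrib-sub (f ∘ suc) (g ∘ suc)))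
    (solve 4 (λ a b x y → a :- b :+ (x :- y) := (a :+ x) :- (b :+ y)) refl (f zero) (g zero) _ _)

  sum-split : ∀ m {n} (f : Fin (m ℕ.+ n) → Carrier) →
              sum f ≈ sum (λ i → f (i ↑ˡ n)) + sum (λ j → f (m ↑ʳ j))
  sum-split zero f = sym (+-identityˡ _)
  sum-split (suc m) f = trans (+-congˡ (sum-split m (f ∘ suc))) (sym (+-assoc _ _ _))

  sum-combine : ∀ m {n} (f : Fin (m ℕ.* n) → Carrier) →
                sum f ≈ sum (λ (i : Fin m) → sum (λ (j : Fin n) → f (combine i j)))
  sum-combine zero f = refl
  sum-combine (suc m) {n} f = trans (sum-split n f) (+-congˡ (sum-combine m (λ i → f (n ↑ʳ i))))

  sum-reindex : ∀ {N n k r} (σ : (Fin n ⊎ (Fin k × Fin r)) ↔ Fin N) (f : Fin N → Carrier) →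
    sum f ≈ sum (λ u → f (Inverse.to σ (inj₁ u))) + sum (λ e → sum (λ i → f (Inverse.to σ (inj₂ (e , i)))))
  sum-reindex {N} {n} {k} {r} σ f = begin-equality
    sum f
      ≈⟨ sum-permute f π ⟩
    sum (f ∘ Inverse.to π)
      ≈⟨ sum-split n _ ⟩
    sum {n} (λ u → f (Inverse.to π (u ↑ˡ _))) + sum (λ p → f (Inverse.to π (n ↑ʳ p)))
      ≈⟨ +-cong (sum-cong λ u → reflexive (≡.cong (f ∘ Inverse.to σ) (to-↑ˡ u)))
                (trans (sum-combine k _) (sum-cong λ e → sum-cong λ i →
                  reflexive (≡.cong (f ∘ Inverse.to σ) (to-↑ʳ e i)))) ⟩
    sum (λ u → f (Inverse.to σ (inj₁ u))) + sum (λ e → sum (λ i → f (Inverse.to σ (inj₂ (e , i))))) ∎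
    where
    open ≤-Reasoning
    ι : Fin (n ℕ.+ k ℕ.* r) ↔ (Fin n ⊎ (Fin k × Fin r))
    ι = ↔.↔-trans Fin.+↔⊎ (↔.↔-refl ⊎-↔ Fin.*↔×)
    π = ↔.↔-trans ι σ

    to-↑ˡ : ∀ u → Inverse.to ι (u ↑ˡ k ℕ.* r) ≡ inj₁ u
    to-↑ˡ u rewrite Fin.splitAt-↑ˡ n u (k ℕ.* r) = ≡.refl

    to-↑ʳ : ∀ e i → Inverse.to ι (n ↑ʳ combine e i) ≡ inj₂ (e , i)
    to-↑ʳ e i rewrite Fin.splitAt-↑ʳ n (k ℕ.* r) (combine e i) | Fin.remQuot-combine e i = ≡.refl

  -- Defined through `fromNat` so that a decided indicator is literally the solver constant `♯ 0` or
  -- `♯ 1`.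
  𝟙 : Bool → Carrier
  𝟙 b = fromNat (if b then 1 else 0)

  0≤𝟙 : ∀ b → 0# ≤ 𝟙 b
  0≤𝟙 b = 0≤fromNat (if b then 1 else 0)

  δ : ∀ {n} → Fin n → Fin n → Carrier
  δ i j = 𝟙 (does (i Fin.≟ j))

  0≤δ : ∀ {n} (i j : Fin n) → 0# ≤ δ i j
  0≤δ i j = 0≤𝟙 (does (i Fin.≟ j))

  δ-refl : ∀ {n} (i : Fin n) → δ i i ≈ 1#
  δ-refl i = trans (reflexive (≡.cong 𝟙 (dec-true (i Fin.≟ i) ≡.refl))) (+-identityʳ 1#)

  δ-≢ : ∀ {n} {i j : Fin n} → i ≢ j → δ i j ≈ 0#
  δ-≢ {i = i} {j} i≢j = reflexive (≡.cong 𝟙 (dec-false (i Fin.≟ j) i≢j))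

  δ-sym : ∀ {n} (i j : Fin n) → δ i j ≈ δ j i
  δ-sym i j with i Fin.≟ j
  ... | yes ≡.refl = reflexive (≡.cong 𝟙 (≡.sym (dec-true (i Fin.≟ i) ≡.refl)))
  ... | no i≢j = sym (δ-≢ (i≢j ∘ ≡.sym))

  sum-δ : ∀ {n} (j : Fin n) (f : Fin n → Carrier) → sum (λ i → δ i j * f i) ≈ f j
  sum-δ {suc n} zero f = begin-equality
    fromNat 1 * f zero + sum (λ i → 0# * f (suc i))  ≈⟨ +-congˡ (sum-zero {n} λ i → zeroˡ _) ⟩
    fromNat 1 * f zero + 0#                          ≈⟨ solve 1 (λ x → ♯ 1 :* x :+ ♯ 0 := x) refl (f zero) ⟩
    f zero                                           ∎
    where open ≤-Reasoning
  sum-δ {suc n} (suc j) f = begin-equality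
    0# * f zero + sum (λ i → δ i j * f (suc i))  ≈⟨ +-cong (zeroˡ _) (sum-δ j (f ∘ suc)) ⟩
    0# + f (suc j)                               ≈⟨ +-identityˡ _ ⟩
    f (suc j)                                    ∎
    where open ≤-Reasoning

-- Quadratic forms of a graph as sums over its edges.

module EdgeForms {c ℓ₁ ℓ₂} (ℝ : CompleteOrderedField c ℓ₁ ℓ₂) where
  open OrderedField ℝ
  open FiniteSums ℝ

  module _ {n k} (A B : Fin k → Fin n) where

    incident : (G H : Fin k → Fin n → Carrier) → Fin n → Carrier
    incident G H u = sum (λ e → δ u (A e) * G e u + δ u (B e) * H e u)

    -- Double counting: after the two sums are exchanged, the deltas collapse the inner sum over
    -- vertices to the two ends of the edge.
    sum-incident : ∀ (p : Fin n → Carrier) G H →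
      sum (λ u → p u * incident G H u) ≈ sum (λ e → p (A e) * G e (A e) + p (B e) * H e (B e))
    sum-incident p G H = begin-equality
      sum (λ u → p u * incident G H u)
        ≈⟨ sum-cong {n} (λ u → trans (*-distribˡ-sum {k} (p u) _) (sum-cong {k} λ e →
             solve 5 (λ p a g b h → p :* (a :* g :+ b :* h) := a :* (p :* g) :+ b :* (p :* h))
               refl (p u) (δ u (A e)) (G e u) (δ u (B e)) (H e u))) ⟩
      sum (λ u → sum (λ e → δ u (A e) * (p u * G e u) + δ u (B e) * (p u * H e u)))
        ≈⟨ ∑-comm {n} {k} _ ⟩
      sum (λ e → sum (λ u → δ u (A e) * (p u * G e u) + δ u (B e) * (p u * H e u)))
        ≈⟨ sum-cong {k} (λ e → trans (∑-distrib-+ {n} _ _)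
             (+-cong (sum-δ (A e) (λ u → p u * G e u)) (sum-δ (B e) (λ u → p u * H e u)))) ⟩
      sum (λ e → p (A e) * G e (A e) + p (B e) * H e (B e)) ∎
      where open ≤-Reasoning

    -- The matrix r D + s A of the graph with edges A e B e, where D is its degree matrix and
    -- A its adjacency matrix, and the associated quadratic form.
    flow : (r s : Carrier) → (Fin n → Carrier) → Fin n → Carrier
    flow r s y = incident (λ e u → r * y u + s * y (B e)) (λ e u → r * y u + s * y (A e))

    degreeForm adjacencyForm : (Fin n → Carrier) → Carrier
    degreeForm y = sum (λ e → y (A e) * y (A e) + y (B e) * y (B e))
    adjacencyForm y = sum (λ e → fromNat 2 * (y (A e) * y (B e)))

    private
      collect : ∀ r s (y : Fin n → Carrier) (g : Fin k → Carrier) →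
        (∀ e → g e ≈ r * (y (A e) * y (A e) + y (B e) * y (B e)) + s * (fromNat 2 * (y (A e) * y (B e)))) →
        sum g ≈ r * degreeForm y + s * adjacencyForm y
      collect r s y g g≈ = begin-equality
        sum g
          ≈⟨ sum-cong {k} g≈ ⟩
        sum (λ e → r * (y (A e) * y (A e) + y (B e) * y (B e)) + s * (fromNat 2 * (y (A e) * y (B e))))
          ≈⟨ ∑-distrib-+ {k} _ _ ⟩
        sum (λ e → r * (y (A e) * y (A e) + y (B e) * y (B e))) + sum (λ e → s * (fromNat 2 * (y (A e) * y (B e))))
          ≈⟨ +-cong (*-distribˡ-sum {k} r _) (*-distribˡ-sum {k} s _) ⟨
        r * degreeForm y + s * adjacencyForm y ∎
        where open ≤-Reasoning

    sum-flow : ∀ r s y → sum (λ u → y u * flow r s y u) ≈ r * degreeForm y + s * adjacencyForm y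
    sum-flow r s y = trans (sum-incident y _ _) (collect r s y _ λ e →
      solve 4 (λ r s a b → a :* (r :* a :+ s :* b) :+ b :* (r :* b :+ s :* a)
        := r :* (a :* a :+ b :* b) :+ s :* (♯ 2 :* (a :* b))) refl r s (y (A e)) (y (B e)))

    0≤degreeForm : ∀ y → 0# ≤ degreeForm y
    0≤degreeForm y = 0≤sum {k} λ e → 0≤x+y (0≤x² _) (0≤x² _)

    gap : (w z : Fin n → Carrier) → Fin k → Carrier
    gap w z e = w (A e) * w (B e) * ((z (A e) - z (B e)) * (z (A e) - z (B e)))

    -- The ground-state transformation: when w is an eigenvector with eigenvalue θ, the form
    -- θ - (r D + s A) at the vector w z is a sum of squares.
    groundState : ∀ {r s θ w y} z → (∀ u → θ * w u ≈ flow r s w u) → (∀ u → y u ≈ w u * z u) →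
      θ * sum (λ u → y u * y u) ≈ r * degreeForm y + s * adjacencyForm y + s * sum (gap w z)
    groundState {r} {s} {θ} {w} {y} z eigen y≈wz = begin-equality
      θ * sum (λ u → y u * y u)
        ≈⟨ *-distribˡ-sum {n} θ _ ⟩
      sum (λ u → θ * (y u * y u))
        ≈⟨ sum-cong {n} (λ u → begin-equality
             θ * (y u * y u)
               ≈⟨ *-congˡ (*-cong (y≈wz u) (y≈wz u)) ⟩
             θ * (w u * z u * (w u * z u))
               ≈⟨ solve 3 (λ θ w z → θ :* (w :* z :* (w :* z)) := w :* (z :* z) :* (θ :* w)) refl θ (w u) (z u) ⟩
             w u * (z u * z u) * (θ * w u)
               ≈⟨ *-congˡ (eigen u) ⟩
             w u * (z u * z u) * flow r s w u ∎) ⟩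
      sum (λ u → w u * (z u * z u) * flow r s w u)
        ≈⟨ sum-incident (λ u → w u * (z u * z u)) _ _ ⟩
      sum (λ e → w (A e) * (z (A e) * z (A e)) * (r * w (A e) + s * w (B e))
               + w (B e) * (z (B e) * z (B e)) * (r * w (B e) + s * w (A e)))
        ≈⟨ sum-cong {k} (λ e → solve 6 (λ r s a b x y →
             a :* (x :* x) :* (r :* a :+ s :* b) :+ b :* (y :* y) :* (r :* b :+ s :* a)
             := r :* ((a :* x) :* (a :* x) :+ (b :* y) :* (b :* y)) :+ s :* (♯ 2 :* ((a :* x) :* (b :* y)))
                :+ s :* (a :* b :* ((x :- y) :* (x :- y))))
             refl r s (w (A e)) (w (B e)) (z (A e)) (z (B e))) ⟩
      sum (λ e → r * (w (A e) * z (A e) * (w (A e) * z (A e)) + w (B e) * z (B e) * (w (B e) * z (B e)))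
               + s * (fromNat 2 * (w (A e) * z (A e) * (w (B e) * z (B e)))) + s * gap w z e)
        ≈⟨ ∑-distrib-+ {k} _ _ ⟩
      _ + sum (λ e → s * gap w z e)
        ≈⟨ +-cong (collect r s y _ λ e → +-cong
             (*-congˡ (sym (+-cong (*-cong (y≈wz (A e)) (y≈wz (A e))) (*-cong (y≈wz (B e)) (y≈wz (B e))))))
             (*-congˡ (*-congˡ (sym (*-cong (y≈wz (A e)) (y≈wz (B e)))))))
             (sym (*-distribˡ-sum {k} s _)) ⟩
      r * degreeForm y + s * adjacencyForm y + s * sum (gap w z) ∎
      where open ≤-Reasoning

-- Comparison of two graphs that differ only in the second ends of their edges.

module Comparison {c ℓ₁ ℓ₂} (ℝ : CompleteOrderedField c ℓ₁ ℓ₂) where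
  open OrderedField ℝ
  open FiniteSums ℝ
  open EdgeForms ℝ
  open PerronRoot ℝ using (s; θ)

  module _ (r : ℕ) where
    private
      R = fromNat r

    -- θ = (s - 1)(s - r), so θ / s is increasing in s.
    θ/s-mono : ∀ {ν ν′} → 0# < ν → ν < ν′ → 0# < s ν R * θ ν′ R - s ν′ R * θ ν R
    θ/s-mono {ν} {ν′} 0<ν ν<ν′ = <-respʳ-≈
      (solve 3 (λ ν ν′ r → (ν′ :- ν) :* (ν :+ ν′ :* (ν :+ r :+ ♯ 1) :+ ♯ 1 :+ r :* (ν :+ r :+ ♯ 1)) :=
        (ν :+ r :+ ♯ 1) :* ((ν′ :+ ♯ 1) :* (ν′ :+ r)) :- (ν′ :+ r :+ ♯ 1) :* ((ν :+ ♯ 1) :* (ν :+ r)))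
        refl ν ν′ R)
      (0<x*y (x<y⇒0<y-x ν<ν′) (0<x+y (0≤x⇒0<y⇒0<x+y (0≤x+y (proj₁ 0<ν) (*-nonNegative 0≤ν′
        (0≤x+y (0≤x+y (proj₁ 0<ν) 0≤R) (0≤fromNat 1)))) (0<fromNat 0))
        (*-nonNegative 0≤R (0≤x+y (0≤x+y (proj₁ 0<ν) 0≤R) (0≤fromNat 1)))))
      where
      0≤R = 0≤fromNat r
      0≤ν′ = ≤-trans (proj₁ 0<ν) (proj₁ ν<ν′)

  module Compare {n k} (r : ℕ) (A B B* : Fin k → Fin n) {ν* : Carrier} (0<ν* : 0# < ν*)
    (w : Fin n → Carrier) (0<w : ∀ u → 0# < w u)
    (eigen : ∀ u → θ ν* (fromNat r) * w u ≈ flow A B* (fromNat r) (s ν* (fromNat r)) w u)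
    {ν : Carrier} (0<ν+1 : 0# < ν + fromNat 1)
    (y : Fin n → Carrier) (0≤y : ∀ u → 0# ≤ y u) (0<y² : 0# < sum (λ u → y u * y u))
    (subeigen : ∀ u → θ ν (fromNat r) * y u ≤ flow A B (fromNat r) (s ν (fromNat r)) y u)
    (dominated : ∀ e → y (B e) ≤ y (B* e))
    where

    private
      R = fromNat r
      0≤R = 0≤fromNat r
      X = sum (λ u → y u * y u)
      D = degreeForm A B* y
      C = adjacencyForm A B* y

    0<s : 0# < s ν R
    0<s = <-respʳ-≈ (solve 2 (λ ν r → ν :+ ♯ 1 :+ r := ν :+ r :+ ♯ 1) refl ν R) (0<x+y 0<ν+1 0≤R)

    0<s* : 0# < s ν* R
    0<s* = 0<x+y (0<x+y 0<ν* 0≤R) (0≤fromNat 1)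

    z : Fin n → Carrier
    z u = y u * w u ⁻¹

    y≈wz : ∀ u → y u ≈ w u * z u
    y≈wz u = sym (begin-equality
      w u * (y u * w u ⁻¹)  ≈⟨ solve 3 (λ w y i → w :* (y :* i) := y :* (w :* i)) refl (w u) (y u) (w u ⁻¹) ⟩
      y u * (w u * w u ⁻¹)  ≈⟨ *-congˡ (⁻¹-inverse (>⇒≉0 (0<w u))) ⟩
      y u * 1#              ≈⟨ *-identityʳ _ ⟩
      y u                   ∎)
      where open ≤-Reasoning

    -- The inequality at `u` is multiplied by `y u ≥ 0` and summed. As `y` is non-negative, passing
    -- from `B e` to `B* e` increases both the squares and the products in the form.
    upper : θ ν R * X ≤ R * D + s ν R * C
    upper = begin
      θ ν R * X
        ≈⟨ *-distribˡ-sum {n} (θ ν R) _ ⟩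
      sum (λ u → θ ν R * (y u * y u))
        ≤⟨ sum-mono-≤ {n} (λ u → ≤-trans
             (≤-reflexive (solve 2 (λ θ y → θ :* (y :* y) := y :* (θ :* y)) refl (θ ν R) (y u)))
             (*-monoˡ-≤ (0≤y u) (subeigen u))) ⟩
      sum (λ u → y u * flow A B R (s ν R) y u)
        ≈⟨ sum-flow A B R (s ν R) y ⟩
      R * degreeForm A B y + s ν R * adjacencyForm A B y
        ≤⟨ +-mono-≤
             (*-monoˡ-≤ 0≤R (sum-mono-≤ {k} λ e → +-mono-≤ ≤-refl
               (≤-trans (*-monoˡ-≤ (0≤y _) (dominated e)) (≤-trans (≤-reflexive (*-comm _ _))
                 (*-monoˡ-≤ (0≤y _) (dominated e))))))
             (*-monoˡ-≤ (proj₁ 0<s) (sum-mono-≤ {k} λ e →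
               *-monoˡ-≤ (0≤fromNat 2) (*-monoˡ-≤ (0≤y (A e)) (dominated e)))) ⟩
      R * D + s ν R * C ∎
      where open ≤-Reasoning

    gaps : Fin k → Carrier
    gaps = gap A B* w z

    0≤gaps : ∀ e → 0# ≤ gaps e
    0≤gaps e = *-nonNegative (*-nonNegative (proj₁ (0<w _)) (proj₁ (0<w _))) (0≤x² _)

    exact : θ ν* R * X ≈ R * D + s ν* R * C + s ν* R * sum gaps
    exact = groundState A B* z eigen y≈wz

    -- Subtracting `s` times `exact` from `s*` times `upper` cancels the adjacency form: `(s* θ - s
    -- θ*) X ≤ (s* - s) r D - s s* sum gaps`. If `ν* < ν`, the left side is positive by `θ/s-mono`,
    -- while the right side is not.
    ν≤ν* : ν ≤ ν*
    ν≤ν* with ≤-or-> ν ν*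
    ... | inj₁ ν≤ν* = ν≤ν*
    ... | inj₂ ν*<ν = contradiction
          (0<x*y (θ/s-mono r 0<ν* ν*<ν) 0<y²)
          (λ 0<x → <⇒≱ 0<x (0≤d⇒x≤y
            (0≤x+y (0≤x+y (*-nonNegative (proj₁ 0<s*) (x≤y⇒0≤y-x upper))
                          (*-nonNegative (x≤y⇒0≤y-x s*≤s) (*-nonNegative 0≤R (0≤degreeForm A B* y))))
                   (*-nonNegative (proj₁ 0<s) (*-nonNegative (proj₁ 0<s*) (0≤sum {k} 0≤gaps))))
            (begin-equality
              0#
                ≈⟨ solve 2 (λ s x → ♯ 0 := s :* (x :- x)) refl (s ν R) (θ ν* R * X) ⟩
              s ν R * (θ ν* R * X - θ ν* R * X)
                ≈⟨ *-congˡ (+-congʳ exact) ⟩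
              s ν R * (R * D + s ν* R * C + s ν* R * sum gaps - θ ν* R * X)
                ≈⟨ solve 9 (λ s s* θ θ* x r d c g →
                     s :* (r :* d :+ s* :* c :+ s* :* g :- θ* :* x)
                     := (s* :* θ :- s :* θ*) :* x
                        :+ (s* :* (r :* d :+ s :* c :- θ :* x) :+ (s :- s*) :* (r :* d) :+ s :* (s* :* g)))
                     refl (s ν R) (s ν* R) (θ ν R) (θ ν* R) X R D C (sum gaps) ⟩
              (s ν* R * θ ν R - s ν R * θ ν* R) * X
                + (s ν* R * (R * D + s ν R * C - θ ν R * X) + (s ν R - s ν* R) * (R * D)
                   + s ν R * (s ν* R * sum gaps)) ∎)))
      where
      open ≤-Reasoning
      s*≤s : s ν* R ≤ s ν R
      s*≤s = +-monoˡ-≤ (fromNat 1) (+-monoˡ-≤ R (proj₁ ν*<ν))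

    module Equality (ν≈ν* : ν ≈ ν*) where
      s≈s* : s ν R ≈ s ν* R
      s≈s* = +-congʳ (+-congʳ ν≈ν*)

      θ≈θ* : θ ν R ≈ θ ν* R
      θ≈θ* = *-cong (+-congʳ ν≈ν*) (+-congʳ ν≈ν*)

      -- At equal parameters `exact` exceeds the bound in `upper` by `s*` times the sum of the gaps.
      -- That sum is therefore at most zero, and its terms are non-negative.
      gaps≈0 : ∀ e → gaps e ≈ 0#
      gaps≈0 e = antisym (≤-trans (term≤sum {k} 0≤gaps e) sum≤0) (0≤gaps e)
        where
        open ≤-Reasoning
        sum≤0 : sum gaps ≤ 0#
        sum≤0 = *-cancelˡ-≤ 0<s* (0≤d⇒x≤y (x≤y⇒0≤y-x upper) (begin-equality
          s ν* R * 0#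
            ≈⟨ solve 2 (λ s x → s :* ♯ 0 := x :- x) refl (s ν* R) (θ ν* R * X) ⟩
          θ ν* R * X - θ ν* R * X
            ≈⟨ +-cong exact (-‿cong (*-congʳ (sym θ≈θ*))) ⟩
          R * D + s ν* R * C + s ν* R * sum gaps - θ ν R * X
            ≈⟨ solve 4 (λ a b c d → a :+ b :+ c :- d := c :+ (a :+ b :- d)) refl _ _ _ _ ⟩
          s ν* R * sum gaps + (R * D + s ν* R * C - θ ν R * X)
            ≈⟨ +-congˡ (+-congʳ (+-congˡ (*-congʳ (sym s≈s*)))) ⟩
          s ν* R * sum gaps + (R * D + s ν R * C - θ ν R * X) ∎))

      z-constant : ∀ e → z (A e) ≈ z (B* e)
      z-constant e = begin-equality
        z (A e)                        ≈⟨ solve 2 (λ a b → a := b :+ (a :- b)) refl (z (A e)) (z (B* e)) ⟩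
        z (B* e) + (z (A e) - z (B* e)) ≈⟨ +-congˡ (x²≈0⇒x≈0 (*≈0 (gaps≈0 e) (>⇒≉0 (0<x*y (0<w _) (0<w _))))) ⟩
        z (B* e) + 0#                  ≈⟨ +-identityʳ _ ⟩
        z (B* e)                       ∎
        where open ≤-Reasoning

      module Proportional {κ} (z≈κ : ∀ u → z u ≈ κ) where
        y≈κw : ∀ u → y u ≈ κ * w u
        y≈κw u = trans (y≈wz u) (trans (*-congˡ (z≈κ u)) (*-comm _ _))

        0<κ : 0# < κ
        0<κ with ≤-or-> κ 0#
        ... | inj₂ 0<κ = 0<κ
        ... | inj₁ κ≤0 = contradiction (sum-zero {n} λ u → trans (*-cong (y≈0 u) (y≈0 u)) (zeroˡ _)) (>⇒≉0 0<y²)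
          where
          y≈0 : ∀ u → y u ≈ 0#
          y≈0 u = antisym (0≤d⇒x≤y (*-nonNegative (-x≥0 κ≤0) (proj₁ (0<w u)))
                    (trans (solve 2 (λ κ w → ♯ 0 := κ :* w :+ :- κ :* w) refl κ (w u))
                           (+-congʳ (sym (y≈κw u)))))
                  (0≤y u)

        0<y : ∀ u → 0# < y u
        0<y u = <-respʳ-≈ (sym (y≈κw u)) (0<x*y 0<κ (0<w u))

        -- Being proportional to `w`, the vector `y` satisfies the eigenvalue equation of the graph
        -- with ends `B*`, and it is a subeigenvector of the other graph for the same `θ` and `s`.
        flow≤flow : ∀ u → flow A B* R (s ν R) y u ≤ flow A B R (s ν R) y u
        flow≤flow u = ≤-trans (≤-reflexive (begin-equality
          flow A B* R (s ν R) y u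
            ≈⟨ sum-cong {k} (λ e → +-cong
                 (*-congˡ (+-cong (*-congˡ (y≈κw u)) (*-cong s≈s* (y≈κw _))))
                 (*-congˡ (+-cong (*-congˡ (y≈κw u)) (*-cong s≈s* (y≈κw _))))) ⟩
          flow A B* R (s ν* R) (λ u → κ * w u) u
            ≈⟨ sum-cong {k} (λ e → solve 8 (λ κ a b r s x y u →
                 a :* (r :* (κ :* u) :+ s :* (κ :* y)) :+ b :* (r :* (κ :* u) :+ s :* (κ :* x))
                 := κ :* (a :* (r :* u :+ s :* y) :+ b :* (r :* u :+ s :* x)))
                 refl κ (δ u (A e)) (δ u (B* e)) R (s ν* R) (w (A e)) (w (B* e)) (w u)) ⟩
          sum (λ e → κ * (δ u (A e) * (R * w u + s ν* R * w (B* e)) + δ u (B* e) * (R * w u + s ν* R * w (A e))))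
            ≈⟨ *-distribˡ-sum {k} κ _ ⟨
          κ * flow A B* R (s ν* R) w u
            ≈⟨ *-congˡ (eigen u) ⟨
          κ * (θ ν* R * w u)
            ≈⟨ solve 3 (λ κ θ w → κ :* (θ :* w) := θ :* (κ :* w)) refl κ (θ ν* R) (w u) ⟩
          θ ν* R * (κ * w u)
            ≈⟨ *-cong (sym θ≈θ*) (sym (y≈κw u)) ⟩
          θ ν R * y u ∎)) (subeigen u)
          where open ≤-Reasoning

        -- Otherwise the equations of the two graphs at u would differ.
        endpoint : ∀ u → (∀ e → B e ≡ u → B* e ≡ u) → ∀ e → B* e ≡ u → B e ≡ u
        endpoint u B⇒B* e B*e≡u with B e Fin.≟ u
        ... | yes Be≡u = Be≡u
        ... | no Be≢u = contradiction (flow≤flow u) (<⇒≱ flow<flow)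
          where
          term term* : Fin k → Carrier
          term e = δ u (A e) * (R * y u + s ν R * y (B e)) + δ u (B e) * (R * y u + s ν R * y (A e))
          term* e = δ u (A e) * (R * y u + s ν R * y (B* e)) + δ u (B* e) * (R * y u + s ν R * y (A e))

          0<g : ∀ v → 0# < R * y u + s ν R * y v
          0<g v = 0≤x⇒0<y⇒0<x+y (*-nonNegative 0≤R (0≤y u)) (0<x*y 0<s (0<y v))

          δ-mono : ∀ e → δ u (B e) ≤ δ u (B* e)
          δ-mono e with u Fin.≟ B e
          ... | no _ = 0≤δ u (B* e)
          ... | yes u≡Be = ≤-reflexive (trans (trans (+-identityʳ 1#) (sym (δ-refl u)))
                  (reflexive (≡.cong (δ u) (≡.sym (B⇒B* e (≡.sym u≡Be))))))

          first≤ : ∀ e → δ u (A e) * (R * y u + s ν R * y (B e)) ≤ δ u (A e) * (R * y u + s ν R * y (B* e))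
          first≤ e = *-monoˡ-≤ (0≤δ u (A e)) (+-mono-≤ ≤-refl (*-monoˡ-≤ (proj₁ 0<s) (dominated e)))

          term≤ : ∀ e → term e ≤ term* e
          term≤ e = +-mono-≤ (first≤ e) (begin
            δ u (B e) * g   ≈⟨ *-comm _ _ ⟩
            g * δ u (B e)   ≤⟨ *-monoˡ-≤ (proj₁ (0<g (A e))) (δ-mono e) ⟩
            g * δ u (B* e)  ≈⟨ *-comm _ _ ⟩
            δ u (B* e) * g  ∎)
            where
            open ≤-Reasoning
            g = R * y u + s ν R * y (A e)

          term<e : term e < term* e
          term<e = 0<d⇒x<y (0≤x⇒0<y⇒0<x+y (x≤y⇒0≤y-x (first≤ e)) (0<g (A e))) (begin-equality
            p* + δ u (B* e) * g
              ≈⟨ +-congˡ (*-congʳ (trans (reflexive (≡.cong (δ u) B*e≡u)) (δ-refl u))) ⟩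
            p* + 1# * g
              ≈⟨ +-congˡ (*-identityˡ g) ⟩
            p* + g
              ≈⟨ solve 3 (λ p p* g → p* :+ g := p :+ ♯ 0 :* g :+ (p* :- p :+ g)) refl p p* g ⟩
            p + 0# * g + (p* - p + g)
              ≈⟨ +-congʳ (+-congˡ (*-congʳ (sym (δ-≢ (Be≢u ∘ ≡.sym))))) ⟩
            p + δ u (B e) * g + (p* - p + g) ∎)
            where
            open ≤-Reasoning
            g = R * y u + s ν R * y (A e)
            p = δ u (A e) * (R * y u + s ν R * y (B e))
            p* = δ u (A e) * (R * y u + s ν R * y (B* e))

          flow<flow : flow A B R (s ν R) y u < flow A B* R (s ν R) y u
          flow<flow = 0<d⇒x<y
            (<-≤-trans (x<y⇒0<y-x term<e) (term≤sum {k} (λ e → x≤y⇒0≤y-x (term≤ e)) e))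
            (begin-equality
              sum term*                            ≈⟨ solve 2 (λ a b → b := a :+ (b :- a)) refl (sum term) (sum term*) ⟩
              sum term + (sum term* - sum term)    ≈⟨ +-congˡ (sum-distrib-sub {k} term* term) ⟨
              sum term + sum (λ e → term* e - term e) ∎)
            where open ≤-Reasoning

-- The comparison specialised to the extremal graph.

module Extremal {c ℓ₁ ℓ₂} (ℝ : CompleteOrderedField c ℓ₁ ℓ₂) (r l : ℕ) where
  open OrderedField ℝ
  open FiniteSums ℝ
  open EdgeForms ℝ
  open PerronRoot ℝ
  open Perron (perron r l) public
  open Comparison ℝ

  private
    R = fromNat r

  w : Fin (4 ℕ.+ l) → Carrier
  w 0F = x₀
  w 1F = x₁
  w 2F = x₂
  w 3F = x₁
  w (4+ _) = x₄

  0<w : ∀ u → 0# < w u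
  0<w 0F = 0<x₀
  0<w 1F = 0<x₁
  0<w 2F = 0<x₂
  0<w 3F = 0<x₁
  0<w (4+ _) = 0<x₄

  private
    pendant : Fin (4 ℕ.+ l) → Fin l → Carrier
    pendant u j = δ u (4+ j) * (R * w u + s ν R * x₀) + δ u 0F * (R * w u + s ν R * x₄)

    -- The summand of flow at an edge with weights h at the head and t at the tail.
    edgeᴾ : ∀ {n} (i j r s u h t : Polynomial n) → Polynomial n
    edgeᴾ i j r s u h t = i :* (r :* u :+ s :* h) :+ j :* (r :* u :+ s :* t)

    0*+0* : ∀ x y → fromNat 0 * x + fromNat 0 * y ≈ 0#
    0*+0* = solve 2 (λ x y → ♯ 0 :* x :+ ♯ 0 :* y := ♯ 0) refl

  -- At each kind of vertex the deltas of the five diamond edges compute to constants, so the solver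
  -- handles these summands in the order of the edges. The pendant edges form the remaining sum,
  -- which is evaluated separately.
  eigen : ∀ u → θ ν R * w u ≈ flow tail head R (s ν R) w u
  eigen 0F = trans eigen₀ (trans
    (solve 7 (λ r s a b c d k →
      let edge = λ i j → edgeᴾ i j r s a in
      (r :* a :+ s :* b) :+ (r :* a :+ s :* c) :+ (r :* a :+ s :* b) :+ k :* (r :* a :+ s :* d)
      := edge (♯ 0) (♯ 1) a b :+ (edge (♯ 0) (♯ 0) b c :+ (edge (♯ 0) (♯ 1) a c :+ (edge (♯ 0) (♯ 0) c b
         :+ (edge (♯ 0) (♯ 1) a b :+ k :* edge (♯ 0) (♯ 1) a d)))))
      refl R (s ν R) x₀ x₁ x₂ x₄ (fromNat l))
    (+-congˡ (+-congˡ (+-congˡ (+-congˡ (+-congˡ (sym (sum-const l _))))))))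
  eigen 1F = trans eigen₁ (trans
    (solve 5 (λ r s a b c →
      let edge = λ i j → edgeᴾ i j r s b in
      (r :* b :+ s :* a) :+ (r :* b :+ s :* c)
      := edge (♯ 1) (♯ 0) a b :+ (edge (♯ 0) (♯ 1) b c :+ (edge (♯ 0) (♯ 0) a c :+ (edge (♯ 0) (♯ 0) c b
         :+ (edge (♯ 0) (♯ 0) a b :+ ♯ 0)))))
      refl R (s ν R) x₀ x₁ x₂)
    (+-congˡ (+-congˡ (+-congˡ (+-congˡ (+-congˡ (sym (sum-zero {l} λ _ → 0*+0* _ _))))))))
  eigen 2F = trans eigen₂ (trans
    (solve 5 (λ r s a b c →
      let edge = λ i j → edgeᴾ i j r s c in
      (r :* c :+ s :* b) :+ (r :* c :+ s :* b) :+ (r :* c :+ s :* a)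
      := edge (♯ 0) (♯ 0) a b :+ (edge (♯ 1) (♯ 0) b c :+ (edge (♯ 1) (♯ 0) a c :+ (edge (♯ 0) (♯ 1) c b
         :+ (edge (♯ 0) (♯ 0) a b :+ ♯ 0)))))
      refl R (s ν R) x₀ x₁ x₂)
    (+-congˡ (+-congˡ (+-congˡ (+-congˡ (+-congˡ (sym (sum-zero {l} λ _ → 0*+0* _ _))))))))
  eigen 3F = trans eigen₁ (trans
    (solve 5 (λ r s a b c →
      let edge = λ i j → edgeᴾ i j r s b in
      (r :* b :+ s :* a) :+ (r :* b :+ s :* c)
      := edge (♯ 0) (♯ 0) a b :+ (edge (♯ 0) (♯ 0) b c :+ (edge (♯ 0) (♯ 0) a c :+ (edge (♯ 1) (♯ 0) c b
         :+ (edge (♯ 1) (♯ 0) a b :+ ♯ 0)))))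
      refl R (s ν R) x₀ x₁ x₂)
    (+-congˡ (+-congˡ (+-congˡ (+-congˡ (+-congˡ (sym (sum-zero {l} λ _ → 0*+0* _ _))))))))
  eigen (4+ j) = trans eigen₄ (trans
    (solve 6 (λ r s a b c d →
      let edge = λ i j → edgeᴾ i j r s d in
      r :* d :+ s :* a
      := edge (♯ 0) (♯ 0) a b :+ (edge (♯ 0) (♯ 0) b c :+ (edge (♯ 0) (♯ 0) a c :+ (edge (♯ 0) (♯ 0) c b
         :+ (edge (♯ 0) (♯ 0) a b :+ (r :* d :+ s :* a))))))
      refl R (s ν R) x₀ x₁ x₂ x₄)
    (+-congˡ (+-congˡ (+-congˡ (+-congˡ (+-congˡ (sym pendants)))))))
    where
    pendants : sum (pendant (4+ j)) ≈ R * x₄ + s ν R * x₀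
    pendants = trans
      (sum-cong {l} λ i → trans
        (+-congʳ (*-congʳ (δ-sym j i)))
        (solve 3 (λ i g h → i :* g :+ ♯ 0 :* h := i :* g) refl (δ i j) (R * x₄ + s ν R * x₀) (R * x₄ + s ν R * x₄)))
      (sum-δ j _)

  module _ (B : Fin (5 ℕ.+ l) → Fin (4 ℕ.+ l)) {ν′ : Carrier} (0<ν′+1 : 0# < ν′ + fromNat 1)
    (y : Fin (4 ℕ.+ l) → Carrier) (0≤y : ∀ u → 0# ≤ y u) (0<y² : 0# < sum (λ u → y u * y u))
    (subeigen : ∀ u → θ ν′ R * y u ≤ flow tail B R (s ν′ R) y u)
    (dominated : ∀ e → y (B e) ≤ y (head e)) where

    private
      module C = Compare r tail B head 0<ν w 0<w eigen 0<ν′+1 y 0≤y 0<y² subeigen dominated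

    ν′≤ν : ν′ ≤ ν
    ν′≤ν = C.ν≤ν*

    -- The edges with head `0F` join every other vertex to `0F`, so `z` is constant and `y`
    -- proportional to `w`. The equation at `0F` then fixes all edges with head `0F`; the conditions
    -- on edges `1F` and `3F` say that neither has its second end there beforehand. After that only
    -- edge `3F` is undetermined, and the equation at `2F` fixes it.
    equality : ν′ ≈ ν → B 1F ≡ 1F → B 3F ≢ 0F → ∀ e → B e ≡ head e
    equality ν′≈ν B1≡1 B3≢0 = λ where
        0F → at0 0F ≡.refl
        1F → B1≡1
        2F → at0 2F ≡.refl
        3F → E.endpoint 2F B⇒head₂ 3F ≡.refl
        4F → at0 4F ≡.refl
        (5+ j) → at0 (5+ j) ≡.refl
      where
      z≈z₀ : ∀ u → C.z u ≈ C.z 0F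
      z≈z₀ 0F = refl
      z≈z₀ 1F = C.Equality.z-constant ν′≈ν 0F
      z≈z₀ 2F = C.Equality.z-constant ν′≈ν 2F
      z≈z₀ 3F = C.Equality.z-constant ν′≈ν 4F
      z≈z₀ (4+ j) = C.Equality.z-constant ν′≈ν (5+ j)

      module E = C.Equality.Proportional ν′≈ν z≈z₀

      B⇒head₀ : ∀ e → B e ≡ 0F → head {l} e ≡ 0F
      B⇒head₀ 0F _ = ≡.refl
      B⇒head₀ 1F B1≡0 = contradiction (≡.trans (≡.sym B1≡0) B1≡1) λ ()
      B⇒head₀ 2F _ = ≡.refl
      B⇒head₀ 3F B3≡0 = contradiction B3≡0 B3≢0
      B⇒head₀ 4F _ = ≡.refl
      B⇒head₀ (5+ j) _ = ≡.refl

      at0 : ∀ e → head e ≡ 0F → B e ≡ 0F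
      at0 = E.endpoint 0F B⇒head₀

      B⇒head₂ : ∀ e → B e ≡ 2F → head {l} e ≡ 2F
      B⇒head₂ 3F _ = ≡.refl
      B⇒head₂ 1F B≡2 = contradiction (≡.trans (≡.sym B1≡1) B≡2) λ ()
      B⇒head₂ 0F B≡2 = contradiction (≡.trans (≡.sym (at0 0F ≡.refl)) B≡2) λ ()
      B⇒head₂ 2F B≡2 = contradiction (≡.trans (≡.sym (at0 2F ≡.refl)) B≡2) λ ()
      B⇒head₂ 4F B≡2 = contradiction (≡.trans (≡.sym (at0 4F ≡.refl)) B≡2) λ ()
      B⇒head₂ (5+ j) B≡2 = contradiction (≡.trans (≡.sym (at0 (5+ j) ≡.refl)) B≡2) λ ()

-- Real eigenvectors and subeigenvectors of symmetric non-negative matrices.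

module SymmetricMatrices {c ℓ₁ ℓ₂} (ℝ : CompleteOrderedField c ℓ₁ ℓ₂) where
  open OrderedField ℝ
  open IntermediateValue ℝ
  open FiniteSums ℝ
  open SpectralRadius ℝ

  infixr 8 _·ᴿ_
  _·ᴿ_ : ∀ {n} → Matrix n → (Fin n → Carrier) → Fin n → Carrier
  (A ·ᴿ x) i = sum (λ j → A i j * x j)

  Symmetric : ∀ {n} → Matrix n → Set ℓ₁
  Symmetric A = ∀ i j → A i j ≈ A j i

  selfAdjoint : ∀ {n} (A : Matrix n) → Symmetric A → ∀ x y →
                sum (λ i → y i * (A ·ᴿ x) i) ≈ sum (λ i → x i * (A ·ᴿ y) i)
  selfAdjoint {n} A A-sym x y = begin-equality
    sum (λ i → y i * (A ·ᴿ x) i)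
      ≈⟨ sum-cong {n} (λ i → *-distribˡ-sum {n} (y i) _) ⟩
    sum (λ i → sum (λ j → y i * (A i j * x j)))
      ≈⟨ ∑-comm {n} {n} _ ⟩
    sum (λ j → sum (λ i → y i * (A i j * x j)))
      ≈⟨ sum-cong {n} (λ j → trans
           (sum-cong {n} λ i → trans
             (solve 3 (λ y a x → y :* (a :* x) := x :* (a :* y)) refl (y i) (A i j) (x j))
             (*-congˡ (*-congʳ (A-sym i j))))
           (sym (*-distribˡ-sum {n} (x j) _))) ⟩
    sum (λ j → x j * (A ·ᴿ y) j) ∎
    where open ≤-Reasoning

  square-injective : ∀ {x y} → 0# ≤ x → 0# ≤ y → x * x ≈ y * y → x ≈ y
  square-injective 0≤x 0≤y x²≈y² = antisym (half 0≤y (≤-reflexive x²≈y²)) (half 0≤x (≤-reflexive (sym x²≈y²)))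
    where
    half : ∀ {x y} → 0# ≤ y → x * x ≤ y * y → x ≤ y
    half {x} {y} 0≤y x²≤y² with ≤-or-> x y
    ... | inj₁ x≤y = x≤y
    ... | inj₂ y<x = contradiction x²≤y² (<⇒≱ (begin-strict
          y * y  ≤⟨ *-monoˡ-≤ 0≤y (proj₁ y<x) ⟩
          y * x  ≈⟨ *-comm y x ⟩
          x * y  <⟨ *-monoˡ-< (≤-<-trans 0≤y y<x) y<x ⟩
          x * x  ∎))
      where open ≤-Reasoning

  Subeigenvector : ∀ {n} → Matrix n → Carrier → (Fin n → Carrier) → Set _
  Subeigenvector A ρ y = (∀ i → 0# ≤ y i) × (∃[ i ] 0# < y i) × (∀ i → ρ * y i ≤ (A ·ᴿ y) i)

  module _ {n} (A : Matrix n) (A-sym : Symmetric A) (0≤A : ∀ i j → 0# ≤ A i j) where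

    -- The triangle inequality: `ρ` times the absolute value of `x i` is the absolute value of a sum
    -- with non-negative coefficients. The alternative for `ρ` covers the case in which the radius
    -- is attained at a negative eigenvalue.
    abs-subeigenvector : ∀ {a ρ} x → (∀ i → (A ·ᴿ x) i ≈ a * x i) → ∀ i₀ → x i₀ ≉ 0# →
                         ρ ≈ a ⊎ ρ ≈ - a → ∃ (Subeigenvector A ρ)
    abs-subeigenvector {a} {ρ} x Ax≈ax i₀ x≉0 ρ≈±a = y , 0≤y , (i₀ , 0<y₀) , bound
      where
      y : Fin n → Carrier
      y i = proj₁ (abs (x i))

      0≤y : ∀ i → 0# ≤ y i
      0≤y i = proj₁ (proj₂ (abs (x i)))

      x≤±y : ∀ i → x i ≤± y i
      x≤±y i = proj₁ (proj₂ (proj₂ (abs (x i))))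

      y≈±x : ∀ i → y i ≈ x i ⊎ y i ≈ - x i
      y≈±x i = proj₂ (proj₂ (proj₂ (abs (x i))))

      0<y₀ : 0# < y i₀
      0<y₀ = 0≤y i₀ , λ 0≈y → x≉0 ([ (λ y≈x → trans (sym y≈x) (sym 0≈y))
        , (λ y≈-x → trans (sym (-‿involutive (x i₀))) (trans (-‿cong (trans (sym y≈-x) (sym 0≈y))) -0≈0)) ]′
        (y≈±x i₀))

      sum-≤± : ∀ {m} {f g : Fin m → Carrier} → (∀ i → f i ≤± g i) → sum f ≤± sum g
      sum-≤± {zero} f≤±g = ≤-reflexive -0≈0 , ≤-refl
      sum-≤± {suc m} f≤±g = ≤±-+ (f≤±g zero) (sum-≤± (f≤±g ∘ suc))

      scale-≤± : ∀ {b u v} → 0# ≤ b → u ≤± v → b * u ≤± b * v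
      scale-≤± {b} {u} {v} 0≤b (-v≤u , u≤v) =
        ≤-trans (≤-reflexive (-‿distribʳ-* b v)) (*-monoˡ-≤ 0≤b -v≤u) , *-monoˡ-≤ 0≤b u≤v

      Ax≤±Ay : ∀ i → (A ·ᴿ x) i ≤± (A ·ᴿ y) i
      Ax≤±Ay i = sum-≤± {n} λ j → scale-≤± (0≤A i j) (x≤±y j)

      bound : ∀ i → ρ * y i ≤ (A ·ᴿ y) i
      bound i = [ (λ ρy≈ → ≤-trans (≤-reflexive ρy≈) (proj₂ (Ax≤±Ay i)))
                , (λ ρy≈ → ≤-trans (≤-reflexive ρy≈) (proj₂ (≤±-neg (Ax≤±Ay i)))) ]′ (signs ρ≈±a (y≈±x i))
        where
        signs : ρ ≈ a ⊎ ρ ≈ - a → y i ≈ x i ⊎ y i ≈ - x i → ρ * y i ≈ (A ·ᴿ x) i ⊎ ρ * y i ≈ - (A ·ᴿ x) i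
        signs (inj₁ ρ≈a) (inj₁ y≈x) = inj₁ (trans (*-cong ρ≈a y≈x) (sym (Ax≈ax i)))
        signs (inj₂ ρ≈-a) (inj₂ y≈-x) = inj₁ (trans (*-cong ρ≈-a y≈-x) (trans
          (solve 2 (λ a x → :- a :* :- x := a :* x) refl a (x i)) (sym (Ax≈ax i))))
        signs (inj₁ ρ≈a) (inj₂ y≈-x) = inj₂ (trans (*-cong ρ≈a y≈-x) (trans
          (solve 2 (λ a x → a :* :- x := :- (a :* x)) refl a (x i)) (-‿cong (sym (Ax≈ax i)))))
        signs (inj₂ ρ≈-a) (inj₁ y≈x) = inj₂ (trans (*-cong ρ≈-a y≈x) (trans
          (solve 2 (λ a x → :- a :* x := :- (a :* x)) refl a (x i)) (-‿cong (sym (Ax≈ax i)))))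

    -- Symmetry gives u · A v = v · A u, that is, b (|u|² + |v|²) = 0.
    imaginaryPart≈0 : ∀ {a b} u v → (∀ i → (A ·ᴿ u) i ≈ a * u i - b * v i)
                      → (∀ i → (A ·ᴿ v) i ≈ a * v i + b * u i) → ∀ i₀ → ¬ (u i₀ ≈ 0# × v i₀ ≈ 0#) → b ≈ 0#
    imaginaryPart≈0 {a} {b} u v Au Av i₀ uv≉0 = *≈0 (begin-equality
      S * b
        ≈⟨ *-distribʳ-sum {n} b _ ⟩
      sum (λ i → (u i * u i + v i * v i) * b)
        ≈⟨ sum-cong {n} (λ i → solve 4 (λ a b u v → (u :* u :+ v :* v) :* b
             := u :* (a :* v :+ b :* u) :- v :* (a :* u :- b :* v)) refl a b (u i) (v i)) ⟩
      sum (λ i → u i * (a * v i + b * u i) - v i * (a * u i - b * v i))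
        ≈⟨ sum-cong {n} (λ i → +-cong (*-congˡ (sym (Av i))) (-‿cong (*-congˡ (sym (Au i))))) ⟩
      sum (λ i → u i * (A ·ᴿ v) i - v i * (A ·ᴿ u) i)
        ≈⟨ sum-distrib-sub {n} _ _ ⟩
      sum (λ i → u i * (A ·ᴿ v) i) - sum (λ i → v i * (A ·ᴿ u) i)
        ≈⟨ +-congʳ (selfAdjoint A A-sym v u) ⟩
      sum (λ i → v i * (A ·ᴿ u) i) - sum (λ i → v i * (A ·ᴿ u) i)
        ≈⟨ -‿inverseʳ _ ⟩
      0# ∎) S≉0
      where
      open ≤-Reasoning
      S = sum (λ i → u i * u i + v i * v i)

      0≤term : ∀ i → 0# ≤ u i * u i + v i * v i
      0≤term i = 0≤x+y (0≤x² _) (0≤x² _)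

      S≉0 : S ≉ 0#
      S≉0 S≈0 = uv≉0
        ( x²≈0⇒x≈0 (antisym (≤-trans (0≤d⇒x≤y (0≤x² (v i₀)) refl) term≤0) (0≤x² _))
        , x²≈0⇒x≈0 (antisym (≤-trans (0≤d⇒x≤y (0≤x² (u i₀)) (+-comm _ _)) term≤0) (0≤x² _)))
        where
        term≤0 : u i₀ * u i₀ + v i₀ * v i₀ ≤ 0#
        term≤0 = ≤-respʳ-≈ S≈0 (term≤sum {n} 0≤term i₀)

    -- An eigenvalue attaining the radius is real by symmetry, hence `ρ` or `-ρ`. The real and
    -- imaginary parts of its eigenvector satisfy the same real equation, and at `i₀` at least one
    -- of them is not zero.
    subeigenvector : ∀ {ρ} → IsSpectralRadius A ρ → ∃ (Subeigenvector A ρ)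
    subeigenvector {ρ} (0≤ρ , ((a , b) , (x , x≉0 , Ax≈zx) , ∣z∣²≈ρ²) , _) = nonzeroPart (u i₀ ≟ 0#)
      where
      open ≤-Reasoning
      u v : Fin n → Carrier
      u i = proj₁ (x i)
      v i = proj₂ (x i)

      nonzero = Fin.¬∀⟶∃¬ n (λ i → x i ≈ᶜ 0ᶜ) (λ i → (u i ≟ 0#) ×-dec (v i ≟ 0#)) x≉0
      i₀ = proj₁ nonzero
      uv≉0 = proj₂ nonzero

      b≈0 : b ≈ 0#
      b≈0 = imaginaryPart≈0 u v (λ i → proj₁ (Ax≈zx i)) (λ i → proj₂ (Ax≈zx i)) i₀ uv≉0

      Au≈au : ∀ i → (A ·ᴿ u) i ≈ a * u i
      Au≈au i = begin-equality
        (A ·ᴿ u) i          ≈⟨ proj₁ (Ax≈zx i) ⟩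
        a * u i - b * v i   ≈⟨ +-congˡ (-‿cong (*-congʳ b≈0)) ⟩
        a * u i - 0# * v i  ≈⟨ solve 2 (λ p v → p :- ♯ 0 :* v := p) refl (a * u i) (v i) ⟩
        a * u i             ∎

      Av≈av : ∀ i → (A ·ᴿ v) i ≈ a * v i
      Av≈av i = begin-equality
        (A ·ᴿ v) i          ≈⟨ proj₂ (Ax≈zx i) ⟩
        a * v i + b * u i   ≈⟨ +-congˡ (*-congʳ b≈0) ⟩
        a * v i + 0# * u i  ≈⟨ solve 2 (λ p v → p :+ ♯ 0 :* v := p) refl (a * v i) (u i) ⟩
        a * v i             ∎

      a²≈ρ² : a * a ≈ ρ * ρ
      a²≈ρ² = begin-equality
        a * a            ≈⟨ solve 1 (λ a → a :* a := a :* a :+ ♯ 0 :* ♯ 0) refl a ⟩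
        a * a + 0# * 0#  ≈⟨ +-congˡ (*-cong (sym b≈0) (sym b≈0)) ⟩
        a * a + b * b    ≈⟨ ∣z∣²≈ρ² ⟩
        ρ * ρ            ∎

      ρ≈±a : ρ ≈ a ⊎ ρ ≈ - a
      ρ≈±a with total 0# a
      ... | inj₁ 0≤a = inj₁ (square-injective 0≤ρ 0≤a (sym a²≈ρ²))
      ... | inj₂ a≤0 = inj₂ (square-injective 0≤ρ (-x≥0 a≤0)
              (trans (sym a²≈ρ²) (solve 1 (λ a → a :* a := :- a :* :- a) refl a)))

      nonzeroPart : Dec (u i₀ ≈ 0#) → ∃ (Subeigenvector A ρ)
      nonzeroPart (no u≉0) = abs-subeigenvector u Au≈au i₀ u≉0 ρ≈±a
      nonzeroPart (yes u≈0) = abs-subeigenvector v Av≈av i₀ (λ v≈0 → uv≉0 (u≈0 , v≈0)) ρ≈±a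

  eigenvalue≤spectralRadius : ∀ {n} {A : Matrix n} {ρ t} → IsSpectralRadius A ρ → 0# ≤ t → ∀ x i₀ → x i₀ ≉ 0# →
                              (∀ i → (A ·ᴿ x) i ≈ t * x i) → t ≤ ρ
  eigenvalue≤spectralRadius {n} {A} {ρ} {t} (0≤ρ , _ , ∣z∣²≤ρ²) 0≤t x i₀ x≉0 Ax≈tx with ≤-or-> t ρ
  ... | inj₁ t≤ρ = t≤ρ
  ... | inj₂ ρ<t = contradiction
        (∣z∣²≤ρ² (t , 0#) ((λ i → x i , 0#) , (λ x≈0 → x≉0 (proj₁ (x≈0 i₀))) ,
          λ i → trans (Ax≈tx i) (solve 2 (λ t x → t :* x := t :* x :- ♯ 0 :* ♯ 0) refl t (x i)) ,
                trans (sum-zero {n} λ j → zeroʳ _) (solve 2 (λ t x → ♯ 0 := t :* ♯ 0 :+ ♯ 0 :* x) refl t (x i))))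
        (<⇒≱ (begin-strict
          ρ * ρ            ≤⟨ *-monoˡ-≤ 0≤ρ (proj₁ ρ<t) ⟩
          ρ * t            ≈⟨ *-comm ρ t ⟩
          t * ρ            <⟨ *-monoˡ-< (≤-<-trans 0≤ρ ρ<t) ρ<t ⟩
          t * t            ≈⟨ solve 1 (λ t → t :* t := t :* t :+ ♯ 0 :* ♯ 0) refl t ⟩
          t * t + 0# * 0#  ∎))
    where open ≤-Reasoning

-- The adjacency operator written through edge sums.

module AdjacencyOperator {c ℓ₁ ℓ₂} (ℝ : CompleteOrderedField c ℓ₁ ℓ₂) (r : ℕ) where
  open OrderedField ℝ
  open FiniteSums ℝ
  open SpectralRadius ℝ
  open SymmetricMatrices ℝ

  private
    m : ℕ
    m = suc (suc r)

    m-1 : Carrier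
    m-1 = fromNat (suc r)

  incidence : ∀ H → Vertex H → Edge H → Carrier
  incidence H v e = 𝟙 (does (v ∈? edge H e))

  edgeSum : ∀ H → (Vertex H → Carrier) → Edge H → Carrier
  edgeSum H x e = sum (λ v → incidence H v e * x v)

  adjacency-symmetric : ∀ H → Symmetric (adjacency ℝ m H)
  adjacency-symmetric H i j with i Fin.≟ j | j Fin.≟ i | joined? H i j | joined? H j i
  ... | yes _ | yes _ | _ | _ = refl
  ... | yes i≡j | no j≢i | _ | _ = contradiction (≡.sym i≡j) j≢i
  ... | no i≢j | yes j≡i | _ | _ = contradiction (≡.sym j≡i) i≢j
  ... | no _ | no _ | yes _ | yes _ = refl
  ... | no _ | no _ | no _ | no _ = refl
  ... | no _ | no _ | yes (e , i∈e , j∈e) | no ¬ji = contradiction (e , j∈e , i∈e) ¬ji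
  ... | no _ | no _ | no ¬ij | yes (e , j∈e , i∈e) = contradiction (e , i∈e , j∈e) ¬ij

  0≤adjacency : ∀ H i j → 0# ≤ adjacency ℝ m H i j
  0≤adjacency H i j with i Fin.≟ j | joined? H i j
  ... | yes _ | _ = ≤-refl
  ... | no _ | no _ = ≤-refl
  ... | no _ | yes _ = proj₁ (0<x⁻¹ (0<fromNat r))

  incidence-yes : ∀ H {v e} → v ∈ edge H e → incidence H v e ≈ 1#
  incidence-yes H {v} {e} v∈e = trans (reflexive (≡.cong 𝟙 (dec-true (v ∈? edge H e) v∈e))) (+-identityʳ 1#)

  incidence-no : ∀ H {v e} → ¬ v ∈ edge H e → incidence H v e ≈ 0#
  incidence-no H {v} {e} v∉e = reflexive (≡.cong 𝟙 (dec-false (v ∈? edge H e) v∉e))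

  incidence-idem : ∀ H v e → incidence H v e * incidence H v e ≈ incidence H v e
  incidence-idem H v e with v ∈? edge H e
  ... | yes _ = solve 0 (♯ 1 :* ♯ 1 := ♯ 1) refl
  ... | no _ = zeroˡ _

  module _ (H : Hypergraph) (once : MeetOnce H) where

    -- Two distinct vertices lie in at most one common edge, so the number of common edges is itself
    -- the indicator of adjacency. The factor `1# - δ j i` removes the diagonal.
    adjacency-entry : ∀ i j → m-1 * adjacency ℝ m H i j
                              ≈ (1# - δ j i) * sum (λ e → incidence H i e * incidence H j e)
    adjacency-entry i j with i Fin.≟ j | joined? H i j
    ... | yes ≡.refl | _ = trans (zeroʳ m-1) (sym (trans
            (*-congʳ (trans (+-congˡ (-‿cong (δ-refl i))) (-‿inverseʳ 1#))) (zeroˡ _)))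
    ... | no i≢j | no ¬ij = trans (zeroʳ m-1) (sym (trans
            (*-congˡ (sum-zero {size H} common≈0)) (zeroʳ _)))
      where
      common≈0 : ∀ e → incidence H i e * incidence H j e ≈ 0#
      common≈0 e with i ∈? edge H e | j ∈? edge H e
      ... | yes i∈e | yes j∈e = contradiction (e , i∈e , j∈e) ¬ij
      ... | yes _ | no _ = zeroʳ _
      ... | no _ | _ = zeroˡ _
    ... | no i≢j | yes (e₀ , i∈e₀ , j∈e₀) = begin-equality
      m-1 * m-1 ⁻¹
        ≈⟨ ⁻¹-inverse (>⇒≉0 (0<fromNat r)) ⟩
      1#
        ≈⟨ sum-δ e₀ (λ _ → 1#) ⟨
      sum (λ e → δ e e₀ * 1#)
        ≈⟨ sum-cong {size H} (λ e → trans (*-identityʳ _) (common e)) ⟩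
      sum (λ e → incidence H i e * incidence H j e)
        ≈⟨ *-identityˡ _ ⟨
      1# * sum (λ e → incidence H i e * incidence H j e)
        ≈⟨ *-congʳ (sym (trans (+-congˡ (trans (-‿cong (δ-≢ (i≢j ∘ ≡.sym))) -0≈0)) (+-identityʳ 1#))) ⟩
      (1# - δ j i) * sum (λ e → incidence H i e * incidence H j e) ∎
      where
      open ≤-Reasoning
      common : ∀ e → δ e e₀ ≈ incidence H i e * incidence H j e
      common e with e Fin.≟ e₀
      ... | yes ≡.refl = trans (+-identityʳ 1#) (sym (trans
              (*-cong (incidence-yes H i∈e₀) (incidence-yes H j∈e₀)) (*-identityˡ 1#)))
      ... | no e≢e₀ with i ∈? edge H e | j ∈? edge H e
      ...   | yes i∈e | yes j∈e = contradiction (once i≢j i∈e j∈e i∈e₀ j∈e₀) e≢e₀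
      ...   | yes _ | no _ = sym (zeroʳ _)
      ...   | no _ | _ = sym (zeroˡ _)

    -- The neighbours of `i` are collected edge by edge; each edge sum contains `x i` itself, which
    -- is subtracted.
    adjacency-operator : ∀ x i → m-1 * (adjacency ℝ m H ·ᴿ x) i
                                 ≈ sum (λ e → incidence H i e * (edgeSum H x e - x i))
    adjacency-operator x i = begin-equality
      m-1 * sum (λ j → adjacency ℝ m H i j * x j)
        ≈⟨ *-distribˡ-sum {order H} m-1 _ ⟩
      sum (λ j → m-1 * (adjacency ℝ m H i j * x j))
        ≈⟨ sum-cong {order H} (λ j → trans (sym (*-assoc m-1 _ _)) (trans
             (*-congʳ (trans (adjacency-entry i j) (*-distribˡ-sum {size H} _ _)))
             (*-distribʳ-sum {size H} (x j) _))) ⟩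
      sum (λ j → sum (λ e → (1# - δ j i) * (incidence H i e * incidence H j e) * x j))
        ≈⟨ ∑-comm {order H} {size H} _ ⟩
      sum (λ e → sum (λ j → (1# - δ j i) * (incidence H i e * incidence H j e) * x j))
        ≈⟨ sum-cong {size H} edgewise ⟩
      sum (λ e → incidence H i e * (edgeSum H x e - x i)) ∎
      where
      open ≤-Reasoning
      edgewise : ∀ e → sum (λ j → (1# - δ j i) * (incidence H i e * incidence H j e) * x j)
                       ≈ incidence H i e * (edgeSum H x e - x i)
      edgewise e = begin-equality
        sum (λ j → (1# - δ j i) * (incidence H i e * incidence H j e) * x j)
          ≈⟨ sum-cong {order H} (λ j → trans
               (*-congʳ (*-congʳ (+-congʳ (sym (+-identityʳ 1#)))))
               (solve 4 (λ d a b x → (♯ 1 :- d) :* (a :* b) :* x := a :* (b :* x) :- d :* (a :* (b :* x)))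
                  refl (δ j i) (incidence H i e) (incidence H j e) (x j))) ⟩
        sum (λ j → incidence H i e * (incidence H j e * x j) - δ j i * (incidence H i e * (incidence H j e * x j)))
          ≈⟨ sum-distrib-sub {order H} _ _ ⟩
        sum (λ j → incidence H i e * (incidence H j e * x j))
          - sum (λ j → δ j i * (incidence H i e * (incidence H j e * x j)))
          ≈⟨ +-cong (sym (*-distribˡ-sum {order H} _ _)) (-‿cong (sum-δ i _)) ⟩
        incidence H i e * edgeSum H x e - incidence H i e * (incidence H i e * x i)
          ≈⟨ +-congˡ (-‿cong (trans (sym (*-assoc _ _ _)) (*-congʳ (incidence-idem H i e)))) ⟩
        incidence H i e * edgeSum H x e - incidence H i e * x i
          ≈⟨ solve 3 (λ a s x → a :* s :- a :* x := a :* (s :- x)) refl (incidence H i e) (edgeSum H x e) (x i) ⟩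
        incidence H i e * (edgeSum H x e - x i) ∎

  module Presented {H n k} {A B : Fin k → Fin n} (P : Presentation H r A B) where
    open Presentation P

    incidence-old : ∀ u e → incidence H (old u) (at e) ≈ δ u (A e) + δ u (B e)
    incidence-old u e with u Fin.≟ A e | u Fin.≟ B e
    ... | yes u≡A | yes u≡B = contradiction (≡.trans (≡.sym u≡A) u≡B) (A≢B e)
    ... | yes u≡A | no _ = trans (incidence-yes H (Equivalence.from (old∈ u e) (inj₁ u≡A)))
            (sym (trans (+-identityʳ _) (+-identityʳ 1#)))
    ... | no _ | yes u≡B = trans (incidence-yes H (Equivalence.from (old∈ u e) (inj₂ u≡B)))
            (sym (trans (+-identityˡ _) (+-identityʳ 1#)))
    ... | no u≢A | no u≢B = trans (incidence-no H (λ u∈e → [ u≢A , u≢B ]′ (Equivalence.to (old∈ u e) u∈e)))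
            (sym (+-identityˡ 0#))

    incidence-new : ∀ f i e → incidence H (new f i) (at e) ≈ δ f e
    incidence-new f i e with f Fin.≟ e
    ... | yes f≡e = trans (incidence-yes H (Equivalence.from (new∈ f i e) f≡e)) (sym (+-identityʳ 1#))
    ... | no f≢e = incidence-no H (f≢e ∘ Equivalence.to (new∈ f i e))

    edgeSum-at : ∀ x e → edgeSum H x (at e) ≈ x (old (A e)) + x (old (B e)) + sum (λ i → x (new e i))
    edgeSum-at x e = begin-equality
      edgeSum H x (at e)
        ≈⟨ sum-reindex vertices _ ⟩
      sum (λ u → incidence H (old u) (at e) * x (old u))
        + sum (λ f → sum (λ i → incidence H (new f i) (at e) * x (new f i)))
        ≈⟨ +-cong
             (sum-cong {n} λ u → trans (*-congʳ (incidence-old u e)) (distribʳ _ _ _))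
             (sum-cong {k} λ f → trans
               (sum-cong {r} λ i → *-congʳ (incidence-new f i e))
               (sym (*-distribˡ-sum {r} (δ f e) _))) ⟩
      sum (λ u → δ u (A e) * x (old u) + δ u (B e) * x (old u))
        + sum (λ f → δ f e * sum (λ i → x (new f i)))
        ≈⟨ +-cong (trans (∑-distrib-+ {n} _ _) (+-cong (sum-δ (A e) _) (sum-δ (B e) _))) (sum-δ e _) ⟩
      x (old (A e)) + x (old (B e)) + sum (λ i → x (new e i)) ∎
      where open ≤-Reasoning

    module _ (once : MeetOnce H) where
      private
        sum-at : ∀ (f : Edge H → Carrier) → sum f ≈ sum (λ e → f (at e))
        sum-at f = sum-permute f edges

      adjacency-old : ∀ x u → m-1 * (adjacency ℝ m H ·ᴿ x) (old u)
                              ≈ sum (λ e → (δ u (A e) + δ u (B e)) * (edgeSum H x (at e) - x (old u)))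
      adjacency-old x u = trans (adjacency-operator H once x (old u)) (trans (sum-at _)
        (sum-cong {k} λ e → *-congʳ (incidence-old u e)))

      adjacency-new : ∀ x f i → m-1 * (adjacency ℝ m H ·ᴿ x) (new f i) ≈ edgeSum H x (at f) - x (new f i)
      adjacency-new x f i = trans (adjacency-operator H once x (new f i)) (trans (sum-at _) (trans
        (sum-cong {k} λ e → *-congʳ (trans (incidence-new f i e) (δ-sym f e)))
        (sum-δ f _)))

-- Eliminating and restoring the new vertices of a power.

module PowerSpectrum {c ℓ₁ ℓ₂} (ℝ : CompleteOrderedField c ℓ₁ ℓ₂) (r : ℕ) {n k} {A B : Fin k → Fin n}
  (H : Hypergraph) (once : MeetOnce H) (P : Presentation H r A B) where
  open OrderedField ℝ
  open FiniteSums ℝ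
  open EdgeForms ℝ
  open SpectralRadius ℝ
  open SymmetricMatrices ℝ
  open AdjacencyOperator ℝ r
  open PerronRoot ℝ using (s; θ)
  open Presentation P
  open Presented P

  private
    R m-1 : Carrier
    R = fromNat r
    m-1 = fromNat (suc r)

    vertex-cases : (Q : Vertex H → Set ℓ₁) → (∀ u → Q (old u)) → (∀ f i → Q (new f i)) → ∀ v → Q v
    vertex-cases Q q-old q-new v with Inverse.from vertices v in eq
    ... | inj₁ u = ≡.subst Q (Inverse.inverseˡ vertices (≡.sym eq)) (q-old u)
    ... | inj₂ (f , i) = ≡.subst Q (Inverse.inverseˡ vertices (≡.sym eq)) (q-new f i)

    δ-transport : ∀ (f : Fin n → Carrier) u v → δ u v * f v ≈ δ u v * f u
    δ-transport f u v with u Fin.≟ v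
    ... | yes ≡.refl = refl
    ... | no _ = trans (zeroˡ _) (sym (zeroˡ _))

    -- Both ends of e contribute s (x (A e) + x (B e)) - t x u at u, and R = s - t.
    flow-term : ∀ {ν} (x : Fin n → Carrier) u e →
      (δ u (A e) + δ u (B e)) * (s ν R * (x (A e) + x (B e)) - (ν + fromNat 1) * x u)
      ≈ δ u (A e) * (R * x u + s ν R * x (B e)) + δ u (B e) * (R * x u + s ν R * x (A e))
    flow-term {ν} x u e = begin-equality
      (a + b) * (S * (xA + xB) - (ν + fromNat 1) * x u)
        ≈⟨ solve 7 (λ ν r a b x y z → (a :+ b) :* ((ν :+ r :+ ♯ 1) :* (x :+ y) :- (ν :+ ♯ 1) :* z)
             := (ν :+ r :+ ♯ 1) :* (a :* x) :+ a :* ((ν :+ r :+ ♯ 1) :* y :- (ν :+ ♯ 1) :* z)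
                :+ ((ν :+ r :+ ♯ 1) :* (b :* y) :+ b :* ((ν :+ r :+ ♯ 1) :* x :- (ν :+ ♯ 1) :* z)))
             refl ν R a b xA xB (x u) ⟩
      S * (a * xA) + a * (S * xB - (ν + fromNat 1) * x u)
        + (S * (b * xB) + b * (S * xA - (ν + fromNat 1) * x u))
        ≈⟨ +-cong (+-congʳ (*-congˡ (δ-transport x u (A e)))) (+-congʳ (*-congˡ (δ-transport x u (B e)))) ⟩
      S * (a * x u) + a * (S * xB - (ν + fromNat 1) * x u)
        + (S * (b * x u) + b * (S * xA - (ν + fromNat 1) * x u))
        ≈⟨ solve 7 (λ ν r a b x y z →
             (ν :+ r :+ ♯ 1) :* (a :* z) :+ a :* ((ν :+ r :+ ♯ 1) :* y :- (ν :+ ♯ 1) :* z)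
                :+ ((ν :+ r :+ ♯ 1) :* (b :* z) :+ b :* ((ν :+ r :+ ♯ 1) :* x :- (ν :+ ♯ 1) :* z))
             := a :* (r :* z :+ (ν :+ r :+ ♯ 1) :* y) :+ b :* (r :* z :+ (ν :+ r :+ ♯ 1) :* x))
             refl ν R a b xA xB (x u) ⟩
      a * (R * x u + S * xB) + b * (R * x u + S * xA) ∎
      where
      open ≤-Reasoning
      S = s ν R
      a = δ u (A e)
      b = δ u (B e)
      xA = x (A e)
      xB = x (B e)

  module _ {ρ} (y : Vertex H → Carrier) (0≤y : ∀ v → 0# ≤ y v) (v₀ : Vertex H) (0<yv₀ : 0# < y v₀)
    (subeigen : ∀ v → ρ * y v ≤ (adjacency ℝ (2 ℕ.+ r) H ·ᴿ y) v)
    (0<t : 0# < m-1 * ρ - R + fromNat 1) where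

    private
      ν t μ S : Carrier
      ν = m-1 * ρ - R
      t = ν + fromNat 1
      μ = m-1 * ρ
      S = s ν R

      x : Fin n → Carrier
      x = y ∘ old

      E : Fin k → Carrier
      E e = edgeSum H y (at e)

      0≤m-1 : 0# ≤ m-1
      0≤m-1 = 0≤fromNat (suc r)

      0<S : 0# < S
      0<S = <-respʳ-≈ (solve 2 (λ ν r → ν :+ ♯ 1 :+ r := ν :+ r :+ ♯ 1) refl ν R) (0<x+y 0<t (0≤fromNat r))

      scaled : ∀ v → μ * y v ≤ m-1 * (adjacency ℝ (2 ℕ.+ r) H ·ᴿ y) v
      scaled v = ≤-trans (≤-reflexive (*-assoc m-1 ρ (y v))) (*-monoˡ-≤ 0≤m-1 (subeigen v))

      new-bound : ∀ f i → S * y (new f i) ≤ E f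
      new-bound f i = 0≤d⇒x≤y (x≤y⇒0≤y-x (≤-respʳ-≈ (adjacency-new once y f i) (scaled (new f i))))
        (solve 4 (λ μ r e z → e := (μ :- r :+ r :+ ♯ 1) :* z :+ (e :- z :- μ :* z)) refl μ R (E f) (y (new f i)))

      -- With `Z` the sum over the `r` new vertices, `new-bound` gives `S Z ≤ R E`. Hence
      -- `S (x A + x B) = S (E - Z) ≥ (S - R) E`, and `S - R = t`.
      edge-bound : ∀ e → t * E e ≤ S * (x (A e) + x (B e))
      edge-bound e = 0≤d⇒x≤y (x≤y⇒0≤y-x SZ≤RE) (begin-equality
        S * (x (A e) + x (B e))
          ≈⟨ solve 3 (λ s xs z → s :* xs := s :* (xs :+ z) :- s :* z) refl S (x (A e) + x (B e)) Z ⟩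
        S * (x (A e) + x (B e) + Z) - S * Z
          ≈⟨ +-congʳ (*-congˡ (edgeSum-at y e)) ⟨
        S * E e - S * Z
          ≈⟨ solve 4 (λ ν r e z → (ν :+ r :+ ♯ 1) :* e :- z := (ν :+ ♯ 1) :* e :+ (r :* e :- z))
               refl ν R (E e) (S * Z) ⟩
        t * E e + (R * E e - S * Z) ∎)
        where
        open ≤-Reasoning
        Z = sum (λ i → y (new e i))

        SZ≤RE : S * Z ≤ R * E e
        SZ≤RE = ≤-trans (≤-reflexive (*-distribˡ-sum {r} S _))
          (≤-respʳ-≈ (sum-const r (E e)) (sum-mono-≤ {r} (new-bound e)))

    -- The inequality at an old vertex is multiplied by `t > 0`, which turns `μ` into `θ = t μ` and
    -- lets `edge-bound` replace every edge sum by values at the two ends.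
    graph-subeigen : ∀ u → θ ν R * y (old u) ≤ flow A B R (s ν R) (y ∘ old) u
    graph-subeigen u = begin
      θ ν R * x u
        ≈⟨ solve 3 (λ μ r x → (μ :- r :+ ♯ 1) :* (μ :- r :+ r) :* x := (μ :- r :+ ♯ 1) :* (μ :* x)) refl μ R (x u) ⟩
      t * (μ * x u)
        ≤⟨ *-monoˡ-≤ (proj₁ 0<t) (≤-respʳ-≈ (adjacency-old once y u) (scaled (old u))) ⟩
      t * sum (λ e → (δ u (A e) + δ u (B e)) * (E e - x u))
        ≈⟨ *-distribˡ-sum {k} t _ ⟩
      sum (λ e → t * ((δ u (A e) + δ u (B e)) * (E e - x u)))
        ≤⟨ sum-mono-≤ {k} (λ e → begin
             t * ((δ u (A e) + δ u (B e)) * (E e - x u))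
               ≈⟨ solve 4 (λ t d e x → t :* (d :* (e :- x)) := d :* (t :* e :- t :* x)) refl
                    t (δ u (A e) + δ u (B e)) (E e) (x u) ⟩
             (δ u (A e) + δ u (B e)) * (t * E e - t * x u)
               ≤⟨ *-monoˡ-≤ (0≤x+y (0≤δ u (A e)) (0≤δ u (B e))) (+-monoˡ-≤ (- (t * x u)) (edge-bound e)) ⟩
             (δ u (A e) + δ u (B e)) * (S * (x (A e) + x (B e)) - t * x u)
               ≈⟨ flow-term x u e ⟩
             _ ∎) ⟩
      flow A B R S x u ∎
      where open ≤-Reasoning

    -- The vector could a priori be supported on new vertices. But a positive value there makes the
    -- edge sum positive, and by `edge-bound` the two ends cannot then both be non-positive.
    graph-nonzero : 0# < sum (λ u → y (old u) * y (old u))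
    graph-nonzero = let u , 0<xu = positive in
      <-≤-trans (0<x*y 0<xu 0<xu) (term≤sum {n} (λ u → 0≤x² (x u)) u)
      where
      open ≤-Reasoning

      positive-end : ∀ e → 0# < E e → ∃[ u ] 0# < x u
      positive-end e 0<E with ≤-or-> (x (A e)) 0# | ≤-or-> (x (B e)) 0#
      ... | inj₂ 0<xA | _ = A e , 0<xA
      ... | _ | inj₂ 0<xB = B e , 0<xB
      ... | inj₁ xA≤0 | inj₁ xB≤0 = contradiction (begin
            t * E e                  ≤⟨ edge-bound e ⟩
            S * (x (A e) + x (B e))  ≤⟨ *-monoˡ-≤ (proj₁ 0<S) (+-mono-≤ xA≤0 xB≤0) ⟩
            S * (0# + 0#)            ≈⟨ trans (*-congˡ (+-identityˡ 0#)) (zeroʳ S) ⟩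
            0#                       ∎) (<⇒≱ (0<x*y 0<t 0<E))

      positive : ∃[ u ] 0# < x u
      positive with Inverse.from vertices v₀ in eq
      ... | inj₁ u = u , ≡.subst (λ v → 0# < y v) (≡.sym (Inverse.inverseˡ vertices (≡.sym eq))) 0<yv₀
      ... | inj₂ (f , i) = positive-end f (<-≤-trans
              (0<x*y 0<S (≡.subst (λ v → 0# < y v) (≡.sym (Inverse.inverseˡ vertices (≡.sym eq))) 0<yv₀))
              (new-bound f i))

  module _ {ν} (0<ν : 0# < ν) (w : Fin n → Carrier) (u₀ : Fin n) (0<w : 0# < w u₀)
    (eigen : ∀ u → θ ν R * w u ≈ flow A B R (s ν R) w u) where

    private
      t S : Carrier
      t = ν + fromNat 1
      S = s ν R

      0<m-1 : 0# < m-1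
      0<m-1 = 0<fromNat r

      -- The elimination read backwards and scaled by `t`: the edge sum becomes `S (w A + w B)`, and
      -- a new vertex carries this divided by `S`.
      lifted : Fin n ⊎ (Fin k × Fin r) → Carrier
      lifted (inj₁ u) = t * w u
      lifted (inj₂ (e , _)) = w (A e) + w (B e)

      x : Vertex H → Carrier
      x v = lifted (Inverse.from vertices v)

      x-old : ∀ u → x (old u) ≡ t * w u
      x-old u = ≡.cong lifted (Inverse.inverseʳ vertices ≡.refl)

      x-new : ∀ e i → x (new e i) ≡ w (A e) + w (B e)
      x-new e i = ≡.cong lifted (Inverse.inverseʳ vertices ≡.refl)

      edgeSum-x : ∀ e → edgeSum H x (at e) ≈ S * (w (A e) + w (B e))
      edgeSum-x e = begin-equality
        edgeSum H x (at e)
          ≈⟨ edgeSum-at x e ⟩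
        x (old (A e)) + x (old (B e)) + sum (λ i → x (new e i))
          ≈⟨ +-cong (+-cong (reflexive (x-old (A e))) (reflexive (x-old (B e))))
                    (trans (sum-cong {r} λ i → reflexive (x-new e i)) (sum-const r _)) ⟩
        t * w (A e) + t * w (B e) + R * (w (A e) + w (B e))
          ≈⟨ solve 4 (λ ν r a b → (ν :+ ♯ 1) :* a :+ (ν :+ ♯ 1) :* b :+ r :* (a :+ b)
                              := (ν :+ r :+ ♯ 1) :* (a :+ b))
               refl ν R (w (A e)) (w (B e)) ⟩
        S * (w (A e) + w (B e)) ∎
        where open ≤-Reasoning

      eigen-x : ∀ v → m-1 * (adjacency ℝ (2 ℕ.+ r) H ·ᴿ x) v ≈ (ν + R) * x v
      eigen-x = vertex-cases _
        (λ u → begin-equality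
          m-1 * (adjacency ℝ (2 ℕ.+ r) H ·ᴿ x) (old u)
            ≈⟨ adjacency-old once x u ⟩
          sum (λ e → (δ u (A e) + δ u (B e)) * (edgeSum H x (at e) - x (old u)))
            ≈⟨ sum-cong {k} (λ e → trans
                 (*-congˡ (+-cong (edgeSum-x e) (-‿cong (reflexive (x-old u))))) (flow-term w u e)) ⟩
          flow A B R S w u
            ≈⟨ eigen u ⟨
          θ ν R * w u
            ≈⟨ solve 3 (λ ν r w → (ν :+ ♯ 1) :* (ν :+ r) :* w := (ν :+ r) :* ((ν :+ ♯ 1) :* w)) refl ν R (w u) ⟩
          (ν + R) * (t * w u)
            ≈⟨ *-congˡ (reflexive (x-old u)) ⟨
          (ν + R) * x (old u) ∎)
        (λ f i → begin-equality
          m-1 * (adjacency ℝ (2 ℕ.+ r) H ·ᴿ x) (new f i)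
            ≈⟨ adjacency-new once x f i ⟩
          edgeSum H x (at f) - x (new f i)
            ≈⟨ +-cong (edgeSum-x f) (-‿cong (reflexive (x-new f i))) ⟩
          S * (w (A f) + w (B f)) - (w (A f) + w (B f))
            ≈⟨ solve 3 (λ ν r x → (ν :+ r :+ ♯ 1) :* x :- x := (ν :+ r) :* x) refl ν R (w (A f) + w (B f)) ⟩
          (ν + R) * (w (A f) + w (B f))
            ≈⟨ *-congˡ (reflexive (x-new f i)) ⟨
          (ν + R) * x (new f i) ∎)
        where open ≤-Reasoning

    eigenvalue-bound : ∀ {ρ} → IsSpectralRadius (adjacency ℝ (2 ℕ.+ r) H) ρ → ν + R ≤ m-1 * ρ
    eigenvalue-bound {ρ} radius = begin
      ν + R                     ≈⟨ cancel (ν + R) ⟨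
      m-1 * ((ν + R) * m-1 ⁻¹)  ≤⟨ *-monoˡ-≤ (proj₁ 0<m-1) (eigenvalue≤spectralRadius radius
                                     (*-nonNegative (0≤x+y (proj₁ 0<ν) (0≤fromNat r)) (proj₁ (0<x⁻¹ 0<m-1)))
                                     x (old u₀) (λ x≈0 → >⇒≉0 (0<x*y (0<x+y 0<ν (0≤fromNat 1)) 0<w)
                                       (trans (reflexive (≡.sym (x-old u₀))) x≈0))
                                     λ v → begin-equality
                                       (adjacency ℝ (2 ℕ.+ r) H ·ᴿ x) v
                                         ≈⟨ cancel _ ⟨
                                       m-1 * ((adjacency ℝ (2 ℕ.+ r) H ·ᴿ x) v * m-1 ⁻¹)
                                         ≈⟨ *-assoc m-1 _ _ ⟨
                                       m-1 * (adjacency ℝ (2 ℕ.+ r) H ·ᴿ x) v * m-1 ⁻¹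
                                         ≈⟨ *-congʳ (eigen-x v) ⟩
                                       (ν + R) * x v * m-1 ⁻¹
                                         ≈⟨ solve 3 (λ a x i → a :* x :* i := a :* i :* x) refl (ν + R) (x v) (m-1 ⁻¹) ⟩
                                       (ν + R) * m-1 ⁻¹ * x v ∎) ⟩
      m-1 * ρ                   ∎
      where
      open ≤-Reasoning
      cancel : ∀ a → m-1 * (a * m-1 ⁻¹) ≈ a
      cancel a = trans (solve 3 (λ m a i → m :* (a :* i) := a :* (m :* i)) refl m-1 a (m-1 ⁻¹))
        (trans (*-congˡ (⁻¹-inverse (>⇒≉0 0<m-1))) (*-identityʳ a))

-- Bounds on the scaled spectral radius `(m - 1) λ`.

module Bounds {c ℓ₁ ℓ₂} (ℝ : CompleteOrderedField c ℓ₁ ℓ₂) (r : ℕ) where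
  open OrderedField ℝ
  open SpectralRadius ℝ
  open SymmetricMatrices ℝ
  open AdjacencyOperator ℝ r using (adjacency-symmetric; 0≤adjacency)

  private
    R m-1 : Carrier
    R = fromNat r
    m-1 = fromNat (suc r)

    A[_] : ∀ X → Matrix (order X)
    A[ X ] = adjacency ℝ (2 ℕ.+ r) X

  module _ {l} {X} (once : MeetOnce X) {B} (P : Presentation X r (tail {l}) B) where
    open Extremal ℝ r l
    open Presentation P

    module _ {ρ y} (sub : Subeigenvector A[ X ] ρ y) (dominated : ∀ e → y (old (B e)) ≤ y (old (head e))) where
      private
        0≤y = proj₁ sub
        v₀ = proj₁ (proj₁ (proj₂ sub))
        0<yv₀ = proj₂ (proj₁ (proj₂ sub))
        subeigen = proj₂ (proj₂ sub)
        ν′ : Carrier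
        ν′ = m-1 * ρ - R

        ν′+R : m-1 * ρ ≈ ν′ + R
        ν′+R = solve 2 (λ μ r → μ := μ :- r :+ r) refl (m-1 * ρ) R

        module S = PowerSpectrum ℝ r X once P

        Conclusion : Set _
        Conclusion = m-1 * ρ ≤ ν + R × (m-1 * ρ ≈ ν + R → B 1F ≡ 1F → B 3F ≢ 0F → ∀ e → B e ≡ head e)

        large : 0# < ν′ + fromNat 1 → Conclusion
        large 0<t =
          ≤-trans (≤-reflexive ν′+R) (+-monoˡ-≤ R (ν′≤ν B 0<t x 0≤x nonzero graph dominated)) ,
          λ μ≈ → equality B 0<t x 0≤x nonzero graph dominated (begin-equality
            m-1 * ρ - R  ≈⟨ +-congʳ μ≈ ⟩
            ν + R - R    ≈⟨ solve 2 (λ ν r → ν :+ r :- r := ν) refl ν R ⟩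
            ν            ∎)
          where
          open ≤-Reasoning
          x : Fin (4 ℕ.+ l) → Carrier
          x u = y (old u)
          0≤x = λ u → 0≤y (old u)
          nonzero = S.graph-nonzero y 0≤y v₀ 0<yv₀ subeigen 0<t
          graph = S.graph-subeigen y 0≤y v₀ 0<yv₀ subeigen 0<t

        small : ν′ + fromNat 1 ≤ 0# → Conclusion
        small t≤0 = proj₁ μ<ν+R , λ μ≈ → contradiction μ≈ (<⇒≉ μ<ν+R)
          where
          μ<ν+R : m-1 * ρ < ν + R
          μ<ν+R = 0<d⇒x<y (0<x+y 0<ν (0≤x+y (-x≥0 t≤0) (0≤fromNat 1)))
            (solve 3 (λ μ ν r → ν :+ r := μ :+ (ν :+ (:- (μ :- r :+ ♯ 1) :+ ♯ 1))) refl (m-1 * ρ) ν R)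

      bounds : Conclusion
      bounds = [ small , large ]′ (≤-or-> (ν′ + fromNat 1) 0#)

  module _ {l ν m k one σ} (N<0 : PerronRoot.N ℝ ν R (fromNat l) < 0#)
    (m≈ : m ≈ fromNat 2 + R) (k≈ : k ≈ fromNat 5 + fromNat l) (one≈ : one ≈ fromNat 1) (0≤σ : 0# ≤ σ)
    (σ² : σ * σ ≈ (m + one) * (m + one) + fromNat 4 * (k - fromNat 3) * (m - one)) where

    -- With `q = 2 μ - (m + 1)` one has `4 N = q² - σ²`, so `N < 0` excludes `0 ≤ σ ≤ q`. The number
    -- `one` is a separate parameter because `1#` and the solver constant `fromNat 1` are only
    -- related by `≈`.
    ν-bound : fromNat 2 * (ν + R) < m + one + σ
    ν-bound with ≤-or-> (m + one + σ) (fromNat 2 * (ν + R))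
    ... | inj₂ bound = bound
    ... | inj₁ σ≤ = contradiction (*-cancelˡ-≤ (0<fromNat 3) (0≤d⇒x≤y
          (0≤x+y (*-nonNegative 0≤σ 0≤q-σ) (*-nonNegative (≤-trans 0≤σ σ≤q) 0≤q-σ))
          (begin-equality
            fromNat 4 * N ν R K
              ≈⟨ solve 3 (λ ν r k →
                   ♯ 4 :* (ν :* ν :+ (r :- ♯ 3) :* ν :- ♯ 3 :* r :- (k :+ ♯ 2) :* (r :+ ♯ 1))
                   := (♯ 2 :* (ν :+ r) :- (♯ 2 :+ r :+ ♯ 1)) :* (♯ 2 :* (ν :+ r) :- (♯ 2 :+ r :+ ♯ 1))
                      :- ((♯ 2 :+ r :+ ♯ 1) :* (♯ 2 :+ r :+ ♯ 1) :+ ♯ 4 :* (♯ 5 :+ k :- ♯ 3) :* (♯ 2 :+ r :- ♯ 1)))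
                   refl ν R K ⟩
            q * q - ((fromNat 2 + R + fromNat 1) * (fromNat 2 + R + fromNat 1)
                     + fromNat 4 * (fromNat 5 + K - fromNat 3) * (fromNat 2 + R - fromNat 1))
              ≈⟨ +-congˡ (-‿cong (sym (trans σ² (+-cong (*-cong (+-cong m≈ one≈) (+-cong m≈ one≈))
                   (*-cong (*-congˡ (+-congʳ k≈)) (+-cong m≈ (-‿cong one≈))))))) ⟩
            q * q - σ * σ
              ≈⟨ solve 2 (λ q s → q :* q :- s :* s := ♯ 4 :* ♯ 0 :+ (s :* (q :- s) :+ q :* (q :- s))) refl q σ ⟩
            fromNat 4 * 0# + (σ * (q - σ) + q * (q - σ)) ∎))) (<⇒≱ N<0)
      where
      open ≤-Reasoning
      open PerronRoot ℝ using (N)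
      K q : Carrier
      K = fromNat l
      q = fromNat 2 * (ν + R) - (fromNat 2 + R + fromNat 1)

      σ≤q : σ ≤ q
      σ≤q = 0≤d⇒x≤y (x≤y⇒0≤y-x σ≤) (begin-equality
        fromNat 2 * (ν + R) - (fromNat 2 + R + fromNat 1)
          ≈⟨ +-congˡ (-‿cong (+-cong m≈ one≈)) ⟨
        fromNat 2 * (ν + R) - (m + one)
          ≈⟨ solve 3 (λ a b s → a :- b := s :+ (a :- (b :+ s))) refl (fromNat 2 * (ν + R)) (m + one) σ ⟩
        σ + (fromNat 2 * (ν + R) - (m + one + σ)) ∎)

      0≤q-σ : 0# ≤ q - σ
      0≤q-σ = x≤y⇒0≤y-x σ≤q

-- Assembling the two assertions.

module Main {c ℓ₁ ℓ₂} (ℝ : CompleteOrderedField c ℓ₁ ℓ₂) (r : ℕ) (H : Hypergraph) (tc : TC₁ (2 ℕ.+ r) H) where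
  open OrderedField ℝ
  open SpectralRadius ℝ
  open SymmetricMatrices ℝ
  open AdjacencyOperator ℝ r using (adjacency-symmetric; 0≤adjacency)
  open Bounds ℝ r
  open TC₁ tc

  private
    T : Hypergraph
    T = T₁C (2 ℕ.+ r) (size H ∸ 5) 0 0 0

    R m-1 : Carrier
    R = fromNat r
    m-1 = fromNat (suc r)

    G : Hypergraph
    G = proj₁ inPowers

    ends-of : ∀ e → _
    ends-of e = ∣p∣≡2⇒pair (edge G e) (proj₁ (proj₂ inPowers) e) (edge-nonempty G e)

    A B : Edge G → Vertex G
    A e = proj₁ (ends-of e)
    B e = proj₁ (proj₂ (ends-of e))

    P : Presentation H r A B
    P = presentation-≅ (proj₂ (proj₂ inPowers)) (power-presentation r G A B
      (λ e → proj₁ (proj₂ (proj₂ (ends-of e)))) (λ e → proj₂ (proj₂ (proj₂ (ends-of e)))))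

    once : MeetOnce H
    once = Linear⇒MeetOnce H linear

    label : ∀ {ℓ} {_≼_ : Rel (Vertex G) ℓ} → Total _≼_ → Transitive _≼_ → Labelling A B _≼_
    label total transitive = presentation-labelling total transitive P once connected typeI

    module _ {ℓ} {_≼_ : Rel (Vertex G) ℓ} (L : Labelling A B _≼_) where
      open Labelling L

      labelled : Presentation H r tail B′
      labelled = relabel P ψ φ tail≢B′ ends

      size≡5+l : size H ≡ 5 ℕ.+ l
      size≡5+l = ≡.sym (presentation-size labelled)

      -- The labelling shows `size H ≡ 5 + l`, so the truncated difference `size H ∸ 5` is exactly
      -- `l`.
      PT : Presentation T r (tail {l}) head
      PT = ≡.subst (λ l → Presentation T r (tail {l}) head)
        (≡.trans (ℕ.+-identityʳ _) (≡.cong (_∸ 5) size≡5+l)) (T₁C-presentation r (size H ∸ 5))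

      onceT : MeetOnce T
      onceT = presentation-MeetOnce PT extremal-simple

      open Extremal ℝ r l

      -- The extremal graph is compared with itself: for `B = head` the domination is an equality,
      -- and the general bound applies to the radius of `T`.
      T-bound : ∀ {ρ} → IsSpectralRadius (adjacency ℝ (2 ℕ.+ r) T) ρ → m-1 * ρ ≤ ν + R
      T-bound radius = proj₁ (bounds onceT PT
        (proj₂ (subeigenvector _ (adjacency-symmetric T) (0≤adjacency T) radius)) (λ _ → ≤-refl))

      -- The positive vector `w` lifts to an eigenvector of `T` with eigenvalue `(ν + R) / (m - 1)`.
      T-attained : ∀ {ρ} → IsSpectralRadius (adjacency ℝ (2 ℕ.+ r) T) ρ → ν + R ≤ m-1 * ρ
      T-attained = PowerSpectrum.eigenvalue-bound ℝ r T onceT PT 0<ν w 0F (0<w 0F) eigen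

  maximal : ∀ λH λT → IsSpectralRadius (adjacency ℝ (2 ℕ.+ r) H) λH
            → IsSpectralRadius (adjacency ℝ (2 ℕ.+ r) T) λT → λH ≤ λT × (λH ≈ λT → H ≅ T)
  maximal λH λT radiusH radiusT =
    *-cancelˡ-≤ (0<fromNat r) (≤-trans (proj₁ H-bounds) (T-attained L radiusT)) ,
    λ λH≈λT → presentations⇒≅ (labelled L) (PT L) (proj₂ H-bounds
      (antisym (proj₁ H-bounds) (≤-respʳ-≈ (*-congˡ (sym λH≈λT)) (T-attained L radiusT)))
      B′1≡1 B′3≢0)
    where
    sub = subeigenvector _ (adjacency-symmetric H) (0≤adjacency H) radiusH
    y = proj₁ sub

    L : Labelling A B (λ u v → y (Presentation.old P u) ≤ y (Presentation.old P v))
    L = label (λ u v → total (y (Presentation.old P u)) (y (Presentation.old P v))) ≤-trans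

    open Labelling L

    H-bounds = bounds once (labelled L) (proj₂ sub) dominated

  upper-bound : ∀ λT σ → IsSpectralRadius (adjacency ℝ (2 ℕ.+ r) T) λT →
    IsSqrt ((fromNat (2 ℕ.+ r) + 1#) * (fromNat (2 ℕ.+ r) + 1#)
            + fromNat 4 * (fromNat (size H) - fromNat 3) * (fromNat (2 ℕ.+ r) - 1#)) σ →
    λT < (fromNat (2 ℕ.+ r) + 1# + σ) * (fromNat 2 * fromNat (2 ℕ.+ r) - fromNat 2) ⁻¹
  upper-bound λT σ radiusT (0≤σ , σ²) = *-cancelˡ-< (proj₁ 0<D) (begin-strict
    D * λT                       ≈⟨ *-congʳ D≈ ⟩
    fromNat 2 * m-1 * λT         ≈⟨ *-assoc _ _ _ ⟩
    fromNat 2 * (m-1 * λT)       ≤⟨ *-monoˡ-≤ (0≤fromNat 2) (T-bound L radiusT) ⟩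
    fromNat 2 * (ν + R)          <⟨ ν-bound {l} N<0 m≈ k≈ (sym (+-identityʳ 1#)) 0≤σ σ² ⟩
    fromNat (2 ℕ.+ r) + 1# + σ   ≈⟨ trans (*-congˡ (⁻¹-inverse (>⇒≉0 0<D))) (*-identityʳ _) ⟨
    (fromNat (2 ℕ.+ r) + 1# + σ) * (D * D ⁻¹)
      ≈⟨ solve 3 (λ x d i → x :* (d :* i) := d :* (x :* i)) refl (fromNat (2 ℕ.+ r) + 1# + σ) D (D ⁻¹) ⟩
    D * ((fromNat (2 ℕ.+ r) + 1# + σ) * D ⁻¹) ∎)
    where
    open ≤-Reasoning

    -- Only the number of pendant edges is read off from this labelling, so the trivial preorder
    -- suffices.
    L : Labelling A B (λ _ _ → ⊤)
    L = label (λ _ _ → inj₁ tt) (λ _ _ → tt)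

    open Labelling L
    open Extremal ℝ r l

    D : Carrier
    D = fromNat 2 * fromNat (2 ℕ.+ r) - fromNat 2

    m≈ : fromNat (2 ℕ.+ r) ≈ fromNat 2 + R
    m≈ = fromNat-+ 2 r

    k≈ : fromNat (size H) ≈ fromNat 5 + fromNat l
    k≈ = trans (reflexive (≡.cong fromNat (size≡5+l L))) (fromNat-+ 5 l)

    D≈ : D ≈ fromNat 2 * m-1
    D≈ = begin-equality
      fromNat 2 * fromNat (2 ℕ.+ r) - fromNat 2   ≈⟨ +-congʳ (*-congˡ m≈) ⟩
      fromNat 2 * (fromNat 2 + R) - fromNat 2
        ≈⟨ solve 1 (λ r → ♯ 2 :* (♯ 2 :+ r) :- ♯ 2 := ♯ 2 :* (♯ 1 :+ r)) refl R ⟩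
      fromNat 2 * (fromNat 1 + R)                 ≈⟨ *-congˡ (fromNat-+ 1 r) ⟨
      fromNat 2 * m-1                             ∎

    0<D : 0# < D
    0<D = <-respʳ-≈ (sym D≈) (0<x*y (0<fromNat 1) (0<fromNat r))

theorem5p1p1 : ∀ {c ℓ₁ ℓ₂} (ℝ : CompleteOrderedField c ℓ₁ ℓ₂) →
    let open CompleteOrderedField ℝ
        open SpectralRadius ℝ
    in
    ∀ (m : ℕ) .{{_ : NonTrivial m}} (H : Hypergraph) → TC₁ m H →
    let k = size H
        T = T₁C m (k ∸ 5) 0 0 0
    in
    (∀ (λH λT : Carrier) →
      IsSpectralRadius (adjacency ℝ m H) λH →
      IsSpectralRadius (adjacency ℝ m T) λT →
      λH ≤ λT × (λH ≈ λT → H ≅ T))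
    ×
    (∀ (λT s : Carrier) →
      IsSpectralRadius (adjacency ℝ m T) λT →
      IsSqrt ((fromNat m + 1#) * (fromNat m + 1#)
              + fromNat 4 * (fromNat k - fromNat 3) * (fromNat m - 1#)) s →
      λT < (fromNat m + 1# + s) * (fromNat 2 * fromNat m - fromNat 2) ⁻¹)
theorem5p1p1 ℝ zero {{()}} H tc
theorem5p1p1 ℝ (suc zero) {{()}} H tc
theorem5p1p1 ℝ (suc (suc r)) H tc = Main.maximal ℝ r H tc , Main.upper-bound ℝ r H tc
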